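{- Let $\Sigma$ be a surface with Euler characteristic $\chi(\Sigma)$ and Euler genus $\mathrm{eg}(\Sigma)=2-\chi(\Sigma)$, and let $n(\Sigma)$ be the number of vertices of a minimal quadrangulation of $\Sigma$. If $\Sigma \neq S_0$ and $\Sigma \neq N_2$, then $$n(\Sigma) = \left\lceil \frac{5+\sqrt{25-16\chi(\Sigma)}}{2} \right\rceil = \left\lceil \frac{5+\sqrt{16\,\mathrm{eg}(\Sigma)-7}}{2} \right\rceil.$$ Moreover, $n(S_0)=4$ and $n(N_2)=6$.
   Context: All graphs are simple. A surface is a connected compact 2-manifold without boundary; $S_g$ is the orientable surface of genus $g$ (Euler characteristic $2-2g$) and $N_q$ the nonorientable surface of genus $q$ (Euler characteristic $2-q$). All embeddings are cellular (every face is an open disc). A quadrangulation of $\Sigma$ (quadrangular embedding) is an embedding of a simple graph in $\Sigma$ in which every face is bounded by a $4$-cycle. A quadrangulation of $\Sigma$ is minimal if there is no quadrangular embedding in $\Sigma$ of a simple graph with fewer vertices. -}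

module Defs where

open import Data.Nat using (ℕ; zero; suc; _<_; _≤_; NonZero)
open import Data.Integer as ℤ using (ℤ; +_) renaming (_+_ to _ℤ+_; _-_ to _ℤ-_; _*_ to _ℤ*_; _≤_ to _ℤ≤_; _<_ to _ℤ<_)
open import Data.Fin using (Fin)
open import Data.Bool using (Bool)
open import Data.Product using (Σ; ∃; _×_; _,_)
open import Data.Sum using (_⊎_)
open import Relation.Nullary using (¬_)
open import Relation.Binary.PropositionalEquality using (_≡_; _≢_)
open import Relation.Binary.Construct.Closure.ReflexiveTransitive using (Star)

-- Surfaces, classified: S g (orientable, genus g), N q (nonorientable,
-- genus q ≥ 1).

data Surface : Set where
  S : (g : ℕ) → Surface
  N : (q : ℕ) → .{{NonZero q}} → Surface

eulerChar : Surface → ℤ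
eulerChar (S g) = + 2 ℤ- (+ 2 ℤ* + g)
eulerChar (N q) = + 2 ℤ- + q

eulerGenus : Surface → ℕ
eulerGenus (S g) = 2 Data.Nat.* g
eulerGenus (N q) = q

-- Cellular embeddings of graphs, encoded combinatorially as
-- graph-encoded maps (gems / flag systems): a nonempty finite set of
-- flags Fin nF with three fixed-point-free involutions t0 t1 t2 such
-- that t0,t2 commute and t0∘t2 is fixed-point-free, and the group
-- ⟨t0,t1,t2⟩ acts transitively.  Vertices / edges / faces are the
-- orbits of ⟨t1,t2⟩ / ⟨t0,t2⟩ / ⟨t0,t1⟩; we record them through
-- explicit surjective labellings whose fibres are exactly the orbits.

module _ {n : ℕ} where
  Step012 : (t0 t1 t2 : Fin n → Fin n) → Fin n → Fin n → Set
  Step012 t0 t1 t2 x y = (y ≡ t0 x ⊎ y ≡ t1 x) ⊎ y ≡ t2 x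
  Step12 Step02 Step01 : (s t : Fin n → Fin n) → Fin n → Fin n → Set
  Step12 t1 t2 x y = y ≡ t1 x ⊎ y ≡ t2 x
  Step02 t0 t2 x y = y ≡ t0 x ⊎ y ≡ t2 x
  Step01 t0 t1 x y = y ≡ t0 x ⊎ y ≡ t1 x

record Map : Set where
  field
    nF : ℕ
    nonempty : 0 < nF
    t0 t1 t2 : Fin nF → Fin nF
    inv0 : ∀ x → t0 (t0 x) ≡ x
    inv1 : ∀ x → t1 (t1 x) ≡ x
    inv2 : ∀ x → t2 (t2 x) ≡ x
    fpf0 : ∀ x → t0 x ≢ x
    fpf1 : ∀ x → t1 x ≢ x
    fpf2 : ∀ x → t2 x ≢ x
    comm02 : ∀ x → t0 (t2 x) ≡ t2 (t0 x)
    fpf02 : ∀ x → t0 (t2 x) ≢ x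

    connected : ∀ x y → Star (Step012 t0 t1 t2) x y
    V : ℕ
    vert : Fin nF → Fin V
    vert-surj : ∀ v → ∃ λ x → vert x ≡ v
    vert-orb : ∀ x y → (vert x ≡ vert y → Star (Step12 t1 t2) x y) × (Star (Step12 t1 t2) x y → vert x ≡ vert y)
    E : ℕ
    edge : Fin nF → Fin E
    edge-surj : ∀ e → ∃ λ x → edge x ≡ e
    edge-orb : ∀ x y → (edge x ≡ edge y → Star (Step02 t0 t2) x y) × (Star (Step02 t0 t2) x y → edge x ≡ edge y)
    F : ℕ
    face : Fin nF → Fin F
    face-surj : ∀ f → ∃ λ x → face x ≡ f
    face-orb : ∀ x y → (face x ≡ face y → Star (Step01 t0 t1) x y) × (Star (Step01 t0 t1) x y → face x ≡ face y)

open Map public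

mapEulerChar : Map → ℤ
mapEulerChar M = (+ V M ℤ- + E M) ℤ+ + F M

-- The surface is orientable iff the flag graph is bipartite
Orientable : Map → Set
Orientable M = Σ (Fin (nF M) → Bool) λ c →
  ∀ x → (c (t0 M x) ≢ c x) × (c (t1 M x) ≢ c x) × (c (t2 M x) ≢ c x)

-- The map is a cellular embedding into the surface Σ'
-- (surfaces are determined by orientability and Euler characteristic)
EmbeddedIn : Map → Surface → Set
EmbeddedIn M (S g) = Orientable M × mapEulerChar M ≡ eulerChar (S g)
EmbeddedIn M (N q) = ¬ Orientable M × mapEulerChar M ≡ eulerChar (N q)

-- The embedded graph (vertices Fin V, edge e joins vert x and vert (t0 x)
-- for any flag x of e) is simple: no loops, no parallel edges.
SimpleGraph : Map → Set
SimpleGraph M =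
  (∀ x → vert M (t0 M x) ≢ vert M x) ×
  (∀ x y → vert M x ≡ vert M y → vert M (t0 M x) ≡ vert M (t0 M y) → edge M x ≡ edge M y)

-- Every face is bounded by a 4-cycle: walking around the face
-- (ρ = t1 ∘ t0 moves to the next corner) returns after 4 steps and
-- visits 4 pairwise distinct vertices.
Quadrangular : Map → Set
Quadrangular M = ∀ x →
    ρ (ρ (ρ (ρ x))) ≡ x
  × v x ≢ v (ρ x) × v x ≢ v (ρ (ρ x)) × v x ≢ v (ρ (ρ (ρ x)))
  × v (ρ x) ≢ v (ρ (ρ x)) × v (ρ x) ≢ v (ρ (ρ (ρ x)))
  × v (ρ (ρ x)) ≢ v (ρ (ρ (ρ x)))
  where
    ρ : Fin (nF M) → Fin (nF M)
    ρ y = t1 M (t0 M y)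
    v = vert M

Quadrangulation : Surface → Set
Quadrangulation Σ' = Σ Map λ M → SimpleGraph M × Quadrangular M × EmbeddedIn M Σ'

numVertices : ∀ {Σ'} → Quadrangulation Σ' → ℕ
numVertices (M , _) = V M

MinQuadVertices : Surface → ℕ → Set
MinQuadVertices Σ' k =
  (Σ (Quadrangulation Σ') λ Q → numVertices Q ≡ k) ×
  (∀ (Q : Quadrangulation Σ') → k ≤ numVertices Q)

-- k = ⌈(5 + √D)/2⌉  (for D ≥ 0), written without reals:
-- (5+√D)/2 ≤ k  ⇔  2k-5 ≥ 0 ∧ (2k-5)² ≥ D,
-- k - 1 < (5+√D)/2  ⇔  2k-7 < 0 ∨ (2k-7)² < D.
IsCeilHalf5PlusSqrt : ℤ → ℕ → Set
IsCeilHalf5PlusSqrt D k =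
  (+ 0 ℤ≤ a × D ℤ≤ a ℤ* a) × (b ℤ< + 0 ⊎ b ℤ* b ℤ< D)
  where
    a = + (2 Data.Nat.* k) ℤ- + 5
    b = + (2 Data.Nat.* k) ℤ- + 7

{-# OPTIONS --safe #-}
module Submission where

-- Lower bound. A quadrangulation with n vertices has E = 2F, so Euler's formula
-- gives E = 2(n − χ), and E ≤ n(n − 1)/2 becomes n ≥ (5 + √(25 − 16χ))/2. On the
-- Klein bottle this leaves n = 5, where the graph is K₅ with five faces, each
-- missing exactly one vertex; a finite check shows that any such embedding is
-- orientable.
--
-- Upper bound. Removing faces a₁b₁a₂b₂ and a₃b₃a₄b₄ and joining their boundaries
-- by a tube gives an annulus that the four edges between {a₁, a₂} and {a₃, a₄}
-- cut into four quadrilaterals, and two of these again have a₁, a₂ resp. a₃, a₄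
-- as opposite corners. So if the vertices are grouped into pairs and every pair
-- has a face in which it is opposite, tubes can join any pair to any other, in
-- any order; each raises the Euler genus by two and keeps orientability. To pass from n to n + 8 vertices, glue a fixed orientable
-- surface carrying K₈ on the new vertices into one face (for odd n one vertex z
-- is unpaired, and the new vertices are joined to z as well), and then join the
-- four new pairs to the old pairs. Started from graphs with 7, …, 14 vertices
-- that miss at most three edges, one series for orientable, one for even and one
-- for odd nonorientable genus, this produces K_n minus at most three edges for
-- all n, and stopping the last round of tubes early produces all other genera
-- that need n vertices. Euler genus at most 33 is covered by explicit surfaces.

-- The bound is attained only by nearly complete graphs: a quadrangulation with n vertices and Euler
-- genus e leaves t = (n² - 5n + 8 - 4e)/2 pairs of vertices nonadjacent. Tubes and patches change e
-- by even amounts and keep orientability, which is why three series are needed. Within a series e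
-- is as large as n permits exactly when t ≤ 3, since one more tube would use up four nonadjacent
-- pairs. Passing from n to n + 8 changes n² - 5n by 16n + 24, a multiple of 8, so t can be kept
-- fixed; no smaller step does this for all n. An Euler genus that fits n + 8 but not n + 7 vertices
-- lies between the one right after gluing the patch and the one after the last tube, so it is met
-- after some number of tubes. Finally, 33 is the largest Euler genus that 14 vertices allow; from
-- 34 on at least 15 = 7 + 8 vertices are needed, and a step from a smaller graph is available.

open import Defs
open import Data.Bool using (Bool; true; false; not; if_then_else_; _∧_; _∨_; _xor_; T)
open import Data.Bool.ListAction using (all; any)
open import Data.Bool.Properties using (T-∧; T-∨; not-¬; ¬-not; not-involutive) renaming (_≟_ to _≟ᵇ_)
open import Data.Empty using (⊥; ⊥-elim)
open import Data.Empty.Irrelevant using () renaming (⊥-elim to ⊥-elim-irr)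
open import Data.Fin as Fin using (Fin; toℕ; fromℕ<; combine; remQuot; splitAt; join)
open import Data.Fin.Patterns
open import Data.Fin.Properties as Fin using (combine-remQuot; remQuot-combine; combine-injective; injective⇒≤; join-splitAt; toℕ-fromℕ<; toℕ-injective; toℕ<n; fromℕ<-injective)
import Data.Integer as ℤ
import Data.Integer.Properties as ℤ
import Data.Integer.Tactic.RingSolver as ℤSolver
open import Data.List using (List; []; _∷_; _++_; map; foldr; concat; concatMap; length; lookup; allFin; filter; cartesianProduct; upTo; take; drop)
open import Data.List.Properties using (map-++; map-cong; map-tabulate; tabulate-lookup; map-∘; length-++; length-map; length-take; concat-map-[_])
open import Data.List.Membership.Propositional using (_∈_; find; lose)
open import Data.List.Membership.Propositional.Properties using (∈-filter⁺; ∈-filter⁻; ∈-cartesianProduct⁺; ∈-cartesianProduct⁻; ∈-allFin; ∈-lookup; ∈-map⁺; ∈-map⁻; ∈-++⁺ˡ; ∈-++⁺ʳ; ∈-++⁻; ∈-concatMap⁺; ∈-concatMap⁻; ∈-upTo⁺; ∈-upTo⁻; ∈-∃++)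
open import Data.List.Relation.Binary.Permutation.Propositional using (_↭_; ↭-sym; ↭-trans; prep)
open import Data.List.Relation.Binary.Permutation.Propositional.Properties using (∈-resp-↭; map⁺; ↭-map-inv; shift; shifts; ++⁺ʳ; All-resp-↭)
open import Data.List.Relation.Unary.All as All using (All; []; _∷_; all?)
import Data.List.Relation.Unary.All.Properties as All
open import Data.List.Relation.Unary.AllPairs as AllPairs using (AllPairs; []; _∷_; allPairs?)
import Data.List.Relation.Unary.AllPairs.Properties as AllPairs
open import Data.List.Relation.Unary.Any as Any using (Any; here; there; any?)
import Data.List.Relation.Unary.Any.Properties as Any
open import Data.List.Relation.Unary.Unique.Propositional using (Unique)
import Data.List.Relation.Unary.Unique.Propositional.Properties as Unique
open import Data.Nat using (ℕ; zero; suc; _+_; _*_; _∸_; _≤_; _<_; _≤ᵇ_; _<ᵇ_; _≡ᵇ_; NonZero; z≤n; s≤s; _≟_; _<?_; _≤?_)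
open import Data.Nat.DivMod using (_/_; _%_)
open import Data.Nat.ListAction using (sum)
open import Data.Nat.ListAction.Properties using (sum-++; sum-↭)
open import Data.Nat.Properties hiding (_≟_; _<?_; _≤?_)
open import Data.Nat.Tactic.RingSolver using (solve-∀)
open import Data.Product using (∃; ∃₂; _×_; _,_; proj₁; proj₂; swap; uncurry)
open import Data.Sum as Sum using (_⊎_; inj₁; inj₂; [_,_]′)
open import Data.Unit using (tt)
open import Function using (_∘_; id; flip; Equivalence)
open import Relation.Binary.Construct.Closure.ReflexiveTransitive using (Star; ε; _◅_; _◅◅_; return; gmap; kleisliStar; reverse)
open import Relation.Binary.PropositionalEquality
open import Relation.Unary using (Decidable)
open import Relation.Nullary using (¬_; Dec; yes; no; does; contradiction)
open import Relation.Nullary.Decidable using (True; False; toWitness; toWitnessFalse; T?; _×-dec_; _⊎-dec_; _→-dec_; map′; dec-true; dec-false; ¬?)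

-- Embeddings as lists of faces

-- The same data as a Map, with an arbitrary type of flags.
record FlagSystem : Set₁ where
  field
    Flag : Set
    size : ℕ
    to   : Fin size → Flag
    from : Flag → Fin size
    to-from : ∀ x → to (from x) ≡ x
    from-to : ∀ i → from (to i) ≡ i
    inhabited : Flag
    s₀ s₁ s₂ : Flag → Flag
    invol₀ : ∀ x → s₀ (s₀ x) ≡ x
    invol₁ : ∀ x → s₁ (s₁ x) ≡ x
    invol₂ : ∀ x → s₂ (s₂ x) ≡ x
    moves₀ : ∀ x → s₀ x ≢ x
    moves₁ : ∀ x → s₁ x ≢ x
    moves₂ : ∀ x → s₂ x ≢ x
    comm₀₂ : ∀ x → s₀ (s₂ x) ≡ s₂ (s₀ x)
    moves₀₂ : ∀ x → s₀ (s₂ x) ≢ x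
  Two : (s t : Flag → Flag) → Flag → Flag → Set
  Two s t x y = y ≡ s x ⊎ y ≡ t x
  Three : Flag → Flag → Set
  Three x y = (y ≡ s₀ x ⊎ y ≡ s₁ x) ⊎ y ≡ s₂ x
  field
    connect : ∀ x y → Star Three x y
    #V : ℕ
    vertex : Flag → Fin #V
    vertex-surj : ∀ v → ∃ λ x → vertex x ≡ v
    vertex-orb : ∀ x y → vertex x ≡ vertex y → Star (Two s₁ s₂) x y
    vertex-inv : ∀ x y → Two s₁ s₂ x y → vertex x ≡ vertex y
    #E : ℕ
    side : Flag → Fin #E
    side-surj : ∀ e → ∃ λ x → side x ≡ e
    side-orb : ∀ x y → side x ≡ side y → Star (Two s₀ s₂) x y
    side-inv : ∀ x y → Two s₀ s₂ x y → side x ≡ side y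
    #F : ℕ
    tile : Flag → Fin #F
    tile-surj : ∀ f → ∃ λ x → tile x ≡ f
    tile-orb : ∀ x y → tile x ≡ tile y → Star (Two s₀ s₁) x y
    tile-inv : ∀ x y → Two s₀ s₁ x y → tile x ≡ tile y

star-invariant : ∀ {A B : Set} {R : A → A → Set} (f : A → B) →
                 (∀ x y → R x y → f x ≡ f y) → ∀ {x y} → Star R x y → f x ≡ f y
star-invariant f inv ε = refl
star-invariant f inv (r ◅ rs) = trans (inv _ _ r) (star-invariant f inv rs)

module _ (G : FlagSystem) where
  open FlagSystem G

  private
    conj : (Flag → Flag) → Fin size → Fin size
    conj s i = from (s (to i))

    to-conj : ∀ s i → to (conj s i) ≡ s (to i)
    to-conj s i = to-from (s (to i))

    conj² : ∀ s t i → conj s (conj t i) ≡ from (s (t (to i)))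
    conj² s t i = cong (from ∘ s) (to-conj t i)

    conj-invol : ∀ s → (∀ x → s (s x) ≡ x) → ∀ i → conj s (conj s i) ≡ i
    conj-invol s inv i = trans (conj² s s i) (trans (cong from (inv (to i))) (from-to i))

    moves : ∀ {i} x → from x ≡ i → x ≡ to i
    moves x refl = sym (to-from x)

    from-step : ∀ s {x y} → y ≡ s x → from y ≡ conj s (from x)
    from-step s {x} refl = cong (from ∘ s) (sym (to-from x))

    to-step : ∀ s {i j} → j ≡ conj s i → to j ≡ s (to i)
    to-step s refl = to-conj s _

    orb : ∀ s t {k} (lab : Flag → Fin k) →
          (∀ x y → lab x ≡ lab y → Star (Two s t) x y) →
          (∀ x y → Two s t x y → lab x ≡ lab y) → ∀ i j →
          (lab (to i) ≡ lab (to j) → Star (λ i j → j ≡ conj s i ⊎ j ≡ conj t i) i j) ×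
          (Star (λ i j → j ≡ conj s i ⊎ j ≡ conj t i) i j → lab (to i) ≡ lab (to j))
    orb s t lab o v i j =
        (λ eq → subst₂ (Star _) (from-to i) (from-to j)
                  (gmap from (λ { (inj₁ p) → inj₁ (from-step s p) ; (inj₂ p) → inj₂ (from-step t p) })
                        (o (to i) (to j) eq)))
      , star-invariant (lab ∘ to)
          (λ { x y (inj₁ p) → v _ _ (inj₁ (to-step s p)) ; x y (inj₂ p) → v _ _ (inj₂ (to-step t p)) })

    surj : ∀ {k} (lab : Flag → Fin k) → (∀ v → ∃ λ x → lab x ≡ v) → ∀ v → ∃ λ i → lab (to i) ≡ v
    surj lab sj v = let x , eq = sj v in from x , trans (cong lab (to-from x)) eq

    0<fin : ∀ {n} → Fin n → 0 < n
    0<fin {suc n} _ = s≤s z≤n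

  toMap : Map
  toMap = record
    { nF = size ; nonempty = 0<fin (from inhabited)
    ; t0 = conj s₀ ; t1 = conj s₁ ; t2 = conj s₂
    ; inv0 = conj-invol s₀ invol₀ ; inv1 = conj-invol s₁ invol₁ ; inv2 = conj-invol s₂ invol₂
    ; fpf0 = λ i eq → moves₀ (to i) (moves _ eq)
    ; fpf1 = λ i eq → moves₁ (to i) (moves _ eq)
    ; fpf2 = λ i eq → moves₂ (to i) (moves _ eq)
    ; comm02 = λ i → trans (conj² s₀ s₂ i) (trans (cong from (comm₀₂ (to i))) (sym (conj² s₂ s₀ i)))
    ; fpf02 = λ i eq → moves₀₂ (to i) (moves _ (trans (sym (conj² s₀ s₂ i)) eq))
    ; connected = λ i j → subst₂ (Star _) (from-to i) (from-to j)
        (gmap from (λ { (inj₁ (inj₁ p)) → inj₁ (inj₁ (from-step s₀ p))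
                      ; (inj₁ (inj₂ p)) → inj₁ (inj₂ (from-step s₁ p))
                      ; (inj₂ p) → inj₂ (from-step s₂ p) }) (connect (to i) (to j)))
    ; V = #V ; vert = vertex ∘ to ; vert-surj = surj vertex vertex-surj
    ; vert-orb = orb s₁ s₂ vertex vertex-orb vertex-inv
    ; E = #E ; edge = side ∘ to ; edge-surj = surj side side-surj
    ; edge-orb = orb s₀ s₂ side side-orb side-inv
    ; F = #F ; face = tile ∘ to ; face-surj = surj tile tile-surj
    ; face-orb = orb s₀ s₁ tile tile-orb tile-inv }

  toMap-simple :
    (∀ x → vertex (s₀ x) ≢ vertex x) →
    (∀ x y → vertex x ≡ vertex y → vertex (s₀ x) ≡ vertex (s₀ y) → side x ≡ side y) →
    SimpleGraph toMap
  toMap-simple loopless simple =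
      (λ i eq → loopless (to i) (trans (cong vertex (sym (to-conj s₀ i))) eq))
    , (λ i j p q → simple (to i) (to j) p
        (trans (cong vertex (sym (to-conj s₀ i))) (trans q (cong vertex (to-conj s₀ j)))))

  ρ : Flag → Flag
  ρ x = s₁ (s₀ x)

  -- Three inequalities at every flag suffice: the other three in `Quadrangular` are these at `ρ x`
  -- and `ρ (ρ x)`.
  toMap-quadrangular :
    (∀ x → ρ (ρ (ρ (ρ x))) ≡ x
      × vertex x ≢ vertex (ρ x) × vertex x ≢ vertex (ρ (ρ x)) × vertex x ≢ vertex (ρ (ρ (ρ x)))) →
    Quadrangular toMap
  toMap-quadrangular q i =
      trans (cong r (trans (cong r (trans (cong r (r₁ i)) (r₁' _))) (r₁' _)))
            (trans (r₁' _) (trans (cong from (proj₁ (q x))) (from-to i)))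
    , (λ e → proj₁ (proj₂ (q x)) (trans e (v₁ i)))
    , (λ e → proj₁ (proj₂ (proj₂ (q x))) (trans e (v₂ i)))
    , (λ e → proj₂ (proj₂ (proj₂ (q x))) (trans e (v₃ i)))
    , (λ e → proj₁ (proj₂ (q (ρ x))) (trans (sym (v₁ i)) (trans e (v₂ i))))
    , (λ e → proj₁ (proj₂ (proj₂ (q (ρ x)))) (trans (sym (v₁ i)) (trans e (v₃ i))))
    , (λ e → proj₁ (proj₂ (q (ρ (ρ x)))) (trans (sym (v₂ i)) (trans e (v₃ i))))
    where
    x = to i
    r : Fin size → Fin size
    r j = conj s₁ (conj s₀ j)
    r₁ : ∀ j → r j ≡ from (ρ (to j))
    r₁ = conj² s₁ s₀
    r₁' : ∀ y → r (from y) ≡ from (ρ y)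
    r₁' y = trans (r₁ (from y)) (cong (from ∘ ρ) (to-from y))
    to-r : ∀ j → to (r j) ≡ ρ (to j)
    to-r j = trans (cong to (r₁ j)) (to-from _)
    v₁ : ∀ j → vertex (to (r j)) ≡ vertex (ρ (to j))
    v₁ j = cong vertex (to-r j)
    v₂ : ∀ j → vertex (to (r (r j))) ≡ vertex (ρ (ρ (to j)))
    v₂ j = trans (v₁ (r j)) (cong (vertex ∘ ρ) (to-r j))
    v₃ : ∀ j → vertex (to (r (r (r j)))) ≡ vertex (ρ (ρ (ρ (to j))))
    v₃ j = trans (v₂ (r j)) (cong (vertex ∘ ρ ∘ ρ) (to-r j))

  toMap-orientable :
    (∃ λ (c : Flag → Bool) → ∀ x → c (s₀ x) ≢ c x × c (s₁ x) ≢ c x × c (s₂ x) ≢ c x) →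
    Orientable toMap
  toMap-orientable (c , h) = c ∘ to , λ i →
      (λ e → proj₁ (h (to i)) (trans (cong c (sym (to-conj s₀ i))) e))
    , (λ e → proj₁ (proj₂ (h (to i))) (trans (cong c (sym (to-conj s₁ i))) e))
    , (λ e → proj₂ (proj₂ (h (to i))) (trans (cong c (sym (to-conj s₂ i))) e))

  fromMap-orientable : Orientable toMap →
    ∃ λ (c : Flag → Bool) → ∀ x → c (s₀ x) ≢ c x × c (s₁ x) ≢ c x × c (s₂ x) ≢ c x
  fromMap-orientable (c , h) = c ∘ from , λ x →
      (λ e → proj₁ (h (from x)) (trans (cong c (sym (from-step s₀ refl))) e))
    , (λ e → proj₁ (proj₂ (h (from x))) (trans (cong c (sym (from-step s₁ refl))) e))
    , (λ e → proj₂ (proj₂ (h (from x))) (trans (cong c (sym (from-step s₂ refl))) e))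

data Quad : Set where
  quad : (a b c d : ℕ) → Quad

-- The eight flags of a face: 2i sits at corner i and points along the
-- boundary walk a b c d, 2i+1 sits at corner i and points against it.
at nb : Quad → Fin 8 → ℕ
at (quad a b c d) 0F = a
at (quad a b c d) 1F = a
at (quad a b c d) 2F = b
at (quad a b c d) 3F = b
at (quad a b c d) 4F = c
at (quad a b c d) 5F = c
at (quad a b c d) 6F = d
at (quad a b c d) 7F = d
nb (quad a b c d) 0F = b
nb (quad a b c d) 1F = d
nb (quad a b c d) 2F = c
nb (quad a b c d) 3F = a
nb (quad a b c d) 4F = d
nb (quad a b c d) 5F = b
nb (quad a b c d) 6F = a
nb (quad a b c d) 7F = c

τ₀ τ₁ : Fin 8 → Fin 8
τ₀ 0F = 3F
τ₀ 1F = 6F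
τ₀ 2F = 5F
τ₀ 3F = 0F
τ₀ 4F = 7F
τ₀ 5F = 2F
τ₀ 6F = 1F
τ₀ 7F = 4F
τ₁ 0F = 1F
τ₁ 1F = 0F
τ₁ 2F = 3F
τ₁ 3F = 2F
τ₁ 4F = 5F
τ₁ 5F = 4F
τ₁ 6F = 7F
τ₁ 7F = 6F

forward : Fin 8 → Bool
forward 0F = true
forward 1F = false
forward 2F = true
forward 3F = false
forward 4F = true
forward 5F = false
forward 6F = true
forward 7F = false

∀8 : {P : Fin 8 → Set} → P 0F → P 1F → P 2F → P 3F → P 4F → P 5F → P 6F → P 7F → ∀ k → P k
∀8 p0 p1 p2 p3 p4 p5 p6 p7 0F = p0
∀8 p0 p1 p2 p3 p4 p5 p6 p7 1F = p1
∀8 p0 p1 p2 p3 p4 p5 p6 p7 2F = p2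
∀8 p0 p1 p2 p3 p4 p5 p6 p7 3F = p3
∀8 p0 p1 p2 p3 p4 p5 p6 p7 4F = p4
∀8 p0 p1 p2 p3 p4 p5 p6 p7 5F = p5
∀8 p0 p1 p2 p3 p4 p5 p6 p7 6F = p6
∀8 p0 p1 p2 p3 p4 p5 p6 p7 7F = p7

at-τ₀ : ∀ q k → at q (τ₀ k) ≡ nb q k
at-τ₀ (quad a b c d) = ∀8 refl refl refl refl refl refl refl refl

nb-τ₀ : ∀ q k → nb q (τ₀ k) ≡ at q k
nb-τ₀ (quad a b c d) = ∀8 refl refl refl refl refl refl refl refl

at-τ₁ : ∀ q k → at q (τ₁ k) ≡ at q k
at-τ₁ (quad a b c d) = ∀8 refl refl refl refl refl refl refl refl

τ₀-invol : ∀ k → τ₀ (τ₀ k) ≡ k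
τ₀-invol = ∀8 refl refl refl refl refl refl refl refl

τ₁-invol : ∀ k → τ₁ (τ₁ k) ≡ k
τ₁-invol = ∀8 refl refl refl refl refl refl refl refl

forward-τ₀ : ∀ k → forward (τ₀ k) ≡ not (forward k)
forward-τ₀ = ∀8 refl refl refl refl refl refl refl refl

forward-τ₁ : ∀ k → forward (τ₁ k) ≡ not (forward k)
forward-τ₁ = ∀8 refl refl refl refl refl refl refl refl

Valid : ℕ → Quad → Set
Valid n (quad a b c d) =
  (a < n × b < n × c < n × d < n) × (a ≢ b × a ≢ c × a ≢ d × b ≢ c × b ≢ d × c ≢ d)

valid-< : ∀ {n} q → Valid n q → ∀ k → at q k < n
valid-< (quad a b c d) ((p , q , r , s) , _) = ∀8 p p q q r r s s

valid-≢ : ∀ {n} q → Valid n q → ∀ k → at q k ≢ nb q k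
valid-≢ (quad a b c d) (_ , ab , ac , ad , bc , bd , cd) =
  ∀8 ab ad bc (ab ∘ sym) cd (bc ∘ sym) (ad ∘ sym) (cd ∘ sym)

valid-≢₂ : ∀ {n} q → Valid n q → ∀ k → at q k ≢ at q (τ₁ (τ₀ (τ₁ (τ₀ k))))
valid-≢₂ (quad a b c d) (_ , ab , ac , ad , bc , bd , cd) =
  ∀8 ac ac bd bd (ac ∘ sym) (ac ∘ sym) (bd ∘ sym) (bd ∘ sym)

valid-≢₃ : ∀ {n} q → Valid n q → ∀ k → at q k ≢ at q (τ₁ (τ₀ (τ₁ (τ₀ (τ₁ (τ₀ k))))))
valid-≢₃ (quad a b c d) (_ , ab , ac , ad , bc , bd , cd) =
  ∀8 ad ab (ab ∘ sym) bc (bc ∘ sym) cd (cd ∘ sym) (ad ∘ sym)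

ρ⁴ : ∀ k → τ₁ (τ₀ (τ₁ (τ₀ (τ₁ (τ₀ (τ₁ (τ₀ k))))))) ≡ k
ρ⁴ = ∀8 refl refl refl refl refl refl refl refl

Edge : Set
Edge = ℕ × ℕ

Same : Edge → Edge → Set
Same (u , v) (u′ , v′) = (u ≡ u′ × v ≡ v′) ⊎ (u ≡ v′ × v ≡ u′)

same? : ∀ e e′ → Dec (Same e e′)
same? (u , v) (u′ , v′) = (u ≟ u′ ×-dec v ≟ v′) ⊎-dec (u ≟ v′ ×-dec v ≟ u′)

same-sym : ∀ {e e′} → Same e e′ → Same e′ e
same-sym (inj₁ (refl , refl)) = inj₁ (refl , refl)
same-sym (inj₂ (refl , refl)) = inj₂ (refl , refl)

same-trans : ∀ {e e′ e″} → Same e e′ → Same e′ e″ → Same e e″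
same-trans (inj₁ (refl , refl)) s = s
same-trans (inj₂ (refl , refl)) (inj₁ (refl , refl)) = inj₂ (refl , refl)
same-trans (inj₂ (refl , refl)) (inj₂ (refl , refl)) = inj₁ (refl , refl)

faceSum : (ℕ → ℕ → ℕ) → Quad → ℕ
faceSum f (quad a b c d) = f a b + f b c + f c d + f d a

edgeSum : (ℕ → ℕ → ℕ) → Edge → ℕ
edgeSum f (u , v) = f u v + f v u

faceTotal : (ℕ → ℕ → ℕ) → List Quad → ℕ
faceTotal f L = sum (map (faceSum f) L)

edgeTotal : (ℕ → ℕ → ℕ) → List Edge → ℕ
edgeTotal f E = sum (map (edgeSum f) E)

-- Equality of multisets, phrased as equality of all sums over them: every
-- edge of E is traversed once in each direction, resp. twice altogether.
Oriented TwoSided : List Quad → List Edge → Set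
Oriented L E = ∀ f → faceTotal f L ≡ edgeTotal f E
TwoSided L E = ∀ f → faceTotal f L + faceTotal (flip f) L ≡ edgeTotal f E + edgeTotal f E

-- For fixed `v` this is the link graph of `v`: its neighbours, joined when they are consecutive
-- around a corner. Once every edge has two sides the link is 2-regular, and its connectedness says
-- that `v` is not a pinch point.
data Link (L : List Quad) (v w x : ℕ) : Set where
  link : ∀ {q} → q ∈ L → ∀ k → at q k ≡ v → nb q k ≡ w → nb q (τ₁ k) ≡ x → Link L v w x

data Nbr (L : List Quad) (v w : ℕ) : Set where
  nbr : ∀ {q} → q ∈ L → ∀ k → at q k ≡ v → nb q k ≡ w → Nbr L v w

Adj : List Edge → ℕ → ℕ → Set
Adj E v w = Any (Same (v , w)) E

-- By `sides` the faces glue to a closed pseudosurface without any further gluing data; `links`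
-- excludes pinch points and `conn` makes the result connected.
record Inv (n : ℕ) (L : List Quad) (E : List Edge) : Set where
  field
    valid  : All (Valid n) L
    sides  : TwoSided L E
    simple : AllPairs (λ e e′ → ¬ Same e e′) E
    links  : ∀ v w x → Nbr L v w → Nbr L v x → Star (Link L v) w x
    conn   : ∀ v → v < n → Star (Adj E) 0 v

-- The test function that turns the multiset identity `sides` into a count of the flags along one
-- directed edge.
δ : Edge → ℕ → ℕ → ℕ
δ (u , v) s t = if does (s ≟ u ×-dec t ≟ v) then 1 else 0

indicator : ∀ {A : Set} {P : A → Set} → Decidable P → A → ℕ
indicator P? x = if does (P? x) then 1 else 0

module _ {A : Set} {P : A → Set} (P? : Decidable P) where

  length-filter : ∀ xs → length (filter P? xs) ≡ sum (map (indicator P?) xs)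
  length-filter [] = refl
  length-filter (x ∷ xs) with P? x
  ... | yes _ = cong suc (length-filter xs)
  ... | no  _ = length-filter xs

  private
    filtered : ∀ {xs} → (∀ x → x ∈ xs) → ∀ {x} → P x → x ∈ filter P? xs
    filtered all px = ∈-filter⁺ P? (all _) px

  one-satisfies : ∀ {xs} → (∀ x → x ∈ xs) → sum (map (indicator P?) xs) ≡ 1 →
                  ∀ {x y} → P x → P y → x ≡ y
  one-satisfies {xs} all eq px py
    with filter P? xs | trans (length-filter xs) eq | filtered {xs} all px | filtered {xs} all py
  ... | z ∷ [] | _ | here refl | here refl = refl

  two-satisfy : ∀ {xs} → (∀ x → x ∈ xs) → Unique xs → sum (map (indicator P?) xs) ≡ 2 →
                ∃₂ λ p q → p ≢ q × P p × P q × (∀ {x} → P x → x ≡ p ⊎ x ≡ q)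
  two-satisfy {xs} all uniq eq
    with filter P? xs in fil | trans (length-filter xs) eq | Unique.filter⁺ P? uniq
       | (λ {x} (px : P x) → filtered {xs} all px)
       | (λ {x} (m : x ∈ filter P? xs) → proj₂ (∈-filter⁻ P? {xs = xs} m))
  ... | p ∷ q ∷ [] | _ | (p≢q ∷ []) ∷ _ | fl | sat =
    p , q , p≢q , sat (here refl) , sat (there (here refl)) ,
    λ px → [p,q] (fl px)
    where
    [p,q] : ∀ {x} → x ∈ p ∷ q ∷ [] → x ≡ p ⊎ x ≡ q
    [p,q] (here e) = inj₁ e
    [p,q] (there (here e)) = inj₂ e

  some-satisfies : ∀ {xs} → sum (map (indicator P?) xs) ≢ 0 → ∃ P
  some-satisfies {[]} ne = contradiction refl ne
  some-satisfies {x ∷ xs} ne with P? x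
  ... | yes px = x , px
  ... | no  _  = some-satisfies {xs} ne

  indicator-≢0 : ∀ {x xs} → x ∈ xs → P x → sum (map (indicator P?) xs) ≢ 0
  indicator-≢0 {x} (here refl) px with P? x
  ... | yes _ = λ ()
  ... | no ¬p = contradiction px ¬p
  indicator-≢0 {x} {y ∷ ys} (there m) px eq =
    indicator-≢0 m px (m+n≡0⇒n≡0 (indicator P? y) eq)

sum-cartesianProduct : ∀ {A B : Set} (g : A × B → ℕ) (xs : List A) (ys : List B) →
  sum (map g (cartesianProduct xs ys)) ≡ sum (map (λ x → sum (map (λ y → g (x , y)) ys)) xs)
sum-cartesianProduct g [] ys = refl
sum-cartesianProduct g (x ∷ xs) ys =
  trans (cong sum (map-++ g (map (x ,_) ys) (cartesianProduct xs ys)))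
  (trans (sum-++ (map g (map (x ,_) ys)) _)
    (cong₂ _+_ (cong sum (sym (map-∘ ys))) (sum-cartesianProduct g xs ys)))

sum-lookup : ∀ {A : Set} (g : A → ℕ) (xs : List A) →
  sum (map (g ∘ lookup xs) (allFin (length xs))) ≡ sum (map g xs)
sum-lookup g xs = cong sum (trans (map-tabulate id (g ∘ lookup xs))
  (trans (sym (map-tabulate (lookup xs) g)) (cong (map g) (tabulate-lookup xs))))

edgeSum-δ-other : ∀ {v w s t} → ¬ Same (v , w) (s , t) → edgeSum (δ (v , w)) (s , t) ≡ 0
edgeSum-δ-other {v} {w} {s} {t} other
  rewrite dec-false (s ≟ v ×-dec t ≟ w) (λ { (refl , refl) → other (inj₁ (refl , refl)) })
        | dec-false (t ≟ v ×-dec s ≟ w) (λ { (refl , refl) → other (inj₂ (refl , refl)) })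
        = refl

edgeSum-δ-same : ∀ {v w s t} → v ≢ w → Same (v , w) (s , t) → edgeSum (δ (v , w)) (s , t) ≡ 1
edgeSum-δ-same {v} {w} v≢w (inj₁ (refl , refl))
  rewrite dec-true (v ≟ v ×-dec w ≟ w) (refl , refl)
        | dec-false (w ≟ v ×-dec v ≟ w) (λ p → v≢w (proj₂ p)) = refl
edgeSum-δ-same {v} {w} v≢w (inj₂ (refl , refl))
  rewrite dec-true (v ≟ v ×-dec w ≟ w) (refl , refl)
        | dec-false (w ≟ v ×-dec v ≟ w) (λ p → v≢w (proj₂ p)) = refl

edgeTotal-δ-absent : ∀ {v w} E → ¬ Adj E v w → edgeTotal (δ (v , w)) E ≡ 0
edgeTotal-δ-absent [] _ = refl
edgeTotal-δ-absent (_ ∷ E) no-edge =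
  cong₂ _+_ (edgeSum-δ-other (no-edge ∘ here)) (edgeTotal-δ-absent E (no-edge ∘ there))

edgeTotal-δ-present : ∀ {v w E} → AllPairs (λ e e′ → ¬ Same e e′) E → v ≢ w → Adj E v w →
                      edgeTotal (δ (v , w)) E ≡ 1
edgeTotal-δ-present {v} {w} {_ ∷ E} (new ∷ _) v≢w (here same) =
  cong₂ _+_ (edgeSum-δ-same v≢w same) (edgeTotal-δ-absent E λ adj →
    let e , e∈ , s = find adj in All.lookup new e∈ (same-trans (same-sym same) s))
edgeTotal-δ-present (new ∷ rest) v≢w (there adj) =
  cong₂ _+_
    (edgeSum-δ-other λ same →
      let e , e∈ , s = find adj in All.lookup new e∈ (same-trans (same-sym same) s))
    (edgeTotal-δ-present rest v≢w adj)

adj? : ∀ E v w → Dec (Adj E v w)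
adj? E v w = any? (same? (v , w)) E

sum-map-+ : ∀ {A : Set} (f g : A → ℕ) xs →
  sum (map f xs) + sum (map g xs) ≡ sum (map (λ x → f x + g x) xs)
sum-map-+ f g [] = refl
sum-map-+ f g (x ∷ xs) = trans (rearrange (f x) _ (g x) _) (cong (f x + g x +_) (sum-map-+ f g xs))
  where
  rearrange : ∀ a b c d → (a + b) + (c + d) ≡ (a + c) + (b + d)
  rearrange = solve-∀

flagSum : ∀ (f : ℕ → ℕ → ℕ) q →
  sum (map (λ k → f (at q k) (nb q k)) (allFin 8)) ≡ faceSum f q + faceSum (flip f) q
flagSum f (quad a b c d) =
  rearrange (f a b) (f a d) (f b c) (f b a) (f c d) (f c b) (f d a) (f d c)
  where
  rearrange : ∀ x₀ x₁ x₂ x₃ x₄ x₅ x₆ x₇ →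
    x₀ + (x₁ + (x₂ + (x₃ + (x₄ + (x₅ + (x₆ + (x₇ + 0))))))) ≡
    (x₀ + x₂ + x₄ + x₆) + (x₃ + x₅ + x₇ + x₁)
  rearrange = solve-∀

forwardSum : ∀ (f : ℕ → ℕ → ℕ) q →
  sum (map (λ k → if forward k then f (at q k) (nb q k) else 0) (allFin 8)) ≡ faceSum f q
forwardSum f (quad a b c d) = rearrange (f a b) (f b c) (f c d) (f d a)
  where
  rearrange : ∀ x₀ x₁ x₂ x₃ → x₀ + (0 + (x₁ + (0 + (x₂ + (0 + (x₃ + (0 + 0))))))) ≡ x₀ + x₁ + x₂ + x₃
  rearrange = solve-∀

-- `o` decides for each face whether its walk is reversed; two faces with a common edge then have to
-- run through it in opposite directions. Because the condition speaks of faces of the list and not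
-- of the whole surface, `NonOrientable` passes to longer lists, and a few faces forming a Möbius
-- band are a witness.
Coherent : (Quad → Bool) → List Quad → Set
Coherent o L = ∀ {q q′} → q ∈ L → q′ ∈ L → q ≢ q′ → ∀ k k′ →
  at q k ≡ at q′ k′ → nb q k ≡ nb q′ k′ → turn q k ≢ turn q′ k′
  where
  turn : Quad → Fin 8 → Bool
  turn q k = if o q then forward k else not (forward k)

NonOrientable : List Quad → Set
NonOrientable L = ∀ o → ¬ Coherent o L

quad-≟ : ∀ (q q′ : Quad) → Dec (q ≡ q′)
quad-≟ (quad a b c d) (quad a′ b′ c′ d′) =
  map′ (λ { (refl , refl , refl , refl) → refl }) (λ { refl → refl , refl , refl , refl })
       (a ≟ a′ ×-dec b ≟ b′ ×-dec c ≟ c′ ×-dec d ≟ d′)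

-- The surface glued from a list of faces

module FromFaces {m : ℕ} {L : List Quad} {E : List Edge} (I : Inv (suc (suc m)) L E) where
  open Inv I

  n : ℕ
  n = suc (suc m)

  Flag : Set
  Flag = Fin (length L) × Fin 8

  face# : Flag → Quad
  face# (i , _) = lookup L i

  src tgt : Flag → ℕ
  src (i , k) = at (lookup L i) k
  tgt (i , k) = nb (lookup L i) k

  s₀ s₁ : Flag → Flag
  s₀ (i , k) = i , τ₀ k
  s₁ (i , k) = i , τ₁ k

  src-s₀ : ∀ x → src (s₀ x) ≡ tgt x
  src-s₀ (i , k) = at-τ₀ (lookup L i) k

  tgt-s₀ : ∀ x → tgt (s₀ x) ≡ src x
  tgt-s₀ (i , k) = nb-τ₀ (lookup L i) k

  src-s₁ : ∀ x → src (s₁ x) ≡ src x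
  src-s₁ (i , k) = at-τ₁ (lookup L i) k

  s₀-invol : ∀ x → s₀ (s₀ x) ≡ x
  s₀-invol (i , k) = cong (i ,_) (τ₀-invol k)

  s₁-invol : ∀ x → s₁ (s₁ x) ≡ x
  s₁-invol (i , k) = cong (i ,_) (τ₁-invol k)

  s₀-injective : ∀ {x y} → s₀ x ≡ s₀ y → x ≡ y
  s₀-injective {x} {y} eq = trans (sym (s₀-invol x)) (trans (cong s₀ eq) (s₀-invol y))

  valid-face : ∀ x → Valid n (face# x)
  valid-face (i , _) = All.lookup valid (∈-lookup i)

  src<n : ∀ x → src x < n
  src<n x@(i , k) = valid-< (lookup L i) (valid-face x) k

  src≢tgt : ∀ x → src x ≢ tgt x
  src≢tgt x@(i , k) = valid-≢ (lookup L i) (valid-face x) k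

  Dart : ℕ → ℕ → Flag → Set
  Dart v w x = src x ≡ v × tgt x ≡ w

  dart? : ∀ v w x → Dec (Dart v w x)
  dart? v w x = src x ≟ v ×-dec tgt x ≟ w

  flags : List Flag
  flags = cartesianProduct (allFin (length L)) (allFin 8)

  ∈-flags : ∀ x → x ∈ flags
  ∈-flags (i , k) = ∈-cartesianProduct⁺ (∈-allFin i) (∈-allFin k)

  flags-unique : Unique flags
  flags-unique = Unique.cartesianProduct⁺ (Unique.allFin⁺ (length L)) (Unique.allFin⁺ 8)

  flags-sum : ∀ (g : Quad → Fin 8 → ℕ) →
    sum (map (λ { (i , k) → g (lookup L i) k }) flags) ≡
    sum (map (λ q → sum (map (g q) (allFin 8))) L)
  flags-sum g = trans (sum-cartesianProduct _ (allFin (length L)) (allFin 8))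
                      (sum-lookup (λ q → sum (map (g q) (allFin 8))) L)

  dart-count : ∀ v w → sum (map (indicator (dart? v w)) flags) ≡
                       edgeTotal (δ (v , w)) E + edgeTotal (δ (v , w)) E
  dart-count v w = begin
    sum (map (indicator (dart? v w)) flags)
      ≡⟨ flags-sum (λ q k → d (at q k) (nb q k)) ⟩
    sum (map (λ q → sum (map (λ k → d (at q k) (nb q k)) (allFin 8))) L)
      ≡⟨ cong sum (map-cong (flagSum d) L) ⟩
    sum (map (λ q → faceSum d q + faceSum (flip d) q) L)
      ≡⟨ sum-map-+ (faceSum d) (faceSum (flip d)) L ⟨
    faceTotal d L + faceTotal (flip d) L
      ≡⟨ sides d ⟩
    edgeTotal d E + edgeTotal d E ∎
    where
    open ≡-Reasoning
    d = δ (v , w)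

  adj-dart : ∀ x → Adj E (src x) (tgt x)
  adj-dart x with adj? E (src x) (tgt x)
  ... | yes adj = adj
  ... | no ¬adj = contradiction
          (trans (dart-count (src x) (tgt x))
                 (cong₂ _+_ (edgeTotal-δ-absent E ¬adj) (edgeTotal-δ-absent E ¬adj)))
          (indicator-≢0 (dart? (src x) (tgt x)) (∈-flags x) (refl , refl))

  dart-of : ∀ {v w} → Adj E v w → ∃ (Dart v w)
  dart-of {v} {w} adj = some-satisfies (dart? v w) {flags} λ eq →
    nonzero adj (m+n≡0⇒m≡0 (edgeTotal d E) (trans (sym (dart-count v w)) eq))
    where
    d = δ (v , w)
    nonzero : ∀ {E} → Adj E v w → edgeTotal d E ≢ 0
    nonzero {(s , t) ∷ E} (here (inj₁ (refl , refl)))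
      rewrite dec-true (v ≟ v ×-dec w ≟ w) (refl , refl) = λ ()
    nonzero {(s , t) ∷ E} (here (inj₂ (refl , refl)))
      rewrite dec-true (v ≟ v ×-dec w ≟ w) (refl , refl) | +-comm (δ (v , w) w v) 1 = λ ()
    nonzero {e ∷ E} (there adj) eq = nonzero adj (m+n≡0⇒n≡0 (edgeSum d e) eq)

  abstract
    two-darts : ∀ x → ∃₂ λ p q → p ≢ q × Dart (src x) (tgt x) p × Dart (src x) (tgt x) q ×
                                 (∀ {y} → Dart (src x) (tgt x) y → y ≡ p ⊎ y ≡ q)
    two-darts x = two-satisfy (dart? (src x) (tgt x)) ∈-flags flags-unique
      (trans (dart-count (src x) (tgt x)) (cong₂ _+_ one one))
      where
      one : edgeTotal (δ (src x , tgt x)) E ≡ 1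
      one = edgeTotal-δ-present simple (src≢tgt x) (adj-dart x)

    -- Exactly two flags lie along each directed edge, so each flag has one companion there. This
    -- determines `s₂`.
    partner : ∀ x → ∃ λ y → y ≢ x × Dart (src x) (tgt x) y ×
                            (∀ {z} → Dart (src x) (tgt x) z → z ≡ x ⊎ z ≡ y)
    partner x with two-darts x
    ... | p , q , p≢q , dp , dq , only with only {x} (refl , refl)
    ...   | inj₁ refl = q , p≢q ∘ sym , dq , only
    ...   | inj₂ refl = p , p≢q , dp , (λ d → Sum.swap (only d))
  
  s₂ : Flag → Flag
  s₂ x = proj₁ (partner x)

  s₂-moves : ∀ x → s₂ x ≢ x
  s₂-moves x = proj₁ (proj₂ (partner x))

  src-s₂ : ∀ x → src (s₂ x) ≡ src x
  src-s₂ x = proj₁ (proj₁ (proj₂ (proj₂ (partner x))))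

  tgt-s₂ : ∀ x → tgt (s₂ x) ≡ tgt x
  tgt-s₂ x = proj₂ (proj₁ (proj₂ (proj₂ (partner x))))

  same-dart : ∀ x y → src y ≡ src x → tgt y ≡ tgt x → y ≡ x ⊎ y ≡ s₂ x
  same-dart x y p q = proj₂ (proj₂ (proj₂ (partner x))) (p , q)

  s₂-unique : ∀ x y → src y ≡ src x → tgt y ≡ tgt x → y ≢ x → y ≡ s₂ x
  s₂-unique x y p q y≢x with same-dart x y p q
  ... | inj₁ y≡x = contradiction y≡x y≢x
  ... | inj₂ eq = eq

  s₂-invol : ∀ x → s₂ (s₂ x) ≡ x
  s₂-invol x = sym (s₂-unique (s₂ x) x (sym (src-s₂ x)) (sym (tgt-s₂ x)) (s₂-moves x ∘ sym))

  -- Both sides are flags along the reversed edge different from `s₀ x`, and there is only one such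
  -- flag.
  comm : ∀ x → s₀ (s₂ x) ≡ s₂ (s₀ x)
  comm x = s₂-unique (s₀ x) (s₀ (s₂ x))
    (trans (src-s₀ (s₂ x)) (trans (tgt-s₂ x) (sym (src-s₀ x))))
    (trans (tgt-s₀ (s₂ x)) (trans (src-s₂ x) (sym (tgt-s₀ x))))
    (λ eq → s₂-moves x (s₀-injective eq))

  Two : (s t : Flag → Flag) → Flag → Flag → Set
  Two s t x y = y ≡ s x ⊎ y ≡ t x

  Three : Flag → Flag → Set
  Three x y = (y ≡ s₀ x ⊎ y ≡ s₁ x) ⊎ y ≡ s₂ x

  flag-nbr : ∀ x → Nbr L (src x) (tgt x)
  flag-nbr (i , k) = nbr (∈-lookup i) k refl refl

  aligned : ∀ {v w x y} → Dart v w x → Dart v w y → Star (Two s₁ s₂) x y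
  aligned {x = x} {y} (refl , refl) (p , q) with same-dart x y p q
  ... | inj₁ refl = ε
  ... | inj₂ eq   = inj₂ eq ◅ ε

  -- A link step crosses one corner: `s₂`, if necessary, passes to the face of that corner, and `s₁`
  -- turns in it.
  around : ∀ {v w w′} → Star (Link L v) w w′ → ∀ {x y} → Dart v w x → Dart v w′ y →
           Star (Two s₁ s₂) x y
  around ε dx dy = aligned dx dy
  around (link {q} q∈ k refl refl refl ◅ ls) {x} {y} dx dy =
    aligned dx (cong (λ q → at q k) (sym pos) , cong (λ q → nb q k) (sym pos))
    ◅◅ inj₁ refl ◅ around ls
      (trans (src-s₁ z) (cong (λ q → at q k) (sym pos)) , cong (λ q → nb q (τ₁ k)) (sym pos)) dy
    where
    z : Flag
    z = Any.index q∈ , k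
    pos : q ≡ lookup L (Any.index q∈)
    pos = Any.lookup-index q∈

  vertex : Flag → Fin n
  vertex x = fromℕ< (src<n x)

  src-vertex : ∀ {x y} → src x ≡ src y → vertex x ≡ vertex y
  src-vertex {x} {y} eq = toℕ-injective (trans (toℕ-fromℕ< (src<n x)) (trans eq (sym (toℕ-fromℕ< (src<n y)))))

  vertex-src : ∀ {x y} → vertex x ≡ vertex y → src x ≡ src y
  vertex-src {x} {y} eq = trans (sym (toℕ-fromℕ< (src<n x))) (trans (cong toℕ eq) (toℕ-fromℕ< (src<n y)))

  vertex-orbit : ∀ x y → vertex x ≡ vertex y → Star (Two s₁ s₂) x y
  vertex-orbit x y eq =
    around (links (src x) (tgt x) (tgt y) (flag-nbr x) (subst (λ v → Nbr L v (tgt y)) (sym e) (flag-nbr y)))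
           (refl , refl) (sym e , refl)
    where e = vertex-src {x} {y} eq

  Three-sym : ∀ {x y} → Three x y → Three y x
  Three-sym {x} (inj₁ (inj₁ refl)) = inj₁ (inj₁ (sym (s₀-invol x)))
  Three-sym {x} (inj₁ (inj₂ refl)) = inj₁ (inj₂ (sym (s₁-invol x)))
  Three-sym {x} (inj₂ refl) = inj₂ (sym (s₂-invol x))

  vertex-connected : ∀ {x y} → src x ≡ src y → Star Three x y
  vertex-connected {x} {y} eq =
    gmap id (λ { (inj₁ p) → inj₁ (inj₂ p) ; (inj₂ p) → inj₂ p }) (vertex-orbit x y (src-vertex {x} {y} eq))

  along : ∀ {v w} → Star (Adj E) v w → ∀ {x y} → src x ≡ v → src y ≡ w → Star Three x y
  along ε p q = vertex-connected (trans p (sym q))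
  along (adj ◅ rest) p q = let z , sz , tz = dart-of adj in
    vertex-connected (trans p (sym sz)) ◅◅ inj₁ (inj₁ refl) ◅ along rest (trans (src-s₀ z) tz) q

  flag-at : ∀ v → v < n → ∃ λ x → src x ≡ v
  flag-at v v<n with conn v v<n
  -- The path from 0 to itself is empty. An edge at 0 is the first edge of the path to 1, which
  -- exists because there are at least two vertices.
  flag-at .0 v<n | ε with conn 1 (s≤s (s≤s z≤n))
  ... | adj ◅ _ = let x , s , _ = dart-of adj in x , s
  flag-at v v<n | adj ◅ rest = last adj rest
    where
    last : ∀ {u w v} → Adj E u w → Star (Adj E) w v → ∃ λ x → src x ≡ v
    last adj ε = let x , _ , t = dart-of adj in s₀ x , trans (src-s₀ x) t
    last _ (adj ◅ rest) = last adj rest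

  flags-connected : ∀ x y → Star Three x y
  flags-connected x y =
    let z , sz = flag-at 0 (s≤s z≤n) in
    reverse Three-sym (along (conn (src x) (src<n x)) {z} sz refl)
    ◅◅ along (conn (src y) (src<n y)) sz refl

  edge# : Flag → Fin (length E)
  edge# x = Any.index (adj-dart x)

  edge#-same : ∀ x → Same (src x , tgt x) (lookup E (edge# x))
  edge#-same x = Any.lookup-index (adj-dart x)

  lookup-same : ∀ {E : List Edge} → AllPairs (λ e e′ → ¬ Same e e′) E → ∀ i j →
                Same (lookup E i) (lookup E j) → i ≡ j
  lookup-same (_ ∷ _) Fin.zero Fin.zero _ = refl
  lookup-same (new ∷ _) Fin.zero (Fin.suc j) s = contradiction s (All.lookup new (∈-lookup j))
  lookup-same (new ∷ _) (Fin.suc i) Fin.zero s = contradiction (same-sym s) (All.lookup new (∈-lookup i))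
  lookup-same (_ ∷ rest) (Fin.suc i) (Fin.suc j) s = cong Fin.suc (lookup-same rest i j s)

  edge#-cong : ∀ x y → Same (src x , tgt x) (src y , tgt y) → edge# x ≡ edge# y
  edge#-cong x y s = lookup-same simple _ _
    (same-trans (same-sym (edge#-same x)) (same-trans s (edge#-same y)))

  edge#-orbit : ∀ x y → edge# x ≡ edge# y → Star (Two s₀ s₂) x y
  edge#-orbit x y eq
    with same-trans (edge#-same x) (same-sym (subst (λ i → Same _ (lookup E i)) (sym eq) (edge#-same y)))
  ... | inj₁ (p , q) with same-dart x y (sym p) (sym q)
  ...   | inj₁ refl = ε
  ...   | inj₂ e = inj₂ e ◅ ε
  edge#-orbit x y eq | inj₂ (p , q)
    with same-dart (s₀ x) y (trans (sym q) (sym (src-s₀ x))) (trans (sym p) (sym (tgt-s₀ x)))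
  ... | inj₁ e = inj₁ e ◅ ε
  ... | inj₂ e = inj₁ refl ◅ inj₂ e ◅ ε

  edge#-inv : ∀ x y → Two s₀ s₂ x y → edge# x ≡ edge# y
  edge#-inv x _ (inj₁ refl) = edge#-cong x (s₀ x) (inj₂ (sym (tgt-s₀ x) , sym (src-s₀ x)))
  edge#-inv x _ (inj₂ refl) = edge#-cong x (s₂ x) (inj₁ (sym (src-s₂ x) , sym (tgt-s₂ x)))

  edge#-surj : ∀ e → ∃ λ x → edge# x ≡ e
  edge#-surj e =
    let x , s , t = dart-of {proj₁ (lookup E e)} {proj₂ (lookup E e)}
                      (lose (∈-lookup e) (inj₁ (refl , refl)))
    in x , lookup-same simple _ _ (same-trans (same-sym (edge#-same x)) (inj₁ (s , t)))

  private
    0→ : ∀ i k → Star (Two s₀ s₁) (i , 0F) (i , k)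
    0→ i = ∀8 ε
      (inj₂ refl ◅ ε)
      (inj₁ refl ◅ inj₂ refl ◅ ε)
      (inj₁ refl ◅ ε)
      (inj₁ refl ◅ inj₂ refl ◅ inj₁ refl ◅ inj₂ refl ◅ ε)
      (inj₁ refl ◅ inj₂ refl ◅ inj₁ refl ◅ ε)
      (inj₂ refl ◅ inj₁ refl ◅ ε)
      (inj₂ refl ◅ inj₁ refl ◅ inj₂ refl ◅ ε)

    Two₀₁-sym : ∀ {x y} → Two s₀ s₁ x y → Two s₀ s₁ y x
    Two₀₁-sym {x} (inj₁ refl) = inj₁ (sym (s₀-invol x))
    Two₀₁-sym {x} (inj₂ refl) = inj₂ (sym (s₁-invol x))

  face-orbit : ∀ x y → proj₁ x ≡ proj₁ y → Star (Two s₀ s₁) x y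
  face-orbit (i , k) (_ , k′) refl = reverse Two₀₁-sym (0→ i k) ◅◅ 0→ i k′

  system : FlagSystem
  system = record
    { Flag = Flag ; size = length L * 8 ; to = remQuot 8 ; from = uncurry combine
    ; to-from = λ { (i , k) → remQuot-combine i k }
    ; from-to = combine-remQuot {length L} 8
    ; inhabited = proj₁ (flag-at 0 (s≤s z≤n))
    ; s₀ = s₀ ; s₁ = s₁ ; s₂ = s₂ ; invol₀ = s₀-invol ; invol₁ = s₁-invol ; invol₂ = s₂-invol
    ; moves₀ = λ x eq → src≢tgt x (trans (cong src (sym eq)) (src-s₀ x))
    ; moves₁ = λ { (i , k) eq → τ₁-moves k (cong proj₂ eq) }
    ; moves₂ = s₂-moves
    ; comm₀₂ = comm
    ; moves₀₂ = λ x eq → src≢tgt x (trans (cong src (sym eq)) (trans (src-s₀ (s₂ x)) (tgt-s₂ x)))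
    ; connect = flags-connected
    ; #V = n ; vertex = vertex
    ; vertex-surj = λ v → let x , s = flag-at (toℕ v) (toℕ<n v) in
        x , toℕ-injective (trans (toℕ-fromℕ< (src<n x)) s)
    ; vertex-orb = vertex-orbit
    ; vertex-inv = λ { x _ (inj₁ refl) → src-vertex {x} {s₁ x} (sym (src-s₁ x))
                     ; x _ (inj₂ refl) → src-vertex {x} {s₂ x} (sym (src-s₂ x)) }
    ; #E = length E ; side = edge# ; side-surj = edge#-surj
    ; side-orb = edge#-orbit ; side-inv = edge#-inv
    ; #F = length L ; tile = proj₁ ; tile-surj = λ i → (i , 0F) , refl
    ; tile-orb = face-orbit
    ; tile-inv = λ { x _ (inj₁ refl) → refl ; x _ (inj₂ refl) → refl } }
    where
    τ₁-moves : ∀ k → τ₁ k ≢ k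
    τ₁-moves = ∀8 (λ ()) (λ ()) (λ ()) (λ ()) (λ ()) (λ ()) (λ ()) (λ ())

  surface : Map
  surface = toMap system

  surface-simple : SimpleGraph surface
  surface-simple = toMap-simple system
    (λ x eq → src≢tgt x (trans (sym (vertex-src {s₀ x} {x} eq)) (src-s₀ x)))
    (λ x y p q → edge#-cong x y (inj₁ (vertex-src {x} {y} p ,
      trans (sym (src-s₀ x)) (trans (vertex-src {s₀ x} {s₀ y} q) (src-s₀ y)))))

  surface-quadrangular : Quadrangular surface
  surface-quadrangular = toMap-quadrangular system λ where
    x@(i , k) →
        cong (i ,_) (ρ⁴ k)
      , (λ eq → src≢tgt x (trans (vertex-src {x} {s₁ (s₀ x)} eq)
                                 (trans (src-s₁ (s₀ x)) (src-s₀ x))))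
      , (λ eq → valid-≢₂ (lookup L i) (valid-face x) k (vertex-src {x} {s₁ (s₀ (s₁ (s₀ x)))} eq))
      , (λ eq → valid-≢₃ (lookup L i) (valid-face x) k
                  (vertex-src {x} {s₁ (s₀ (s₁ (s₀ (s₁ (s₀ x)))))} eq))

  -- In an oriented list every edge is run through once in each direction, so only one of the two
  -- flags along a directed edge is forward. Hence `forward` changes under `s₂`.
  forward-unique : Oriented L E → ∀ x y → forward (proj₂ x) ≡ true → forward (proj₂ y) ≡ true →
                   src y ≡ src x → tgt y ≡ tgt x → y ≡ x
  forward-unique oriented x y fx fy p q =
    one-satisfies fd? ∈-flags count (fy , p , q) (fx , refl , refl)
    where
    d = δ (src x , tgt x)
    fd? : ∀ z → Dec (forward (proj₂ z) ≡ true × Dart (src x) (tgt x) z)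
    fd? z = (forward (proj₂ z) ≟ᵇ true) ×-dec dart? (src x) (tgt x) z
    weight : ∀ z → indicator fd? z ≡ (if forward (proj₂ z) then d (src z) (tgt z) else 0)
    weight z with forward (proj₂ z)
    ... | true = refl
    ... | false = refl
    count : sum (map (indicator fd?) flags) ≡ 1
    count = begin
      sum (map (indicator fd?) flags)
        ≡⟨ cong sum (map-cong weight flags) ⟩
      sum (map (λ z → if forward (proj₂ z) then d (src z) (tgt z) else 0) flags)
        ≡⟨ flags-sum (λ q k → if forward k then d (at q k) (nb q k) else 0) ⟩
      sum (map (λ q → sum (map (λ k → if forward k then d (at q k) (nb q k) else 0) (allFin 8))) L)
        ≡⟨ cong sum (map-cong (forwardSum d) L) ⟩
      faceTotal d L
        ≡⟨ oriented d ⟩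
      edgeTotal d E
        ≡⟨ edgeTotal-δ-present simple (src≢tgt x) (adj-dart x) ⟩
      1 ∎
      where open ≡-Reasoning

  surface-orientable : Oriented L E → Orientable surface
  surface-orientable oriented = toMap-orientable system (forward ∘ proj₂ , λ x →
      (λ eq → not-¬ {forward (proj₂ x)} refl (trans (sym eq) (forward-τ₀ (proj₂ x))))
    , (λ eq → not-¬ {forward (proj₂ x)} refl (trans (sym eq) (forward-τ₁ (proj₂ x))))
    , opposite x)
    where
    opposite : ∀ x → forward (proj₂ (s₂ x)) ≢ forward (proj₂ x)
    opposite x eq with forward (proj₂ x) in fx
    ... | true = s₂-moves x (forward-unique oriented x (s₂ x) fx eq (src-s₂ x) (tgt-s₂ x))
    -- `s₀` turns backward flags into forward flags along the reversed edge, which reduces this case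
    -- to the previous one.
    ... | false = s₂-moves x (s₀-injective (forward-unique oriented (s₀ x) (s₀ (s₂ x))
          (trans (forward-τ₀ (proj₂ x)) (cong not fx))
          (trans (forward-τ₀ (proj₂ (s₂ x))) (cong not eq))
          (trans (src-s₀ (s₂ x)) (trans (tgt-s₂ x) (sym (src-s₀ x))))
          (trans (tgt-s₀ (s₂ x)) (trans (src-s₂ x) (sym (tgt-s₀ x))))))

  -- A 2-colouring of the flags is determined on each face by its value at the flag `0F`, and these
  -- values would be a coherent choice of directions.
  surface-nonorientable : NonOrientable L → ¬ Orientable surface
  surface-nonorientable nonor orient = nonor o coherent
    where
    c : Flag → Bool
    c = proj₁ (fromMap-orientable system orient)
    c₀ : ∀ x → c (s₀ x) ≡ not (c x)
    c₀ x = ¬-not (proj₁ (proj₂ (fromMap-orientable system orient) x))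
    c₁ : ∀ x → c (s₁ x) ≡ not (c x)
    c₁ x = ¬-not (proj₁ (proj₂ (proj₂ (fromMap-orientable system orient) x)))
    c₂ : ∀ x → c (s₂ x) ≢ c x
    c₂ x = proj₂ (proj₂ (proj₂ (fromMap-orientable system orient) x))
    _∈?_ : ∀ q L → Dec (q ∈ L)
    q ∈? L = any? (quad-≟ q) L
    o : Quad → Bool
    o q with q ∈? L
    ... | yes q∈ = c (Any.index q∈ , 0F)
    ... | no _ = false
    turn : Bool → Fin 8 → Bool
    turn b k = if b then forward k else not (forward k)
    c-turn : ∀ i k → c (i , k) ≡ turn (c (i , 0F)) k
    c-turn i = ∀8
      (at0 _)
      (trans (c₁ (i , 0F)) (at1 _))
      (trans e2 (at0 _))
      (trans (c₀ (i , 0F)) (at1 _))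
      (trans e4 (at0 _))
      (trans (trans (c₀ (i , 2F)) (cong not e2)) (at1 _))
      (trans e6 (at0 _))
      (trans (trans (c₁ (i , 6F)) (cong not e6)) (at1 _))
      where
      open import Data.Bool.Properties using (not-involutive)
      at0 : ∀ b → b ≡ turn b 0F
      at0 true = refl
      at0 false = refl
      at1 : ∀ b → not b ≡ turn b 1F
      at1 true = refl
      at1 false = refl
      e2 : c (i , 2F) ≡ c (i , 0F)
      e2 = trans (c₁ (i , 3F)) (trans (cong not (c₀ (i , 0F))) (not-involutive _))
      e4 : c (i , 4F) ≡ c (i , 0F)
      e4 = trans (c₁ (i , 5F)) (trans (cong not (c₀ (i , 2F))) (trans (not-involutive _) e2))
      e6 : c (i , 6F) ≡ c (i , 0F)
      e6 = trans (c₀ (i , 1F)) (trans (cong not (c₁ (i , 0F))) (not-involutive _))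
    position : ∀ {q} → q ∈ L → ∃ λ i → lookup L i ≡ q × o q ≡ c (i , 0F)
    position {q} q∈ with q ∈? L
    ... | yes q∈′ = Any.index q∈′ , sym (Any.lookup-index q∈′) , refl
    ... | no q∉ = contradiction q∈ q∉
    coherent : Coherent o L
    coherent q∈ q′∈ q≢q′ k k′ p r eq with position q∈ | position q′∈
    ... | i , refl , oi | j , refl , oj rewrite oi | oj =
      c₂ (i , k) (trans (cong c (sym y≡s₂x))
        (trans (c-turn j k′) (trans (sym eq) (sym (c-turn i k)))))
      where
      y≡s₂x : (j , k′) ≡ s₂ (i , k)
      y≡s₂x = s₂-unique (i , k) (j , k′) (sym p) (sym r) (λ e → q≢q′ (cong (lookup L ∘ proj₁) (sym e)))

-- Surgery

mapQ : (ℕ → ℕ) → Quad → Quad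
mapQ ι (quad a b c d) = quad (ι a) (ι b) (ι c) (ι d)

mapE : (ℕ → ℕ) → Edge → Edge
mapE ι (u , v) = ι u , ι v

at-mapQ : ∀ ι q k → at (mapQ ι q) k ≡ ι (at q k)
at-mapQ ι (quad a b c d) = ∀8 refl refl refl refl refl refl refl refl

nb-mapQ : ∀ ι q k → nb (mapQ ι q) k ≡ ι (nb q k)
nb-mapQ ι (quad a b c d) = ∀8 refl refl refl refl refl refl refl refl

-- Replacing the faces pre by post, on labels: labels below o are the old
-- vertices of the patch, the others are new vertices.
record Surgery (o : ℕ) (pre post : List Quad) (new : List Edge) : Set where
  field
    sums    : ∀ f → faceTotal f post ≡ faceTotal f pre + edgeTotal f new
    through : ∀ {v w x} → Link pre v w x → Star (Link post v) w x
    old     : ∀ {v w} → v < o → Nbr post v w → ∃ λ w₀ → Nbr pre v w₀ × Star (Link post v) w w₀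
    fresh   : ∀ {v w x} → o ≤ v → Nbr post v w → Nbr post v x → Star (Link post v) w x

link-mapQ : ∀ ι {L v w x} → Link L v w x → Link (map (mapQ ι) L) (ι v) (ι w) (ι x)
link-mapQ ι (link {q} q∈ k refl refl refl) =
  link (∈-map⁺ (mapQ ι) q∈) k (at-mapQ ι q k) (nb-mapQ ι q k) (nb-mapQ ι q (τ₁ k))

link-++ˡ : ∀ {L R v w x} → Link L v w x → Link (L ++ R) v w x
link-++ˡ (link q∈ k p q r) = link (∈-++⁺ˡ q∈) k p q r

star-mapQ : ∀ ι {L R v w x} → Star (Link L v) w x → Star (Link (map (mapQ ι) L ++ R) (ι v)) (ι w) (ι x)
star-mapQ ι = gmap ι (link-++ˡ ∘ link-mapQ ι)

link-nbr : ∀ {L v w x} → Link L v w x → Nbr L v w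
link-nbr (link q∈ k p q _) = nbr q∈ k p q

link-sym : ∀ {L v w x} → Link L v w x → Link L v x w
link-sym (link {q} q∈ k p r s) =
  link q∈ (τ₁ k) (trans (at-τ₁ q k) p) s (trans (cong (nb q) (τ₁-invol k)) r)

edgeTotal-flip : ∀ f E → edgeTotal (flip f) E ≡ edgeTotal f E
edgeTotal-flip f E = cong sum (map-cong (λ { (u , v) → +-comm (f v u) (f u v) }) E)

faceTotal-++ : ∀ f L R → faceTotal f (L ++ R) ≡ faceTotal f L + faceTotal f R
faceTotal-++ f L R = trans (cong sum (map-++ (faceSum f) L R)) (sum-++ (map (faceSum f) L) _)

edgeTotal-++ : ∀ f E D → edgeTotal f (E ++ D) ≡ edgeTotal f E + edgeTotal f D
edgeTotal-++ f E D = trans (cong sum (map-++ (edgeSum f) E D)) (sum-++ (map (edgeSum f) E) _)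

faceTotal-map : ∀ f ι L → faceTotal f (map (mapQ ι) L) ≡ faceTotal (λ u v → f (ι u) (ι v)) L
faceTotal-map f ι L = cong sum (trans (sym (map-∘ L)) (map-cong (λ { (quad a b c d) → refl }) L))

edgeTotal-map : ∀ f ι E → edgeTotal f (map (mapE ι) E) ≡ edgeTotal (λ u v → f (ι u) (ι v)) E
edgeTotal-map f ι E = cong sum (trans (sym (map-∘ E)) (map-cong (λ { (u , v) → refl }) E))

module _ {o pre post new} (S : Surgery o pre post new) (ι : ℕ → ℕ) where
  open Surgery S

  surgery-total : ∀ R f → faceTotal f (map (mapQ ι) post ++ R) ≡
                          edgeTotal f (map (mapE ι) new) + faceTotal f (map (mapQ ι) pre ++ R)
  surgery-total R f = begin
    faceTotal f (map (mapQ ι) post ++ R)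
      ≡⟨ faceTotal-++ f (map (mapQ ι) post) R ⟩
    faceTotal f (map (mapQ ι) post) + faceTotal f R
      ≡⟨ cong (_+ faceTotal f R) (trans (faceTotal-map f ι post) (sums g)) ⟩
    faceTotal g pre + edgeTotal g new + faceTotal f R
      ≡⟨ cong (_+ faceTotal f R) (+-comm (faceTotal g pre) _) ⟩
    edgeTotal g new + faceTotal g pre + faceTotal f R
      ≡⟨ +-assoc (edgeTotal g new) _ _ ⟩
    edgeTotal g new + (faceTotal g pre + faceTotal f R)
      ≡⟨ cong₂ (λ x y → x + (y + faceTotal f R)) (edgeTotal-map f ι new) (faceTotal-map f ι pre) ⟨
    edgeTotal f (map (mapE ι) new) + (faceTotal f (map (mapQ ι) pre) + faceTotal f R)
      ≡⟨ cong (edgeTotal f (map (mapE ι) new) +_) (faceTotal-++ f (map (mapQ ι) pre) R) ⟨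
    edgeTotal f (map (mapE ι) new) + faceTotal f (map (mapQ ι) pre ++ R) ∎
    where
    open ≡-Reasoning
    g : ℕ → ℕ → ℕ
    g u v = f (ι u) (ι v)

  surgery-oriented : ∀ {R E} → Oriented (map (mapQ ι) pre ++ R) E →
                     Oriented (map (mapQ ι) post ++ R) (map (mapE ι) new ++ E)
  surgery-oriented {R} {E} or f = trans (surgery-total R f)
    (trans (cong (edgeTotal f (map (mapE ι) new) +_) (or f)) (sym (edgeTotal-++ f (map (mapE ι) new) E)))

  module _ {n n′ R E} (I : Inv n (map (mapQ ι) pre ++ R) E)
           (ι-old : ∀ {v} → v < o → ι v < n) (ι-new : ∀ {v} → o ≤ v → n ≤ ι v)
           (ι-inj : ∀ {u v} → o ≤ u → o ≤ v → ι u ≡ ι v → u ≡ v) (n≤n′ : n ≤ n′) where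
    open Inv I renaming (links to links₀; conn to conn₀)

    private
      L₀ L₁ : List Quad
      L₀ = map (mapQ ι) pre ++ R
      L₁ = map (mapQ ι) post ++ R
      E₁ : List Edge
      E₁ = map (mapE ι) new ++ E

      valid-R : All (Valid n) R
      valid-R = All.++⁻ʳ (map (mapQ ι) pre) valid

      lift : ∀ {v w x} → Link L₀ v w x → Star (Link L₁ v) w x
      lift (link {q} q∈ k refl refl refl) with ∈-++⁻ (map (mapQ ι) pre) q∈
      ... | inj₂ q∈R = return (link (∈-++⁺ʳ (map (mapQ ι) post) q∈R) k refl refl refl)
      ... | inj₁ q∈pre with ∈-map⁻ (mapQ ι) q∈pre
      ...   | p , p∈ , refl rewrite at-mapQ ι p k | nb-mapQ ι p k | nb-mapQ ι p (τ₁ k) =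
        star-mapQ ι (through (link p∈ k refl refl refl))

      nbr-mapQ : ∀ {L v w} → Nbr L v w → Nbr (map (mapQ ι) L ++ R) (ι v) (ι w)
      nbr-mapQ (nbr {q} q∈ k refl refl) = nbr (∈-++⁺ˡ (∈-map⁺ (mapQ ι) q∈)) k (at-mapQ ι q k) (nb-mapQ ι q k)

      data Origin (v w : ℕ) : Set where
        rest  : Nbr R v w → Origin v w
        patch : ∀ {v′ w′} → Nbr post v′ w′ → v ≡ ι v′ → w ≡ ι w′ → Origin v w

      origin : ∀ {v w} → Nbr L₁ v w → Origin v w
      origin (nbr {q} q∈ k refl refl) with ∈-++⁻ (map (mapQ ι) post) q∈
      ... | inj₂ q∈R = rest (nbr q∈R k refl refl)
      ... | inj₁ q∈post with ∈-map⁻ (mapQ ι) q∈post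
      ...   | p , p∈ , refl = patch (nbr p∈ k refl refl) (at-mapQ ι p k) (nb-mapQ ι p k)

      nbr-R< : ∀ {v w} → Nbr R v w → v < n
      nbr-R< (nbr {q} q∈ k refl refl) = valid-< q (All.lookup valid-R q∈) k

      back : ∀ {v w} → v < n → Nbr L₁ v w → ∃ λ w₀ → Nbr L₀ v w₀ × Star (Link L₁ v) w w₀
      back v<n nb₁ with origin nb₁
      ... | rest (nbr q∈ k p q) = _ , nbr (∈-++⁺ʳ (map (mapQ ι) pre) q∈) k p q , ε
      ... | patch {v′} {w′} np refl refl with v′ <? o
      ...   | yes v′<o = let w₀ , n₀ , st = old v′<o np in ι w₀ , nbr-mapQ n₀ , star-mapQ ι st
      ...   | no v′≮o = contradiction v<n (≤⇒≯ (ι-new (≮⇒≥ v′≮o)))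

      label≥ : ∀ {v′} → n ≤ ι v′ → o ≤ v′
      label≥ {v′} n≤ with v′ <? o
      ... | yes v′<o = contradiction (ι-old v′<o) (≤⇒≯ n≤)
      ... | no v′≮o = ≮⇒≥ v′≮o

      joined : ∀ v w x → Nbr L₁ v w → Nbr L₁ v x → Star (Link L₁ v) w x
      joined v w x nw nx with v <? n
      ... | yes v<n =
        let w₀ , nw₀ , sw = back v<n nw
            x₀ , nx₀ , sx = back v<n nx
        in sw ◅◅ kleisliStar id lift (links₀ v w₀ x₀ nw₀ nx₀) ◅◅ reverse link-sym sx
      ... | no v≮n with origin nw | origin nx
      ...   | rest r | _ = contradiction (nbr-R< r) v≮n
      ...   | patch _ _ _ | rest r = contradiction (nbr-R< r) v≮n
      ...   | patch {v₁} n₁ refl refl | patch {v₂} n₂ eq refl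
              with ι-inj (label≥ (≮⇒≥ v≮n)) (label≥ (subst (n ≤_) eq (≮⇒≥ v≮n))) eq
      ...     | refl = star-mapQ ι (fresh (label≥ (≮⇒≥ v≮n)) n₁ n₂)

    -- The point is the links. At an old vertex, `old` leads every neighbour after the surgery to
    -- one from before, and `through` replaces each lost link by a path, so the former connection
    -- survives. At a fresh vertex all links lie in the patch. Injectivity of `ι` is assumed on
    -- fresh labels alone, so two old labels may name the same vertex, as happens when the two faces
    -- of a tube share a corner.
    surgery-inv :
      All (Valid n′) (map (mapQ ι) post) →
      AllPairs (λ e e′ → ¬ Same e e′) E₁ →
      (∀ v → n ≤ v → v < n′ → Star (Adj E₁) 0 v) →
      Inv n′ L₁ E₁
    surgery-inv valid₁ simple₁ conn₁ = record
      { valid = All.++⁺ valid₁ (All.map (λ {q} → valid-≤ q) valid-R)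
      ; sides = sides₁
      ; simple = simple₁
      ; links = joined
      ; conn = conn-all }
      where
      valid-≤ : ∀ q → Valid n q → Valid n′ q
      valid-≤ (quad a b c d) ((p , q , r , s) , distinct) =
        (<-≤-trans p n≤n′ , <-≤-trans q n≤n′ , <-≤-trans r n≤n′ , <-≤-trans s n≤n′) , distinct
      conn-all : ∀ v → v < n′ → Star (Adj E₁) 0 v
      conn-all v v<n′ with v <? n
      ... | yes v<n = gmap id (Any.++⁺ʳ (map (mapE ι) new)) (conn₀ v v<n)
      ... | no v≮n = conn₁ v (≮⇒≥ v≮n) v<n′
      sides₁ : TwoSided L₁ E₁
      sides₁ f = begin
        faceTotal f L₁ + faceTotal (flip f) L₁
          ≡⟨ cong₂ _+_ (surgery-total R f) (surgery-total R (flip f)) ⟩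
        (added f + faceTotal f L₀) + (added (flip f) + faceTotal (flip f) L₀)
          ≡⟨ cong (λ x → (added f + faceTotal f L₀) + (x + faceTotal (flip f) L₀)) (edgeTotal-flip f (map (mapE ι) new)) ⟩
        (added f + faceTotal f L₀) + (added f + faceTotal (flip f) L₀)
          ≡⟨ interchange (added f) _ _ _ ⟩
        (added f + added f) + (faceTotal f L₀ + faceTotal (flip f) L₀)
          ≡⟨ cong ((added f + added f) +_) (sides f) ⟩
        (added f + added f) + (edgeTotal f E + edgeTotal f E)
          ≡⟨ interchange (added f) _ _ _ ⟩
        (added f + edgeTotal f E) + (added f + edgeTotal f E)
          ≡⟨ cong (λ x → x + x) (edgeTotal-++ f (map (mapE ι) new) E) ⟨
        edgeTotal f E₁ + edgeTotal f E₁ ∎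
        where
        open ≡-Reasoning
        added : (ℕ → ℕ → ℕ) → ℕ
        added g = edgeTotal g (map (mapE ι) new)
        interchange : ∀ a b c d → (a + b) + (c + d) ≡ (a + c) + (b + d)
        interchange = solve-∀

inv-↭ : ∀ {n L L′ E} → L ↭ L′ → Inv n L E → Inv n L′ E
inv-↭ {n} {L} {L′} {E} p I = record
  { valid = All-resp-↭ p (Inv.valid I)
  ; sides = λ f → trans (cong₂ _+_ (total f) (total (flip f))) (Inv.sides I f)
  ; simple = Inv.simple I
  ; links = λ { v w x (nbr q∈ k e₁ e₂) (nbr q′∈ k′ e₁′ e₂′) →
      gmap id (λ { (link r∈ j a b c) → link (∈-resp-↭ p r∈) j a b c })
        (Inv.links I v w x (nbr (∈-resp-↭ (↭-sym p) q∈) k e₁ e₂) (nbr (∈-resp-↭ (↭-sym p) q′∈) k′ e₁′ e₂′)) }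
  ; conn = Inv.conn I }
  where
  total : ∀ f → faceTotal f L′ ≡ faceTotal f L
  total f = sym (sum-↭ (map⁺ (faceSum f) p))

oriented-↭ : ∀ {L L′ E} → L ↭ L′ → Oriented L E → Oriented L′ E
oriented-↭ p or f = trans (sym (sum-↭ (map⁺ (faceSum f) p))) (or f)

nonorientable-⊆ : ∀ {L L′} → (∀ {q} → q ∈ L → q ∈ L′) → NonOrientable L → NonOrientable L′
nonorientable-⊆ sub nonor o coh = nonor o (λ p q → coh (sub p) (sub q))

-- Verification of explicit face lists by computation

Table : Set
Table = List (ℕ × ℕ)

corner : Bool → (x y : ℕ) → Table
corner true  x y = (x , y) ∷ (y , x) ∷ []
corner false x y = []

corner-∈ : ∀ {v u x y p} → p ∈ corner (v ≡ᵇ u) x y → u ≡ v × (p ≡ (x , y) ⊎ p ≡ (y , x))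
corner-∈ {v} {u} m with v ≡ᵇ u | ≡ᵇ⇒≡ v u
corner-∈ (here refl)         | true | eq = sym (eq tt) , inj₁ refl
corner-∈ (there (here refl)) | true | eq = sym (eq tt) , inj₂ refl

corner-refl : ∀ v x y → (x , y) ∈ corner (v ≡ᵇ v) x y × (y , x) ∈ corner (v ≡ᵇ v) x y
corner-refl v x y with v ≡ᵇ v | ≡⇒≡ᵇ v v refl
... | true | _ = here refl , there (here refl)

linksIn : Quad → ℕ → Table
linksIn (quad a b c d) v =
  corner (v ≡ᵇ a) b d ++ corner (v ≡ᵇ b) c a ++ corner (v ≡ᵇ c) d b ++ corner (v ≡ᵇ d) a c

linksAt : List Quad → ℕ → Table
linksAt L v = concatMap (λ q → linksIn q v) L

linksIn-sound : ∀ q {v w x} → (w , x) ∈ linksIn q v → ∃ λ k → at q k ≡ v × nb q k ≡ w × nb q (τ₁ k) ≡ x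
linksIn-sound (quad a b c d) {v} m with ∈-++⁻ (corner (v ≡ᵇ a) b d) m
... | inj₁ m₀ with corner-∈ {v} m₀
...   | e , inj₁ refl = 0F , e , refl , refl
...   | e , inj₂ refl = 1F , e , refl , refl
linksIn-sound (quad a b c d) {v} m | inj₂ m₁ with ∈-++⁻ (corner (v ≡ᵇ b) c a) m₁
... | inj₁ m₀ with corner-∈ {v} m₀
...   | e , inj₁ refl = 2F , e , refl , refl
...   | e , inj₂ refl = 3F , e , refl , refl
linksIn-sound (quad a b c d) {v} m | inj₂ m₁ | inj₂ m₂ with ∈-++⁻ (corner (v ≡ᵇ c) d b) m₂
... | inj₁ m₀ with corner-∈ {v} m₀
...   | e , inj₁ refl = 4F , e , refl , refl
...   | e , inj₂ refl = 5F , e , refl , refl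
linksIn-sound (quad a b c d) {v} m | inj₂ m₁ | inj₂ m₂ | inj₂ m₃ with corner-∈ {v} m₃
... | e , inj₁ refl = 6F , e , refl , refl
... | e , inj₂ refl = 7F , e , refl , refl

linksIn-complete : ∀ q k → (nb q k , nb q (τ₁ k)) ∈ linksIn q (at q k)
linksIn-complete (quad a b c d) = ∀8
  (∈-++⁺ˡ (proj₁ (corner-refl a b d))) (∈-++⁺ˡ (proj₂ (corner-refl a b d)))
  (skip (b ≡ᵇ a) (∈-++⁺ˡ (proj₁ (corner-refl b c a)))) (skip (b ≡ᵇ a) (∈-++⁺ˡ (proj₂ (corner-refl b c a))))
  (skip (c ≡ᵇ a) (skip (c ≡ᵇ b) (∈-++⁺ˡ (proj₁ (corner-refl c d b)))))
  (skip (c ≡ᵇ a) (skip (c ≡ᵇ b) (∈-++⁺ˡ (proj₂ (corner-refl c d b)))))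
  (skip (d ≡ᵇ a) (skip (d ≡ᵇ b) (skip (d ≡ᵇ c) (proj₁ (corner-refl d a c)))))
  (skip (d ≡ᵇ a) (skip (d ≡ᵇ b) (skip (d ≡ᵇ c) (proj₂ (corner-refl d a c)))))
  where
  skip : ∀ t {x y p} {T : Table} → p ∈ T → p ∈ corner t x y ++ T
  skip t {x} {y} = ∈-++⁺ʳ (corner t x y)

linksAt-sound : ∀ L {v w x} → (w , x) ∈ linksAt L v → Link L v w x
linksAt-sound L {v} m with find (∈-concatMap⁻ (λ q → linksIn q v) {xs = L} m)
... | q , q∈ , m′ = let k , p , r , s = linksIn-sound q m′ in link q∈ k p r s

linksAt-complete : ∀ {L v w x} → Link L v w x → (w , x) ∈ linksAt L v
linksAt-complete (link {q} q∈ k refl refl refl) =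
  ∈-concatMap⁺ (λ q′ → linksIn q′ (at q k)) (lose q∈ (linksIn-complete q k))

onward : Table → (p c : ℕ) → List ℕ
onward [] p c = []
onward ((w , x) ∷ T) p c = if (w ≡ᵇ c) ∧ not (x ≡ᵇ p) then x ∷ onward T p c else onward T p c

onward-sound : ∀ T p c {x} → x ∈ onward T p c → (c , x) ∈ T
onward-sound ((w , x) ∷ T) p c m with w ≡ᵇ c | ≡ᵇ⇒≡ w c | x ≡ᵇ p
onward-sound ((w , x) ∷ T) p c m           | false | _ | _ = there (onward-sound T p c m)
onward-sound ((w , x) ∷ T) p c m           | true | _ | true = there (onward-sound T p c m)
onward-sound ((w , x) ∷ T) p c (here refl) | true | eq | false = here (cong (_, x) (sym (eq tt)))
onward-sound ((w , x) ∷ T) p c (there m)   | true | _ | false = there (onward-sound T p c m)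

-- Walking from c without turning back to p explores a path or a cycle in
-- linear time.
walk : Table → ℕ → (p c : ℕ) → List ℕ
walk T zero p c = c ∷ []
walk T (suc fuel) p c = c ∷ concatMap (walk T fuel c) (onward T p c)

walk-sound : ∀ T fuel p c {x} → x ∈ walk T fuel p c → Star (λ w x → (w , x) ∈ T) c x
walk-sound T zero p c (here refl) = ε
walk-sound T (suc fuel) p c (here refl) = ε
walk-sound T (suc fuel) p c (there m) with find (∈-concatMap⁻ (walk T fuel c) {xs = onward T p c} m)
... | y , y∈ , m′ = onward-sound T p c y∈ ◅ walk-sound T fuel c y m′

-- With `w` as its own predecessor both directions along a cycle stay open. The fuel suffices to go
-- round a cycle; a walk that stopped short could make a test fail, but never succeed wrongly.
reach : Table → ℕ → List ℕ
reach T w = walk T (length T) w w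

reach-sound : ∀ L {v w x} → x ∈ reach (linksAt L v) w → Star (Link L v) w x
reach-sound L m = gmap id (linksAt-sound L) (walk-sound _ _ _ _ m)

_∈ᵇ_ : ℕ → List ℕ → Bool
x ∈ᵇ xs = any (x ≡ᵇ_) xs

∈ᵇ-sound : ∀ {x} xs → T (x ∈ᵇ xs) → x ∈ xs
∈ᵇ-sound {x} xs t = Any.map (λ {y} → ≡ᵇ⇒≡ x y) (Any.any⁻ (x ≡ᵇ_) xs t)

connectedᵇ : Table → Bool
connectedᵇ [] = true
connectedᵇ T@((w , _) ∷ _) = all (λ p → proj₁ p ∈ᵇ r) T
  where r = reach T w

link-of : ∀ {L v w} → Nbr L v w → ∃ (Link L v w)
link-of (nbr q∈ k p r) = _ , link q∈ k p r refl

cyclic : ∀ {L v w x} → T (connectedᵇ (linksAt L v)) → Nbr L v w → Nbr L v x → Star (Link L v) w x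
cyclic {L} {v} cyc nw nx
  with linksAt L v in eq | linksAt-complete (proj₂ (link-of nw)) | linksAt-complete (proj₂ (link-of nx))
... | T@((w₀ , _) ∷ _) | w∈ | x∈ = reverse link-sym (from w∈) ◅◅ from x∈
  where
  from : ∀ {y z} → (y , z) ∈ T → Star (Link L v) w₀ y
  from m = reach-sound L (subst (λ T → _ ∈ reach T w₀) (sym eq)
    (∈ᵇ-sound (reach T w₀) (All.lookup (All.all⁺ (λ p → proj₁ p ∈ᵇ reach T w₀) T cyc) m)))

-- The two halves are the fields `through` and `old` of `Surgery` at a single vertex.
threadedᵇ : (pre post : Table) → Bool
threadedᵇ pre post =
  all (λ p → proj₂ p ∈ᵇ reach post (proj₁ p)) pre ∧
  all (λ p → any (λ p₀ → proj₁ p₀ ∈ᵇ reach post (proj₁ p)) pre) post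

_≤ᴱ_ : Edge → Edge → Bool
(u , v) ≤ᴱ (u′ , v′) = (u <ᵇ u′) ∨ ((u ≡ᵇ u′) ∧ (v ≤ᵇ v′))

merge : List Edge → List Edge → List Edge
merge [] es = es
merge (d ∷ ds) = into
  where
  into : List Edge → List Edge
  into [] = d ∷ ds
  into (e ∷ es) = if d ≤ᴱ e then d ∷ merge ds (e ∷ es) else e ∷ into es

mergePairs : List (List Edge) → List (List Edge)
mergePairs (ds ∷ es ∷ rest) = merge ds es ∷ mergePairs rest
mergePairs rest = rest

mergeAll : ℕ → List (List Edge) → List Edge
mergeAll (suc fuel) (ds ∷ es ∷ rest) = mergeAll fuel (mergePairs (ds ∷ es ∷ rest))
mergeAll _ rest = concat rest

-- Sixteen rounds merge up to 65536 singletons. Whether the result is really sorted is never at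
-- issue: two lists with the same image have equal totals because `sort` preserves totals, and this
-- makes an equality of multisets provable by `refl`.
sort : List Edge → List Edge
sort ds = mergeAll 16 (map (_∷ []) ds)

dartTotal : (ℕ → ℕ → ℕ) → List Edge → ℕ
dartTotal f ds = sum (map (uncurry f) ds)

dartTotal-++ : ∀ f ds es → dartTotal f (ds ++ es) ≡ dartTotal f ds + dartTotal f es
dartTotal-++ f ds es = trans (cong sum (map-++ (uncurry f) ds es)) (sum-++ (map (uncurry f) ds) _)

merge-total : ∀ f ds es → dartTotal f (merge ds es) ≡ dartTotal f ds + dartTotal f es
merge-total f [] es = refl
merge-total f (d ∷ ds) [] = sym (+-identityʳ _)
merge-total f (d ∷ ds) (e ∷ es)
  with d ≤ᴱ e | merge-total f ds (e ∷ es) | merge-total f (d ∷ ds) es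
... | true  | eq | _  = trans (cong (uncurry f d +_) eq) (sym (+-assoc (uncurry f d) _ _))
... | false | _  | eq = trans (cong (uncurry f e +_) eq) (exchange (uncurry f e) (dartTotal f (d ∷ ds)) _)
  where
  exchange : ∀ x y z → x + (y + z) ≡ y + (x + z)
  exchange = solve-∀

mergePairs-total : ∀ f dss → dartTotal f (concat (mergePairs dss)) ≡ dartTotal f (concat dss)
mergePairs-total f [] = refl
mergePairs-total f (_ ∷ []) = refl
mergePairs-total f (ds ∷ es ∷ dss) = begin
  dartTotal f (merge ds es ++ concat (mergePairs dss))
    ≡⟨ dartTotal-++ f (merge ds es) _ ⟩
  dartTotal f (merge ds es) + dartTotal f (concat (mergePairs dss))
    ≡⟨ cong₂ _+_ (merge-total f ds es) (mergePairs-total f dss) ⟩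
  dartTotal f ds + dartTotal f es + dartTotal f (concat dss)
    ≡⟨ +-assoc (dartTotal f ds) _ _ ⟩
  dartTotal f ds + (dartTotal f es + dartTotal f (concat dss))
    ≡⟨ cong (dartTotal f ds +_) (dartTotal-++ f es _) ⟨
  dartTotal f ds + dartTotal f (es ++ concat dss)
    ≡⟨ dartTotal-++ f ds _ ⟨
  dartTotal f (ds ++ es ++ concat dss) ∎
  where open ≡-Reasoning

mergeAll-total : ∀ f k dss → dartTotal f (mergeAll k dss) ≡ dartTotal f (concat dss)
mergeAll-total f zero dss = refl
mergeAll-total f (suc k) [] = refl
mergeAll-total f (suc k) (_ ∷ []) = refl
mergeAll-total f (suc k) dss@(_ ∷ _ ∷ _) =
  trans (mergeAll-total f k (mergePairs dss)) (mergePairs-total f dss)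

sort-total : ∀ f ds → dartTotal f (sort ds) ≡ dartTotal f ds
sort-total f ds = trans (mergeAll-total f 16 (map (_∷ []) ds)) (cong (dartTotal f) (concat-map-[_] ds))

darts : List Quad → List Edge
darts [] = []
darts (quad a b c d ∷ L) = (a , b) ∷ (b , c) ∷ (c , d) ∷ (d , a) ∷ darts L

bothWays : List Edge → List Edge
bothWays [] = []
bothWays ((u , v) ∷ E) = (u , v) ∷ (v , u) ∷ bothWays E

faceTotal-darts : ∀ f L → faceTotal f L ≡ dartTotal f (darts L)
faceTotal-darts f [] = refl
faceTotal-darts f (quad a b c d ∷ L) =
  trans (cong (faceSum f (quad a b c d) +_) (faceTotal-darts f L)) (assoc (f a b) (f b c) (f c d) (f d a) _)
  where
  assoc : ∀ x y z t s → x + y + z + t + s ≡ x + (y + (z + (t + s)))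
  assoc = solve-∀

edgeTotal-bothWays : ∀ f E → edgeTotal f E ≡ dartTotal f (bothWays E)
edgeTotal-bothWays f [] = refl
edgeTotal-bothWays f ((u , v) ∷ E) =
  trans (cong (f u v + f v u +_) (edgeTotal-bothWays f E)) (+-assoc (f u v) _ _)

dartTotal-swap : ∀ f ds → dartTotal f (map swap ds) ≡ dartTotal (flip f) ds
dartTotal-swap f ds = cong sum (sym (map-∘ ds))

sorted-equal : ∀ f {ds es} → sort ds ≡ sort es → dartTotal f ds ≡ dartTotal f es
sorted-equal f {ds} {es} eq = trans (sym (sort-total f ds)) (trans (cong (dartTotal f) eq) (sort-total f es))

validᵇ : ℕ → Quad → Bool
validᵇ n (quad a b c d) =
  ((a <ᵇ n) ∧ (b <ᵇ n) ∧ (c <ᵇ n) ∧ (d <ᵇ n)) ∧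
  (not (a ≡ᵇ b) ∧ not (a ≡ᵇ c) ∧ not (a ≡ᵇ d) ∧ not (b ≡ᵇ c) ∧ not (b ≡ᵇ d) ∧ not (c ≡ᵇ d))

∧-sound : ∀ {x y} → T (x ∧ y) → T x × T y
∧-sound = Equivalence.to T-∧

∨-sound : ∀ {x y} → T (x ∨ y) → T x ⊎ T y
∨-sound = Equivalence.to T-∨

≢-sound : ∀ {x y} → T (not (x ≡ᵇ y)) → x ≢ y
≢-sound {x} {y} t refl with x ≡ᵇ x | ≡⇒≡ᵇ x x refl
... | true | _ = t

valid-sound : ∀ n q → T (validᵇ n q) → Valid n q
valid-sound n (quad a b c d) t =
  let r , s = ∧-sound t
      a< , r = ∧-sound r ; b< , r = ∧-sound {b <ᵇ n} r ; c< , d< = ∧-sound {c <ᵇ n} r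
      ab , s = ∧-sound s ; ac , s = ∧-sound {not (a ≡ᵇ c)} s ; ad , s = ∧-sound {not (a ≡ᵇ d)} s
      bc , s = ∧-sound {not (b ≡ᵇ c)} s ; bd , cd = ∧-sound {not (b ≡ᵇ d)} s
  in (<ᵇ⇒< a n a< , <ᵇ⇒< b n b< , <ᵇ⇒< c n c< , <ᵇ⇒< d n d<) ,
     (≢-sound ab , ≢-sound ac , ≢-sound ad , ≢-sound bc , ≢-sound bd , ≢-sound cd)

Simple : List Edge → Set
Simple = AllPairs (λ e e′ → ¬ Same e e′)

sameᵇ : Edge → Edge → Bool
sameᵇ (u , v) (u′ , v′) = ((u ≡ᵇ u′) ∧ (v ≡ᵇ v′)) ∨ ((u ≡ᵇ v′) ∧ (v ≡ᵇ u′))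

same-sound : ∀ e e′ → T (sameᵇ e e′) → Same e e′
same-sound (u , v) (u′ , v′) t = Sum.map
  (λ t → let p , q = ∧-sound t in ≡ᵇ⇒≡ u u′ p , ≡ᵇ⇒≡ v v′ q)
  (λ t → let p , q = ∧-sound t in ≡ᵇ⇒≡ u v′ p , ≡ᵇ⇒≡ v u′ q)
  (∨-sound {(u ≡ᵇ u′) ∧ (v ≡ᵇ v′)} t)

same-complete : ∀ {e e′} → Same e e′ → T (sameᵇ e e′)
same-complete {u , v} (inj₁ (refl , refl)) =
  Equivalence.from T-∨ (inj₁ (Equivalence.from T-∧ (≡⇒≡ᵇ u u refl , ≡⇒≡ᵇ v v refl)))
same-complete {u , v} (inj₂ (refl , refl)) =
  Equivalence.from (T-∨ {(u ≡ᵇ v) ∧ (v ≡ᵇ u)}) (inj₂ (Equivalence.from T-∧ (≡⇒≡ᵇ u u refl , ≡⇒≡ᵇ v v refl)))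

simpleᵇ : List Edge → Bool
simpleᵇ [] = true
simpleᵇ (e ∷ E) = all (λ e′ → not (sameᵇ e e′)) E ∧ simpleᵇ E

simple-sound : ∀ E → T (simpleᵇ E) → Simple E
simple-sound [] _ = []
simple-sound (e ∷ E) t =
  let p , q = ∧-sound t in
  All.map (λ {e′} d s → refute (sameᵇ e e′) d (same-complete s)) (All.all⁺ _ E p) ∷ simple-sound E q
  where
  refute : ∀ b → T (not b) → ¬ T b
  refute false _ ()

adjᵇ : List Edge → ℕ → ℕ → Bool
adjᵇ E v w = any (sameᵇ (v , w)) E

adj-sound : ∀ E v w → T (adjᵇ E v w) → Adj E v w
adj-sound E v w t = Any.map (λ {e} → same-sound (v , w) e) (Any.any⁻ _ E t)

edgesOf : List Quad → List Edge
edgesOf L = foldr (λ e E → if any (sameᵇ e) E then E else e ∷ E) [] (darts L)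

-- A sufficient test for connectedness: every vertex is within distance two of 0.
nearᵇ : List Edge → ℕ → ℕ → Bool
nearᵇ E n v = (v ≡ᵇ 0) ∨ adjᵇ E 0 v ∨ any (λ u → adjᵇ E 0 u ∧ adjᵇ E u v) (upTo n)

near-star : ∀ E n v → T (nearᵇ E n v) → Star (Adj E) 0 v
near-star E n v t with ∨-sound {v ≡ᵇ 0} t
... | inj₁ p with ≡ᵇ⇒≡ v 0 p
...   | refl = ε
near-star E n v t | inj₂ t′ with ∨-sound {adjᵇ E 0 v} t′
... | inj₁ a = return (adj-sound E 0 v a)
... | inj₂ p =
  let u , _ , ab = find (Any.any⁻ _ (upTo n) p)
      a , b = ∧-sound ab
  in adj-sound E 0 u a ◅ adj-sound E u v b ◅ ε

orientedCheck : ∀ {L E} → sort (darts L) ≡ sort (bothWays E) → Oriented L E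
orientedCheck {L} {E} eq f =
  trans (faceTotal-darts f L) (trans (sorted-equal f {darts L} {bothWays E} eq) (sym (edgeTotal-bothWays f E)))

record Closed (n : ℕ) (L : List Quad) (E : List Edge) : Set where
  constructor closed
  field
    valid  : T (all (validᵇ n) L)
    sides  : sort (darts L ++ map swap (darts L)) ≡ sort (bothWays E ++ bothWays E)
    simple : T (simpleᵇ E)
    cycles : T (all (λ v → connectedᵇ (linksAt L v)) (upTo n))
    near   : T (all (nearᵇ E n) (upTo n))

closed-inv : ∀ {n L E} → Closed n L E → Inv n L E
closed-inv {n} {L} {E} C = record
  { valid = faces
  ; sides = λ f → begin
      faceTotal f L + faceTotal (flip f) L
        ≡⟨ cong₂ _+_ (faceTotal-darts f L) (faceTotal-darts (flip f) L) ⟩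
      dartTotal f (darts L) + dartTotal (flip f) (darts L)
        ≡⟨ cong (dartTotal f (darts L) +_) (dartTotal-swap f (darts L)) ⟨
      dartTotal f (darts L) + dartTotal f (map swap (darts L))
        ≡⟨ dartTotal-++ f (darts L) _ ⟨
      dartTotal f (darts L ++ map swap (darts L))
        ≡⟨ sorted-equal f {darts L ++ map swap (darts L)} {bothWays E ++ bothWays E} C.sides ⟩
      dartTotal f (bothWays E ++ bothWays E)
        ≡⟨ dartTotal-++ f (bothWays E) _ ⟩
      dartTotal f (bothWays E) + dartTotal f (bothWays E)
        ≡⟨ cong₂ _+_ (edgeTotal-bothWays f E) (edgeTotal-bothWays f E) ⟨
      edgeTotal f E + edgeTotal f E ∎
  ; simple = simple-sound E C.simple
  ; links = λ { v w x nw@(nbr {q} q∈ k refl _) nx →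
      cyclic (All.lookup (All.all⁺ _ (upTo n) C.cycles) (∈-upTo⁺ (valid-< q (All.lookup faces q∈) k))) nw nx }
  ; conn = λ v v<n → near-star E n v (All.lookup (All.all⁺ _ (upTo n) C.near) (∈-upTo⁺ v<n)) }
  where
  open ≡-Reasoning
  module C = Closed C
  faces : All (Valid n) L
  faces = All.map (λ {q} → valid-sound n q) (All.all⁺ _ L C.valid)

-- `sides` compares directed edges, so a single check serves oriented and nonorientable lists alike:
-- the boundary walks of `pre` remain, and each new edge is added once in each direction.
record Replacement (o m : ℕ) (pre post : List Quad) (new : List Edge) : Set where
  constructor replacement
  field
    valid-pre  : T (all (validᵇ o) pre)
    valid-post : T (all (validᵇ m) post)
    sides      : sort (darts post) ≡ sort (darts pre ++ bothWays new)
    local      : T (all (λ v → if v <ᵇ o then threadedᵇ (linksAt pre v) (linksAt post v)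
                                         else connectedᵇ (linksAt post v)) (upTo m))

surgery : ∀ {o m pre post new} → o ≤ m → Replacement o m pre post new → Surgery o pre post new
surgery {o} {m} {pre} {post} {new} o≤m C = record
  { sums = λ f → begin
      faceTotal f post                      ≡⟨ faceTotal-darts f post ⟩
      dartTotal f (darts post)              ≡⟨ sorted-equal f {darts post} {darts pre ++ bothWays new} C.sides ⟩
      dartTotal f (darts pre ++ bothWays new) ≡⟨ dartTotal-++ f (darts pre) _ ⟩
      dartTotal f (darts pre) + dartTotal f (bothWays new)
        ≡⟨ cong₂ _+_ (faceTotal-darts f pre) (edgeTotal-bothWays f new) ⟨
      faceTotal f pre + edgeTotal f new ∎
  ; through = λ { l@(link {q} q∈ k refl _ _) →
      let t = proj₁ (threads (valid-< q (All.lookup faces-pre q∈) k)) in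
      reach-sound post (∈ᵇ-sound _ (All.lookup (All.all⁺ _ (linksAt pre _) t) (linksAt-complete l))) }
  ; old = λ {v} v<o nw →
      let t = proj₂ (threads v<o)
          (w₀ , x₀) , p₀∈ , r = find (Any.any⁻ _ (linksAt pre v)
            (All.lookup (All.all⁺ _ (linksAt post v) t) (linksAt-complete (proj₂ (link-of nw)))))
      in w₀ , link-nbr (linksAt-sound pre p₀∈) , reach-sound post (∈ᵇ-sound _ r)
  ; fresh = λ { o≤v nw@(nbr {q} q∈ k refl _) nx →
      cyclic (rounds o≤v (valid-< q (All.lookup faces-post q∈) k)) nw nx } }
  where
  open ≡-Reasoning
  module C = Replacement C
  faces-pre : All (Valid o) pre
  faces-pre = All.map (λ {q} → valid-sound o q) (All.all⁺ _ pre C.valid-pre)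
  faces-post : All (Valid m) post
  faces-post = All.map (λ {q} → valid-sound m q) (All.all⁺ _ post C.valid-post)
  threads : ∀ {v} → v < o →
    T (all (λ p → proj₂ p ∈ᵇ reach (linksAt post v) (proj₁ p)) (linksAt pre v)) ×
    T (all (λ p → any (λ p₀ → proj₁ p₀ ∈ᵇ reach (linksAt post v) (proj₁ p)) (linksAt pre v)) (linksAt post v))
  threads {v} v<o with v <ᵇ o | <⇒<ᵇ v<o | All.lookup (All.all⁺ _ (upTo m) C.local) (∈-upTo⁺ (<-≤-trans v<o o≤m))
  ... | true | _ | t = ∧-sound t
  rounds : ∀ {v} → o ≤ v → v < m → T (connectedᵇ (linksAt post v))
  rounds {v} o≤v v<m with v <ᵇ o | <ᵇ⇒< v o | All.lookup (All.all⁺ _ (upTo m) C.local) (∈-upTo⁺ v<m)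
  ... | true | lt | _ = contradiction (lt tt) (≤⇒≯ o≤v)
  ... | false | _ | t = t

edge-bounds : ∀ {n L E} → 2 ≤ n → Inv n L E → ∀ {u v} → Adj E u v → u < n × v < n
edge-bounds {L = L} (s≤s (s≤s z≤n)) I adj =
  let open FromFaces I
      x , p , q = dart-of adj
  in subst (_< _) p (src<n x) , subst (_< _) (trans (src-s₀ x) q) (src<n (s₀ x))

face-adj : ∀ {n L E} → 2 ≤ n → Inv n L E → ∀ {q} → q ∈ L → ∀ k → Adj E (at q k) (nb q k)
face-adj (s≤s (s≤s z≤n)) I {q} q∈ k =
  subst (λ q → Adj _ (at q k) (nb q k)) (sym (Any.lookup-index q∈)) (FromFaces.adj-dart I (Any.index q∈ , k))

place : ℕ → List ℕ → ℕ → ℕ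
place n [] v = v + n
place n (x ∷ xs) zero = x
place n (x ∷ xs) (suc v) = place n xs v

place-old : ∀ {n xs v} → All (_< n) xs → v < length xs → place n xs v < n
place-old {v = zero} (p ∷ _) _ = p
place-old {v = suc v} (_ ∷ ps) (s≤s lt) = place-old ps lt

place-new : ∀ {n} xs {v} → length xs ≤ v → n ≤ place n xs v
place-new {n} [] {v} _ = m≤n+m n v
place-new (x ∷ xs) (s≤s le) = place-new xs le

place-injective-new : ∀ {n} xs {u v} → length xs ≤ u → length xs ≤ v → place n xs u ≡ place n xs v → u ≡ v
place-injective-new {n} [] {u} {v} _ _ eq = +-cancelʳ-≡ n u v eq
place-injective-new (x ∷ xs) (s≤s p) (s≤s q) eq = cong suc (place-injective-new xs p q eq)

place-avoids : ∀ {n x xs} → x < n → All (x ≢_) xs → ∀ v → x ≢ place n xs v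
place-avoids {n} {xs = []} x< _ v refl = <⇒≱ x< (m≤n+m n v)
place-avoids {xs = y ∷ ys} x< (p ∷ _) zero = p
place-avoids {xs = y ∷ ys} x< (_ ∷ ps) (suc v) = place-avoids x< ps v

place-injective : ∀ {n xs} → All (_< n) xs → AllPairs _≢_ xs → ∀ {u v} → place n xs u ≡ place n xs v → u ≡ v
place-injective {n} {[]} _ _ {u} {v} eq = +-cancelʳ-≡ n u v eq
place-injective _ _ {zero} {zero} eq = refl
place-injective {xs = x ∷ xs} (x< ∷ _) (x∉ ∷ _) {zero} {suc v} eq = contradiction eq (place-avoids x< x∉ v)
place-injective {xs = x ∷ xs} (x< ∷ _) (x∉ ∷ _) {suc u} {zero} eq = contradiction (sym eq) (place-avoids x< x∉ u)
place-injective {xs = x ∷ xs} (_ ∷ xs<) (_ ∷ un) {suc u} {suc v} eq = cong suc (place-injective xs< un eq)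

-- Tubes and patches

Triple : Set
Triple = ℕ × ℕ × ℕ

marked : Triple × ℕ → Quad
marked ((p , x , p′) , y) = quad p x p′ y

Kind : Bool → (L R : List Quad) → List Edge → Set
Kind true  L R E = Oriented L E
Kind false L R E = NonOrientable R

-- A quadrangulation with edges E in which every triple (p , x , p′) of ts
-- has a face p x p′ y of its own reserved for it. Tubes are attached to
-- reserved faces only, so the other faces, where nonorientability is
-- witnessed, are never removed.
record Cfg (or : Bool) (n : ℕ) (ts : List Triple) (E : List Edge) : Set where
  constructor cfg
  field
    marks : List (Triple × ℕ)
    marks-ts : map proj₁ marks ≡ ts
    rest  : List Quad
    inv   : Inv n (map marked marks ++ rest) E
    kind  : Kind or (map marked marks ++ rest) rest E

kind-↭ : ∀ {or L L′ R E} → L ↭ L′ → Kind or L R E → Kind or L′ R E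
kind-↭ {true} {E = E} p o = oriented-↭ {E = E} p o
kind-↭ {false} _ k = k

cfg-↭ : ∀ {or n ts ts′ E} → ts ↭ ts′ → Cfg or n ts E → Cfg or n ts′ E
cfg-↭ {or} p (cfg marks refl rest inv kind) with ↭-map-inv proj₁ p
... | marks′ , refl , q = cfg marks′ refl rest (inv-↭ q′ inv) (kind-↭ {or} {R = rest} q′ kind)
  where q′ = ++⁺ʳ rest (map⁺ marked q)

tubeEdges : Triple × Triple → List Edge
tubeEdges ((p , _ , p′) , (r , _ , r′)) = (p , r) ∷ (p , r′) ∷ (p′ , r) ∷ (p′ , r′) ∷ []

Free : List Edge → Triple × Triple → Set
Free E task = All (λ { (u , v) → u ≢ v × ¬ Adj E u v }) (tubeEdges task)

-- The two pairs are 0, 2 and 4, 6. The first two faces of the result keep the paths 0 1 2 and 4 5 6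
-- and exchange only the fourth corner, so the reserved triples are unchanged and can carry further
-- tubes. Four more edges and two more faces lower the Euler characteristic by two.
tube-surgery : Surgery 8 (quad 0 1 2 3 ∷ quad 4 5 6 7 ∷ [])
  (quad 0 1 2 4 ∷ quad 4 5 6 0 ∷ quad 6 7 4 2 ∷ quad 2 3 0 6 ∷ [])
  ((0 , 4) ∷ (0 , 6) ∷ (2 , 4) ∷ (2 , 6) ∷ [])
tube-surgery = surgery {m = 8} ≤-refl (replacement _ _ refl _)

cfg-tube : ∀ {or n s t ts E} → 2 ≤ n → Cfg or n (s ∷ t ∷ ts) E → Free E (s , t) →
           Cfg or n (s ∷ t ∷ ts) (tubeEdges (s , t) ++ E)
cfg-tube {or} {n} {E = E} 2≤n
  (cfg (((a₁ , b₁ , a₂) , b₂) ∷ ((a₃ , b₃ , a₄) , b₄) ∷ marks) refl rest inv kind)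
  ((n₁₃ , f₁₃) ∷ (n₁₄ , f₁₄) ∷ (n₂₃ , f₂₃) ∷ (n₂₄ , f₂₄) ∷ [])
  with Inv.valid inv
... | ((l₁ , m₁ , l₂ , m₂) , a₁b₁ , a₁a₂ , a₁b₂ , b₁a₂ , b₁b₂ , a₂b₂)
    ∷ ((l₃ , m₃ , l₄ , m₄) , a₃b₃ , a₃a₄ , a₃b₄ , b₃a₄ , b₃b₄ , a₄b₄) ∷ _ =
  cfg (((a₁ , b₁ , a₂) , a₃) ∷ ((a₃ , b₃ , a₄) , a₁) ∷ marks) refl (B ∷ C ∷ rest)
      (inv-↭ regroup inv₁) (kind₁ {or} kind)
  where
  olds : List ℕ
  olds = a₁ ∷ b₁ ∷ a₂ ∷ b₂ ∷ a₃ ∷ b₃ ∷ a₄ ∷ b₄ ∷ []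
  ι : ℕ → ℕ
  ι = place n olds
  A B C D : Quad
  A = quad a₁ b₁ a₂ a₃
  D = quad a₃ b₃ a₄ a₁
  B = quad a₄ b₄ a₃ a₂
  C = quad a₂ b₂ a₁ a₄
  R : List Quad
  R = map marked marks ++ rest
  regroup : A ∷ D ∷ B ∷ C ∷ R ↭ A ∷ D ∷ map marked marks ++ B ∷ C ∷ rest
  regroup = prep A (prep D (shifts (B ∷ C ∷ []) (map marked marks)))
  adj : ∀ {q} → q ∈ quad a₁ b₁ a₂ b₂ ∷ quad a₃ b₃ a₄ b₄ ∷ R → ∀ k → Adj E (at q k) (nb q k)
  adj = face-adj 2≤n inv
  -- Shows that the corners b₁, ..., b₄ differ from the vertices across the tube: each is adjacent
  -- to a corner of its own face to which the vertex across is not adjacent.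
  away : ∀ {x y z} → Adj E x y → ¬ Adj E x z → y ≢ z
  away a na refl = na a
  adj-sym : ∀ {E x y} → Adj E x y → Adj E y x
  adj-sym = Any.map λ { (inj₁ (refl , refl)) → inj₂ (refl , refl) ; (inj₂ (refl , refl)) → inj₁ (refl , refl) }
  inv₁ : Inv n (A ∷ D ∷ B ∷ C ∷ R) ((a₁ , a₃) ∷ (a₁ , a₄) ∷ (a₂ , a₃) ∷ (a₂ , a₄) ∷ E)
  inv₁ = surgery-inv tube-surgery ι inv
    (place-old (l₁ ∷ m₁ ∷ l₂ ∷ m₂ ∷ l₃ ∷ m₃ ∷ l₄ ∷ m₄ ∷ [])) (place-new olds) (place-injective-new olds) ≤-refl
    ( ((l₁ , m₁ , l₂ , l₃) , a₁b₁ , a₁a₂ , n₁₃ , b₁a₂ , away (adj (here refl) 0F) f₁₃ , n₂₃)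
    ∷ ((l₃ , m₃ , l₄ , l₁) , a₃b₃ , a₃a₄ , n₁₃ ∘ sym , b₃a₄ , away (adj (there (here refl)) 0F) (f₁₃ ∘ adj-sym) , n₁₄ ∘ sym)
    ∷ ((l₄ , m₄ , l₃ , l₂) , a₄b₄ , a₃a₄ ∘ sym , n₂₄ ∘ sym , a₃b₄ ∘ sym , away (adj (there (here refl)) 4F) (f₂₄ ∘ adj-sym) , n₂₃ ∘ sym)
    ∷ ((l₂ , m₂ , l₁ , l₄) , a₂b₂ , a₁a₂ ∘ sym , n₂₄ , a₁b₂ ∘ sym , away (adj (here refl) 4F) f₂₄ , n₁₄) ∷ [])
    (  ([ a₃a₄ ∘ proj₂ , n₁₄ ∘ proj₁ ]′ ∷ [ a₁a₂ ∘ proj₁ , n₁₃ ∘ proj₁ ]′ ∷ [ a₁a₂ ∘ proj₁ , n₁₄ ∘ proj₁ ]′ ∷ unused f₁₃)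
     ∷ ([ a₁a₂ ∘ proj₁ , n₁₃ ∘ proj₁ ]′ ∷ [ a₁a₂ ∘ proj₁ , n₁₄ ∘ proj₁ ]′ ∷ unused f₁₄)
     ∷ ([ a₃a₄ ∘ proj₂ , n₂₄ ∘ proj₁ ]′ ∷ unused f₂₃)
     ∷ unused f₂₄ ∷ Inv.simple inv)
    (λ v n≤v v<n → contradiction v<n (≤⇒≯ n≤v))
    where
    unused : ∀ {u v} → ¬ Adj E u v → All (λ e → ¬ Same (u , v) e) E
    unused na = All.¬Any⇒All¬ E na
  kind₁ : ∀ {or} → Kind or (quad a₁ b₁ a₂ b₂ ∷ quad a₃ b₃ a₄ b₄ ∷ R) rest E →
          Kind or (A ∷ D ∷ map marked marks ++ B ∷ C ∷ rest) (B ∷ C ∷ rest) ((a₁ , a₃) ∷ (a₁ , a₄) ∷ (a₂ , a₃) ∷ (a₂ , a₄) ∷ E)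
  kind₁ {true} o = oriented-↭ {E = (a₁ , a₃) ∷ (a₁ , a₄) ∷ (a₂ , a₃) ∷ (a₂ , a₄) ∷ E} regroup
    (surgery-oriented tube-surgery ι {R} {E} o)
  kind₁ {false} non = nonorientable-⊆ {rest} (λ q → there (there q)) non

Disjoint : Triple × Triple → Triple × Triple → Set
Disjoint s t = All (λ e → All (λ e′ → ¬ Same e′ e) (tubeEdges s)) (tubeEdges t)

free-++ : ∀ {D E} t → All (λ e → All (λ e′ → ¬ Same e′ e) D) (tubeEdges t) → Free E t → Free (D ++ E) t
free-++ {D} t dis free = All.zipWith
  (λ { {u , v} (d , (u≢v , na)) → u≢v , λ a → [ none d , na ]′ (Any.++⁻ D a) }) (dis , free)
  where
  none : ∀ {e} → All (λ e′ → ¬ Same e′ e) D → ¬ Any (Same e) D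
  none d a = let e′ , e′∈ , s = find a in All.lookup d e′∈ (same-sym s)

-- A tube acts on the first two reserved triples, so a task carries the permutation that brings its
-- triples to the front.
Among : List Triple → Triple × Triple → Set
Among ts (s , t) = ∃ λ ts′ → ts ↭ s ∷ t ∷ ts′

-- A tube leaves the list of reserved triples as it was, so one pair can take part in many tasks;
-- `Disjoint` keeps the later tasks free.
tubes : ∀ {or n ts E} → 2 ≤ n → Cfg or n ts E → ∀ tasks → All (Free E) tasks →
        AllPairs Disjoint tasks → All (Among ts) tasks →
        ∃ λ E′ → length E′ ≡ 4 * length tasks + length E × Cfg or n ts E′
tubes {E = E} 2≤n C [] _ _ _ = E , refl , C
tubes {E = E} 2≤n C (t ∷ tasks) (f ∷ fs) (d ∷ ds) ((_ , p) ∷ as) =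
  let C₁ = cfg-↭ (↭-sym p) (cfg-tube 2≤n (cfg-↭ p C) f)
      E′ , eq , C′ = tubes 2≤n C₁ tasks (All.zipWith (λ { {t′} (dis , free) → free-++ t′ dis free }) (d , fs)) ds as
  in E′ , trans eq (count (length tasks) (length E)) , C′
  where
  count : ∀ k m → 4 * k + (4 + m) ≡ 4 * suc k + m
  count = solve-∀

mapT : (ℕ → ℕ) → Triple → Triple
mapT ι (p , x , p′) = ι p , ι x , ι p′

place-bound : ∀ {n w} xs {v} → All (_< n) xs → v < length xs + w → place n xs v < w + n
place-bound {n} {w} [] {v} _ lt = +-monoˡ-< n lt
place-bound {w = w} (x ∷ xs) {zero} (p ∷ _) _ = <-≤-trans p (m≤n+m _ w)
place-bound (x ∷ xs) {suc v} (_ ∷ ps) (s≤s lt) = place-bound xs ps lt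

valid-map : ∀ {m n} {ι : ℕ → ℕ} → (∀ {v} → v < m → ι v < n) → (∀ {u v} → ι u ≡ ι v → u ≡ v) →
            ∀ q → Valid m q → Valid n (mapQ ι q)
valid-map bd inj (quad a b c d) ((p , q , r , s) , ab , ac , ad , bc , bd′ , cd) =
  (bd p , bd q , bd r , bd s) , ab ∘ inj , ac ∘ inj , ad ∘ inj , bc ∘ inj , bd′ ∘ inj , cd ∘ inj

simple-map : ∀ {ι : ℕ → ℕ} → (∀ {u v} → ι u ≡ ι v → u ≡ v) → ∀ {E} → Simple E → Simple (map (mapE ι) E)
simple-map inj simple = AllPairs.map⁺ (AllPairs.map
  (λ { na (inj₁ (p , q)) → na (inj₁ (inj p , inj q)) ; na (inj₂ (p , q)) → na (inj₂ (inj p , inj q)) }) simple)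

-- The Euler genus that a patch adds. Its 8 vertices bring 28 edges among themselves and 16 to the
-- pair, for odd n also 8 to the unpaired vertex. As faces are half as many as edges, the Euler
-- characteristic falls by 44/2 - 8 = 14, respectively 52/2 - 8 = 18.
genusStep : Bool → ℕ
genusStep odd = if odd then 18 else 14

-- Replaces a reserved face 0 1 2 3 by a surface with eight more vertices
-- 4, …, 11 that are joined to each other, to 0 and 2, and, if n is odd, to 1.
record Patch (odd : Bool) : Set where
  field
    m₄ y₄ m₆ y₆ m₈ y₈ m₁₀ y₁₀ m₀ y₀ : ℕ
    rest : List Quad
    new  : List Edge
  marks : List (Triple × ℕ)
  marks = ((4 , m₄ , 5) , y₄) ∷ ((6 , m₆ , 7) , y₆) ∷ ((8 , m₈ , 9) , y₈) ∷ ((10 , m₁₀ , 11) , y₁₀)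
        ∷ ((0 , m₀ , 2) , y₀) ∷ []
  post : List Quad
  post = map marked marks ++ rest
  isNew : ℕ → Bool
  isNew v = 4 ≤ᵇ v
  touched : ℕ → Bool
  touched v = isNew v ∨ (v ≡ᵇ 0) ∨ (v ≡ᵇ 2) ∨ (odd ∧ (v ≡ᵇ 1))
  field
    replaces   : Replacement 4 12 (quad 0 1 2 3 ∷ []) post new
    new-simple : T (simpleᵇ new)
    hub        : T (all (λ k → adjᵇ new 0 (4 + k)) (upTo 8))
    attached   : T (all (λ e → touched (proj₁ e) ∧ touched (proj₂ e) ∧ (isNew (proj₁ e) ∨ isNew (proj₂ e))) new)
    -- The reserved face of the first new pair passes through the unpaired vertex, so that the next
    -- patch can be glued into this face with the same unpaired vertex.
    hinge      : T odd → m₄ ≡ 1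
    size       : length new ≡ 16 + 2 * genusStep odd

module Glue {odd : Bool} (P : Patch odd) {or n a z a′ s ms R E} (2≤n : 2 ≤ n)
  (I : Inv n (map marked (((a , z , a′) , s) ∷ ms) ++ R) E)
  (K : Kind or (map marked (((a , z , a′) , s) ∷ ms) ++ R) R E) where
  open Patch P

  olds : List ℕ
  olds = a ∷ z ∷ a′ ∷ s ∷ []

  ι : ℕ → ℕ
  ι = place n olds

  E₁ : List Edge
  E₁ = map (mapE ι) new ++ E

  connector : Valid n (quad a z a′ s)
  connector = All.head (Inv.valid I)

  olds< : All (_< n) olds
  olds< = let (p , q , r , t) , _ = connector in p ∷ q ∷ r ∷ t ∷ []

  olds-distinct : AllPairs _≢_ olds
  olds-distinct = let _ , az , aa′ , as , za′ , zs , a′s = connector in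
    (az ∷ aa′ ∷ as ∷ []) ∷ (za′ ∷ zs ∷ []) ∷ (a′s ∷ []) ∷ [] ∷ []

  ι-inj : ∀ {u v} → ι u ≡ ι v → u ≡ v
  ι-inj = place-injective olds< olds-distinct

  attach-sound : ∀ {u v} → (u , v) ∈ new → T (touched u) × T (touched v) × (4 ≤ u ⊎ 4 ≤ v)
  attach-sound {u} {v} m =
    let p , q = ∧-sound {touched u} (All.lookup (All.all⁺ _ new attached) m)
        r , t = ∧-sound {touched v} q
    in p , r , Sum.map (≤ᵇ⇒≤ 4 u) (≤ᵇ⇒≤ 4 v) (∨-sound t)

  crossing : ∀ {e d} → e ∈ map (mapE ι) new → d ∈ E → ¬ Same e d
  crossing {e} {d} e∈ d∈ same with ∈-map⁻ (mapE ι) e∈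
  ... | (u , v) , uv∈ , refl with edge-bounds 2≤n I (lose d∈ same) | proj₂ (proj₂ (attach-sound uv∈))
  ...   | u< , _ | inj₁ 4≤u = contradiction u< (≤⇒≯ (place-new olds 4≤u))
  ...   | _ , v< | inj₂ 4≤v = contradiction v< (≤⇒≯ (place-new olds 4≤v))

  simple₁ : Simple E₁
  simple₁ = AllPairs.++⁺ (simple-map ι-inj (simple-sound new new-simple)) (Inv.simple I)
    (All.tabulate λ e∈ → All.tabulate λ d∈ → crossing e∈ d∈)

  valid₁ : All (Valid (8 + n)) (map (mapQ ι) post)
  valid₁ = All.map⁺ (All.map (λ {q} t → valid-map (place-bound {w = 8} olds olds<) ι-inj q (valid-sound 12 q t))
    (All.all⁺ _ post (Replacement.valid-post replaces)))

  conn₁ : ∀ v → n ≤ v → v < 8 + n → Star (Adj E₁) 0 v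
  conn₁ v n≤v v<8+n =
    gmap id (Any.++⁺ʳ (map (mapE ι) new)) (Inv.conn I a (All.head olds<)) ◅◅ return (Any.++⁺ˡ to-v)
    where
    k : ℕ
    k = v ∸ n
    k<8 : k < 8
    k<8 = +-cancelʳ-< n k 8 (subst (_< 8 + n) (sym (m∸n+n≡m n≤v)) v<8+n)
    label : Adj new 0 (4 + k)
    label = adj-sound new 0 (4 + k) (All.lookup (All.all⁺ (λ k → adjᵇ new 0 (4 + k)) (upTo 8) hub) (∈-upTo⁺ k<8))
    to-v : Adj (map (mapE ι) new) a v
    to-v = subst (Adj _ a) (m∸n+n≡m n≤v) (Any.map⁺ (Any.map
      (λ { (inj₁ (refl , refl)) → inj₁ (refl , refl) ; (inj₂ (refl , refl)) → inj₂ (refl , refl) }) label))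

  patched : Surgery 4 (quad 0 1 2 3 ∷ []) post new
  patched = surgery {m = 12} (s≤s (s≤s (s≤s (s≤s z≤n)))) replaces

  inv₁ : Inv (8 + n) (map (mapQ ι) post ++ map marked ms ++ R) E₁
  inv₁ = surgery-inv patched ι I (place-old olds<) (place-new olds) (λ _ _ → ι-inj) (m≤n+m n 8) valid₁ simple₁ conn₁

  marks₁ : List (Triple × ℕ)
  marks₁ = map (λ { (t , y) → mapT ι t , ι y }) marks ++ ms

  rest₁ : List Quad
  rest₁ = map (mapQ ι) rest ++ R

  regroup : map (mapQ ι) post ++ map marked ms ++ R ↭ map marked marks₁ ++ rest₁
  regroup = prep _ (prep _ (prep _ (prep _ (prep _ (shifts (map (mapQ ι) rest) (map marked ms))))))

  kind₁ : Kind or (map marked marks₁ ++ rest₁) rest₁ E₁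
  kind₁ = by-kind or K
    where
    by-kind : ∀ or → Kind or (map marked (((a , z , a′) , s) ∷ ms) ++ R) R E →
              Kind or (map marked marks₁ ++ rest₁) rest₁ E₁
    by-kind true o = oriented-↭ {E = E₁} regroup (surgery-oriented patched ι {map marked ms ++ R} {E} o)
    by-kind false non = nonorientable-⊆ {R} (∈-++⁺ʳ (map (mapQ ι) rest)) non

  glued : Cfg or (8 + n) (map proj₁ marks₁) E₁
  glued = cfg marks₁ refl rest₁ (inv-↭ regroup inv₁) kind₁

  -- Patch edges end only at new vertices, at `a`, `a′` and, for odd n, at `z`. Hence the other old
  -- pairs are still free for tubes to the new pairs.
  untouched : ∀ {w p} → n ≤ w → p < n → p ≢ a → p ≢ a′ → (T odd → p ≢ z) → ¬ Adj E₁ w p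
  untouched {w} {p} n≤w p<n p≢a p≢a′ p≢z adj with Any.++⁻ (map (mapE ι) new) adj
  ... | inj₂ in-E = contradiction (proj₁ (edge-bounds 2≤n I in-E)) (≤⇒≯ n≤w)
  ... | inj₁ in-new with find in-new
  ...   | e , e∈ , same with ∈-map⁻ (mapE ι) e∈
  ...     | (u , v) , uv∈ , refl = meets same
    where
    missed : ∀ v → T (touched v) → p ≢ ι v
    missed 0 _ = p≢a
    missed 1 t = p≢z (∧-left odd t)
      where
      ∧-left : ∀ b → T (b ∧ true) → T b
      ∧-left true _ = tt
    missed 2 _ = p≢a′
    missed 3 t = contradiction t (∧-false odd)
      where
      ∧-false : ∀ b → ¬ T (b ∧ false)
      ∧-false true ()
    missed (suc (suc (suc (suc v)))) _ refl = <⇒≱ p<n (m≤n+m n v)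
    meets : ¬ Same (w , p) (ι u , ι v)
    meets (inj₁ (_ , eq)) = missed v (proj₁ (proj₂ (attach-sound uv∈))) eq
    meets (inj₂ (_ , eq)) = missed u (proj₁ (attach-sound uv∈)) eq

-- The step from n to n + 8 vertices

Apart : Triple → Triple → Set
Apart (p , _ , p′) (r , _ , r′) = p ≢ r × p ≢ r′ × p′ ≢ r × p′ ≢ r′

Clear : Bool → (a z a′ : ℕ) → Triple → Set
Clear odd a z a′ (p , _ , p′) = avoids p × avoids p′
  where
  avoids : ℕ → Set
  avoids u = u ≢ a × u ≢ a′ × (T odd → u ≢ z)

-- The inductive state: d pairs of vertices besides the pair a, a′ have
-- reserved faces, and patches are glued into the face reserved for (a, z, a′).
-- For odd n the vertex z belongs to no pair.
record Tight (or odd : Bool) (n d g : ℕ) : Set where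
  constructor tight
  field
    a z a′ : ℕ
    ts     : List Triple
    edges  : List Edge
    config : Cfg or n ((a , z , a′) ∷ ts) edges
    len    : length ts ≡ d
    apart  : AllPairs Apart ts
    clear  : All (Clear odd a z a′) ts
    euler  : length edges + 4 ≡ 2 * n + 2 * g

High Low : ℕ → Triple → Set
High n (p , _ , p′) = n ≤ p × n ≤ p′
Low  n (p , _ , p′) = p < n × p′ < n

-- One end of each edge is new and the other old, so coinciding edges would agree end by end. It is
-- therefore enough that the two tasks have disjoint new pairs or disjoint old pairs.
disjoint : ∀ {n s t s′ t′} → High n s → Low n t′ → Apart s s′ ⊎ Apart t t′ → Disjoint (s , t) (s′ , t′)
disjoint {n} (h , h′) (l , l′) (inj₁ (p , q , r , o)) =
  (by h l p ∷ by h l p ∷ by h′ l r ∷ by h′ l r ∷ []) ∷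
  (by h l′ p ∷ by h l′ p ∷ by h′ l′ r ∷ by h′ l′ r ∷ []) ∷
  (by h l q ∷ by h l q ∷ by h′ l o ∷ by h′ l o ∷ []) ∷
  (by h l′ q ∷ by h l′ q ∷ by h′ l′ o ∷ by h′ l′ o ∷ []) ∷ []
  where
  by : ∀ {w p w′ p′} → n ≤ w → p′ < n → w ≢ w′ → ¬ Same (w , p) (w′ , p′)
  by _ _ w≢ (inj₁ (eq , _)) = w≢ eq
  by n≤w p′<n _ (inj₂ (refl , _)) = <⇒≱ p′<n n≤w
disjoint {n} (h , h′) (l , l′) (inj₂ (p , q , r , o)) =
  (by h l p ∷ by h l r ∷ by h′ l p ∷ by h′ l r ∷ []) ∷
  (by h l′ q ∷ by h l′ o ∷ by h′ l′ q ∷ by h′ l′ o ∷ []) ∷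
  (by h l p ∷ by h l r ∷ by h′ l p ∷ by h′ l r ∷ []) ∷
  (by h l′ q ∷ by h l′ o ∷ by h′ l′ q ∷ by h′ l′ o ∷ []) ∷ []
  where
  by : ∀ {w p w′ p′} → n ≤ w → p′ < n → p ≢ p′ → ¬ Same (w , p) (w′ , p′)
  by _ _ p≢ (inj₁ (_ , eq)) = p≢ eq
  by n≤w p′<n _ (inj₂ (refl , _)) = <⇒≱ p′<n n≤w

product-disjoint : ∀ {n ss ts} → All (High n) ss → All (Low n) ts →
  AllPairs Apart ss → AllPairs Apart ts → AllPairs Disjoint (cartesianProduct ss ts)
product-disjoint [] _ _ _ = []
product-disjoint {n} {s ∷ ss} {ts} (h ∷ hs) ls (as ∷ ass) ats = AllPairs.++⁺
  (AllPairs.map⁺ (row ls ats))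
  (product-disjoint hs ls ass ats)
  (All.map⁺ (All.tabulate λ {t} t∈ → All.tabulate λ { {s′ , t′} m →
    let s′∈ , t′∈ = ∈-cartesianProduct⁻ ss ts m in
    disjoint {s = s} {t} {s′} {t′} h (All.lookup ls t′∈) (inj₁ (All.lookup as s′∈)) }))
  where
  row : ∀ {ts} → All (Low n) ts → AllPairs Apart ts → AllPairs (λ t t′ → Disjoint (s , t) (s , t′)) ts
  row [] [] = []
  row {t ∷ _} (l ∷ ls) (a ∷ as) = All.zipWith (λ { {t′} (l′ , a′) → disjoint {s = s} {t} {s} {t′} h l′ (inj₂ a′) }) (ls , a) ∷ row ls as

∈-↭ : ∀ {A : Set} {x : A} {xs} → x ∈ xs → ∃ λ xs′ → xs ↭ x ∷ xs′
∈-↭ {x = x} x∈ with ∈-∃++ x∈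
... | ys , zs , refl = ys ++ zs , shift x ys zs
  where open import Data.List.Relation.Binary.Permutation.Propositional.Properties using (shift)

among : ∀ {s t ss ts} → s ∈ ss → t ∈ ts → Among (ss ++ ts) (s , t)
among {ss = ss} {ts} s∈ t∈ with ∈-↭ s∈
... | ss′ , p with ∈-↭ (∈-++⁺ʳ ss′ t∈)
...   | us , q = us , ↭-trans (++⁺ʳ ts p) (prep _ q)

low-marks : ∀ {or n ts E} → Cfg or n ts E → All (Low n) ts
low-marks (cfg ms refl rest inv _) = All.map⁺ (All.map
  (λ { {(p , x , p′) , y} ((l , _ , l′ , _) , _) → l , l′ })
  (All.map⁻ (All.++⁻ˡ (map marked ms) (Inv.valid inv))))

length-product : ∀ {A B : Set} (xs : List A) (ys : List B) →
                 length (cartesianProduct xs ys) ≡ length xs * length ys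
length-product [] ys = refl
length-product (x ∷ xs) ys = trans (length-++ (map (x ,_) ys))
  (cong₂ _+_ (length-map (x ,_) ys) (length-product xs ys))

cfg-head : ∀ {or n t ts E} → Cfg or n (t ∷ ts) E →
  ∃ λ s → ∃ λ ms → ∃ λ R → Inv n (map marked ((t , s) ∷ ms) ++ R) E ×
    Kind or (map marked ((t , s) ∷ ms) ++ R) R E × map proj₁ ms ≡ ts
cfg-head (cfg ((_ , s) ∷ ms) refl R I K) = s , ms , R , I , K , refl

module Stage {or odd n d g} (P : Patch odd) (2≤n : 2 ≤ n) (S : Tight or odd n d g) where
  open Tight S
  open Patch P using (m₄; m₆; m₈; m₁₀; m₀; hinge; size) renaming (new to patch-edges)

  private
    Δ : ℕ
    Δ = genusStep odd

  module _ {s ms R} (I : Inv n (map marked (((a , z , a′) , s) ∷ ms) ++ R) edges)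
           (K : Kind or (map marked (((a , z , a′) , s) ∷ ms) ++ R) R edges) (ms-ts : map proj₁ ms ≡ ts) where
    open Glue P {or} {n} {a} {z} {a′} {s} {ms} {R} {edges} 2≤n I K

    news : List Triple
    news = (n , ι m₄ , 1 + n) ∷ (2 + n , ι m₆ , 3 + n) ∷ (4 + n , ι m₈ , 5 + n) ∷ (6 + n , ι m₁₀ , 7 + n) ∷ []

    ts₁ : List Triple
    ts₁ = news ++ (a , ι m₀ , a′) ∷ ts

    config₁ : Cfg or (8 + n) ts₁ E₁
    config₁ = subst (λ ts → Cfg or (8 + n) (news ++ (a , ι m₀ , a′) ∷ ts) E₁) ms-ts glued

    high : All (High n) news
    high = (≤-refl , m≤n+m n 1) ∷ (m≤n+m n 2 , m≤n+m n 3) ∷ (m≤n+m n 4 , m≤n+m n 5) ∷ (m≤n+m n 6 , m≤n+m n 7) ∷ []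

    low : All (Low n) ts
    low = All.tail (low-marks config)

    shifted : ∀ i j {_ : T (not (i ≡ᵇ j))} → i + n ≢ j + n
    shifted i j {i≢j} eq = ≢-sound i≢j (+-cancelʳ-≡ n i j eq)

    news-apart : AllPairs Apart news
    news-apart =
      ((shifted 0 2 , shifted 0 3 , shifted 1 2 , shifted 1 3) ∷ (shifted 0 4 , shifted 0 5 , shifted 1 4 , shifted 1 5)
        ∷ (shifted 0 6 , shifted 0 7 , shifted 1 6 , shifted 1 7) ∷ []) ∷
      ((shifted 2 4 , shifted 2 5 , shifted 3 4 , shifted 3 5) ∷ (shifted 2 6 , shifted 2 7 , shifted 3 6 , shifted 3 7) ∷ []) ∷
      ((shifted 4 6 , shifted 4 7 , shifted 5 6 , shifted 5 7) ∷ []) ∷ [] ∷ []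

    -- The pair `a`, `a′` does not occur here: the patch has already joined it to all new vertices.
    tasks : List (Triple × Triple)
    tasks = cartesianProduct news ts

    tasks-length : length tasks ≡ 4 * d
    tasks-length = trans (length-product news ts) (cong (4 *_) len)

    tasks-disjoint : AllPairs Disjoint tasks
    tasks-disjoint = product-disjoint high low news-apart apart

    tasks-among : All (Among ts₁) tasks
    tasks-among = All.tabulate λ {st} m →
      let s∈ , t∈ = ∈-cartesianProduct⁻ news ts m in among s∈ (there t∈)

    tasks-free : All (Free E₁) tasks
    tasks-free = All.tabulate λ { {s , t} m → free (∈-cartesianProduct⁻ news ts m) }
      where
      free : ∀ {s t} → s ∈ news × t ∈ ts → Free E₁ (s , t)
      free {s} {t} (s∈ , t∈) =
        let w , w′ = All.lookup high s∈
            p , p′ = All.lookup low t∈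
            (pa , pa′ , pz) , (qa , qa′ , qz) = All.lookup clear t∈
            split : ∀ {w p} → n ≤ w → p < n → w ≢ p
            split = λ { n≤w p<n refl → <⇒≱ p<n n≤w }
        in (split w p , untouched w p pa pa′ pz) ∷ (split w p′ , untouched w p′ qa qa′ qz)
         ∷ (split w′ p , untouched w′ p pa pa′ pz) ∷ (split w′ p′ , untouched w′ p′ qa qa′ qz) ∷ []

    after : ∀ j → j ≤ 4 * d → ∃ λ E′ → length E′ + 4 ≡ 2 * (8 + n) + 2 * (g + Δ + 2 * j) × Cfg or (8 + n) ts₁ E′
    after j j≤ = proj₁ done , trans (cong (_+ 4) total) count , proj₂ (proj₂ done)
      where
      done : ∃ λ E′ → length E′ ≡ 4 * length (take j tasks) + length E₁ × Cfg or (8 + n) ts₁ E′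
      done = tubes (≤-trans 2≤n (m≤n+m n 8)) config₁ (take j tasks)
               (All.take⁺ j tasks-free) (AllPairs.take⁺ j tasks-disjoint) (All.take⁺ j tasks-among)
      total : length (proj₁ done) ≡ 4 * j + ((16 + 2 * Δ) + length edges)
      total = trans (proj₁ (proj₂ done)) (cong₂ (λ x y → 4 * x + y)
        (trans (length-take j tasks) (m≤n⇒m⊓n≡m (subst (j ≤_) (sym tasks-length) j≤)))
        (trans (length-++ (map (mapE ι) patch-edges)) (cong (_+ length edges) (trans (length-map (mapE ι) patch-edges) size))))
      count : 4 * j + ((16 + 2 * Δ) + length edges) + 4 ≡ 2 * (8 + n) + 2 * (g + Δ + 2 * j)
      count = trans (left j Δ (length edges)) (trans (cong (4 * j + (16 + 2 * Δ) +_) euler) (right j Δ n g))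
        where
        left : ∀ j Δ l → 4 * j + ((16 + 2 * Δ) + l) + 4 ≡ 4 * j + (16 + 2 * Δ) + (l + 4)
        left = solve-∀
        right : ∀ j Δ n g → 4 * j + (16 + 2 * Δ) + (2 * n + 2 * g) ≡ 2 * (8 + n) + 2 * (g + Δ + 2 * j)
        right = solve-∀

    -- The first new pair takes over the role of `a`, `a′`, which in turn joins the old pairs
    -- together with the other three new ones; so `d` grows by four. For odd n, `hinge` makes `ι m₄`
    -- equal to `z`, and the unpaired vertex stays the same throughout.
    next : Tight or odd (8 + n) (4 + d) (g + Δ + 2 * (4 * d))
    next = let E′ , eu , C = after (4 * d) ≤-refl in
      tight n (ι m₄) (1 + n) (drop 1 ts₁) E′ C (cong (3 +_) len′) apart′ clear′ eu
      where
      a<n : a < n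
      a<n = proj₁ (proj₁ connector)
      a′<n : a′ < n
      a′<n = proj₁ (proj₂ (proj₂ (proj₁ connector)))
      z<n : z < n
      z<n = proj₁ (proj₂ (proj₁ connector))
      a≢z : a ≢ z
      a≢z = proj₁ (proj₂ connector)
      a′≢z : a′ ≢ z
      a′≢z = proj₁ (proj₂ (proj₂ (proj₂ (proj₂ connector)))) ∘ sym
      above : ∀ {s t} → High n s → Low n t → Apart s t
      above (h , h′) (l , l′) = sep h l , sep h l′ , sep h′ l , sep h′ l′
        where
        sep : ∀ {w p} → n ≤ w → p < n → w ≢ p
        sep n≤w p<n refl = <⇒≱ p<n n≤w
      hinge′ : T odd → ι m₄ ≡ z
      hinge′ o = cong ι (hinge o)
      off : ∀ i → T odd → i + n ≢ ι m₄
      off i o eq = <⇒≱ z<n (subst (n ≤_) (trans eq (hinge′ o)) (m≤n+m n i))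
      below : ∀ {u} → u < n → (T odd → u ≢ z) → u ≢ n × u ≢ 1 + n × (T odd → u ≢ ι m₄)
      below u<n u≢z = (λ { refl → <-irrefl refl u<n }) , (λ { refl → <⇒≱ u<n (n≤1+n n) })
                    , λ o eq → u≢z o (trans eq (hinge′ o))
      len′ : suc (length ts) ≡ suc d
      len′ = cong suc len
      apart′ : AllPairs Apart (drop 1 ts₁)
      apart′ = AllPairs.++⁺ (AllPairs.tail news-apart)
        (All.map (λ { ((pa , pa′ , _) , (qa , qa′ , _)) → pa ∘ sym , qa ∘ sym , pa′ ∘ sym , qa′ ∘ sym }) clear ∷ apart)
        (All.map (λ {s} h → All.map (λ {t} l → above {s} {t} h l) ((a<n , a′<n) ∷ low)) (All.tail high))
      clear′ : All (Clear odd n (ι m₄) (1 + n)) (drop 1 ts₁)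
      clear′ = All.++⁺
        ( ((shifted 2 0 , shifted 2 1 , off 2) , (shifted 3 0 , shifted 3 1 , off 3))
        ∷ ((shifted 4 0 , shifted 4 1 , off 4) , (shifted 5 0 , shifted 5 1 , off 5))
        ∷ ((shifted 6 0 , shifted 6 1 , off 6) , (shifted 7 0 , shifted 7 1 , off 7)) ∷ [])
        ((below a<n (λ _ → a≢z) , below a′<n (λ _ → a′≢z))
        ∷ All.zipWith (λ { ((p , p′) , ((_ , _ , pz) , (_ , _ , qz))) → below p pz , below p′ qz }) (low , clear))

  partial : ∀ j → j ≤ 4 * d → ∃₂ λ ts E → length E + 4 ≡ 2 * (8 + n) + 2 * (g + genusStep odd + 2 * j) × Cfg or (8 + n) ts E
  partial j j≤ =
    let s , ms , R , I , K , eq = cfg-head config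
        E , count , C = after I K eq j j≤
    in ts₁ I K eq , E , count , C

  complete : Tight or odd (8 + n) (4 + d) (g + genusStep odd + 2 * (4 * d))
  complete = let s , ms , R , I , K , eq = cfg-head config in next I K eq

-- Lower bounds

Inj : {A B : Set} → (A → B) → Set
Inj f = ∀ {x y} → f x ≡ f y → x ≡ y

remQuot-inj : ∀ {m} k → Inj (remQuot {m} k)
remQuot-inj {m} k {x} {y} eq =
  trans (sym (combine-remQuot {m} k x)) (trans (cong (uncurry combine) eq) (combine-remQuot {m} k y))

splitAt-inj : ∀ m {n} → Inj (splitAt m {n})
splitAt-inj m {n} {x} {y} eq =
  trans (sym (join-splitAt m n x)) (trans (cong (join m n) eq) (join-splitAt m n y))

combine-inj : ∀ {m n} → Inj (uncurry (combine {m} {n}))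
combine-inj {x = i , j} {k , l} eq = let p , q = combine-injective i j k l eq in cong₂ _,_ p q

module Counting (M : Map) (simple : SimpleGraph M) (quadr : Quadrangular M) where
  private
    module M = Map M
    Flag : Set
    Flag = Fin M.nF

  r : Flag → Flag
  r x = M.t1 (M.t0 x)

  edgeMate : Fin 4 → Flag → Flag
  edgeMate 0F x = x
  edgeMate 1F x = M.t0 x
  edgeMate 2F x = M.t2 x
  edgeMate 3F x = M.t0 (M.t2 x)

  edge-edgeMate : ∀ k x → M.edge (edgeMate k x) ≡ M.edge x
  edge-edgeMate 0F x = refl
  edge-edgeMate 1F x = sym (proj₂ (M.edge-orb _ _) (return (inj₁ refl)))
  edge-edgeMate 2F x = sym (proj₂ (M.edge-orb _ _) (return (inj₂ refl)))
  edge-edgeMate 3F x = sym (proj₂ (M.edge-orb _ _) (inj₂ refl ◅ inj₁ refl ◅ ε))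

  t0-inj : Inj M.t0
  t0-inj {x} {y} eq = trans (sym (M.inv0 x)) (trans (cong M.t0 eq) (M.inv0 y))

  edgeMate-inj : ∀ x {j k} → edgeMate j x ≡ edgeMate k x → j ≡ k
  edgeMate-inj x {0F} {0F} _ = refl
  edgeMate-inj x {1F} {1F} _ = refl
  edgeMate-inj x {2F} {2F} _ = refl
  edgeMate-inj x {3F} {3F} _ = refl
  edgeMate-inj x {0F} {1F} eq = contradiction (sym eq) (M.fpf0 x)
  edgeMate-inj x {0F} {2F} eq = contradiction (sym eq) (M.fpf2 x)
  edgeMate-inj x {0F} {3F} eq = contradiction (sym eq) (M.fpf02 x)
  edgeMate-inj x {1F} {0F} eq = contradiction eq (M.fpf0 x)
  edgeMate-inj x {1F} {2F} eq = contradiction (trans (cong M.t0 (sym eq)) (M.inv0 x)) (M.fpf02 x)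
  edgeMate-inj x {1F} {3F} eq = contradiction (sym (t0-inj eq)) (M.fpf2 x)
  edgeMate-inj x {2F} {0F} eq = contradiction eq (M.fpf2 x)
  edgeMate-inj x {2F} {1F} eq = contradiction (trans (cong M.t0 eq) (M.inv0 x)) (M.fpf02 x)
  edgeMate-inj x {2F} {3F} eq = contradiction (sym eq) (M.fpf0 _)
  edgeMate-inj x {3F} {0F} eq = contradiction eq (M.fpf02 x)
  edgeMate-inj x {3F} {1F} eq = contradiction (t0-inj eq) (M.fpf2 x)
  edgeMate-inj x {3F} {2F} eq = contradiction eq (M.fpf0 _)

  4E≤flags : M.E * 4 ≤ M.nF
  4E≤flags = injective⇒≤ {f = mate ∘ remQuot 4} (λ eq → remQuot-inj 4 (mate-inj eq))
    where
    mate : Fin M.E × Fin 4 → Flag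
    mate (e , k) = edgeMate k (proj₁ (M.edge-surj e))
    mate-inj : Inj mate
    mate-inj {e , j} {f , k} eq with trans (sym (proj₂ (M.edge-surj e)))
      (trans (sym (edge-edgeMate j _)) (trans (cong M.edge eq) (trans (edge-edgeMate k _) (proj₂ (M.edge-surj f)))))
    ... | refl = cong (e ,_) (edgeMate-inj _ eq)

  faceMate : Fin 8 → Flag → Flag
  faceMate 0F x = x
  faceMate 1F x = M.t0 x
  faceMate 2F x = r x
  faceMate 3F x = M.t0 (r x)
  faceMate 4F x = r (r x)
  faceMate 5F x = M.t0 (r (r x))
  faceMate 6F x = r (r (r x))
  faceMate 7F x = M.t0 (r (r (r x)))

  r⁴ : ∀ x → r (r (r (r x))) ≡ x
  r⁴ x = proj₁ (quadr x)

  faceMate-t0 : ∀ k x → ∃ λ j → M.t0 (faceMate k x) ≡ faceMate j x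
  faceMate-t0 k x = ∀8 {λ k → ∃ λ j → M.t0 (faceMate k x) ≡ faceMate j x}
    (1F , refl) (0F , M.inv0 _) (3F , refl) (2F , M.inv0 _)
    (5F , refl) (4F , M.inv0 _) (7F , refl) (6F , M.inv0 _) k

  faceMate-t1 : ∀ k x → ∃ λ j → M.t1 (faceMate k x) ≡ faceMate j x
  faceMate-t1 k x = ∀8 {λ k → ∃ λ j → M.t1 (faceMate k x) ≡ faceMate j x}
    (7F , trans (cong M.t1 (sym (r⁴ x))) (M.inv1 _)) (2F , refl)
    (1F , M.inv1 _) (4F , refl) (3F , M.inv1 _) (6F , refl) (5F , M.inv1 _) (0F , r⁴ x) k

  face-reach : ∀ {x y} → Star (Step01 M.t0 M.t1) x y → ∀ {z k} → x ≡ faceMate k z → ∃ λ j → y ≡ faceMate j z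
  face-reach ε {k = k} eq = k , eq
  face-reach (inj₁ refl ◅ st) {z} {k} refl =
    let j , eq = faceMate-t0 k z in face-reach st {z} {j} eq
  face-reach (inj₂ refl ◅ st) {z} {k} refl =
    let j , eq = faceMate-t1 k z in face-reach st {z} {j} eq

  -- Since `r⁴` is the identity, the eight mates of a root are closed under `t0` and `t1` and fill
  -- its face. Together with `4E≤flags` this gives E ≤ 2F, the direction that bounds the number of
  -- vertices from below.
  flags≤8F : M.nF ≤ M.F * 8
  flags≤8F = injective⇒≤ {f = uncurry combine ∘ code} (λ {x} {y} eq → code-inj {x} {y} (combine-inj eq))
    where
    root : Flag → Flag
    root x = proj₁ (M.face-surj (M.face x))
    path : ∀ x → Star (Step01 M.t0 M.t1) (root x) x
    path x = proj₁ (M.face-orb _ _) (proj₂ (M.face-surj (M.face x)))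
    index : ∀ x → ∃ λ k → x ≡ faceMate k (root x)
    index x = face-reach (path x) {root x} {0F} refl
    code : Flag → Fin M.F × Fin 8
    code x = M.face x , proj₁ (index x)
    code-inj : Inj code
    code-inj {x} {y} eq = trans (proj₂ (index x)) (trans
      (cong₂ (λ f k → faceMate k (proj₁ (M.face-surj f))) (cong proj₁ eq) (cong proj₂ eq))
      (sym (proj₂ (index y))))

  ends : Fin M.E × Fin 2 → Flag
  ends (e , 0F) = proj₁ (M.edge-surj e)
  ends (e , 1F) = M.t0 (proj₁ (M.edge-surj e))

  edge-ends : ∀ p → M.edge (ends p) ≡ proj₁ p
  edge-ends (e , 0F) = proj₂ (M.edge-surj e)
  edge-ends (e , 1F) = trans (edge-edgeMate 1F _) (proj₂ (M.edge-surj e))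

  -- In the V × V table every edge takes two cells off the diagonal and every vertex takes its
  -- diagonal cell.
  2E+V≤V² : M.E * 2 + M.V ≤ M.V * M.V
  2E+V≤V² = injective⇒≤ {f = uncurry combine ∘ cell ∘ splitAt (M.E * 2)}
                        (λ eq → splitAt-inj (M.E * 2) (cell-inj (combine-inj eq)))
    where
    cell : Fin (M.E * 2) ⊎ Fin M.V → Fin M.V × Fin M.V
    cell (inj₁ i) = let x = ends (remQuot 2 i) in M.vert x , M.vert (M.t0 x)
    cell (inj₂ v) = v , v
    loop : ∀ {x v} → (M.vert x , M.vert (M.t0 x)) ≢ (v , v)
    loop {x} eq = proj₁ simple x (trans (cong proj₂ eq) (sym (cong proj₁ eq)))
    ends-inj : ∀ p q → M.vert (ends p) ≡ M.vert (ends q) → M.vert (M.t0 (ends p)) ≡ M.vert (M.t0 (ends q)) → p ≡ q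
    ends-inj p q a b with trans (sym (edge-ends p)) (trans (proj₂ simple _ _ a b) (edge-ends q))
    ends-inj (e , 0F) (_ , 0F) a b | refl = refl
    ends-inj (e , 1F) (_ , 1F) a b | refl = refl
    ends-inj (e , 0F) (_ , 1F) a b | refl = contradiction (sym a) (proj₁ simple _)
    ends-inj (e , 1F) (_ , 0F) a b | refl = contradiction a (proj₁ simple _)
    cell-inj : Inj cell
    cell-inj {inj₁ i} {inj₁ j} eq = cong inj₁ (remQuot-inj {M.E} 2 (ends-inj (remQuot 2 i) (remQuot 2 j) (cong proj₁ eq) (cong proj₂ eq)))
    cell-inj {inj₁ i} {inj₂ v} eq = contradiction eq (loop {ends (remQuot 2 i)})
    cell-inj {inj₂ v} {inj₁ j} eq = contradiction (sym eq) (loop {ends (remQuot 2 j)})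
    cell-inj {inj₂ v} {inj₂ w} eq = cong inj₂ (cong proj₁ eq)

  aFlag : Flag
  aFlag = Fin.fromℕ< M.nonempty

  4≤V : 4 ≤ M.V
  4≤V = injective⇒≤ {f = walkVertex} walk-inj
    where
    x = aFlag
    walkVertex : Fin 4 → Fin M.V
    walkVertex 0F = M.vert x
    walkVertex 1F = M.vert (r x)
    walkVertex 2F = M.vert (r (r x))
    walkVertex 3F = M.vert (r (r (r x)))
    walk-inj : Inj walkVertex
    walk-inj {i} {j} eq with quadr x
    walk-inj {0F} {0F} eq | _ = refl
    walk-inj {1F} {1F} eq | _ = refl
    walk-inj {2F} {2F} eq | _ = refl
    walk-inj {3F} {3F} eq | _ = refl
    walk-inj {0F} {1F} eq | _ , d , _ = contradiction eq d
    walk-inj {0F} {2F} eq | _ , _ , d , _ = contradiction eq d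
    walk-inj {0F} {3F} eq | _ , _ , _ , d , _ = contradiction eq d
    walk-inj {1F} {2F} eq | _ , _ , _ , _ , d , _ = contradiction eq d
    walk-inj {1F} {3F} eq | _ , _ , _ , _ , _ , d , _ = contradiction eq d
    walk-inj {2F} {3F} eq | _ , _ , _ , _ , _ , _ , d = contradiction eq d
    walk-inj {1F} {0F} eq | _ , d , _ = contradiction (sym eq) d
    walk-inj {2F} {0F} eq | _ , _ , d , _ = contradiction (sym eq) d
    walk-inj {3F} {0F} eq | _ , _ , _ , d , _ = contradiction (sym eq) d
    walk-inj {2F} {1F} eq | _ , _ , _ , _ , d , _ = contradiction (sym eq) d
    walk-inj {3F} {1F} eq | _ , _ , _ , _ , _ , d , _ = contradiction (sym eq) d
    walk-inj {3F} {2F} eq | _ , _ , _ , _ , _ , _ , d = contradiction (sym eq) d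

  E≤2F : M.E ≤ 2 * M.F
  E≤2F = *-cancelʳ-≤ M.E (2 * M.F) 4 (≤-trans 4E≤flags (≤-trans flags≤8F (≤-reflexive (assoc M.F))))
    where
    assoc : ∀ f → f * 8 ≡ 2 * f * 4
    assoc = solve-∀

  -- Euler's formula with F ≥ E/2 gives 4g ≤ 8 + 2E - 4V, and 2E ≤ V² - V eliminates E. The summand
  -- 2E is carried on both sides so that nothing is subtracted.
  genus-bound : ∀ {g} → M.V + M.F + g ≡ 2 + M.E → 4 * g + 5 * M.V ≤ M.V * M.V + 8
  genus-bound {g} eq = +-cancelʳ-≤ (2 * M.E) _ _ (begin
    4 * g + 5 * M.V + 2 * M.E          ≤⟨ +-monoʳ-≤ (4 * g + 5 * M.V) (*-monoʳ-≤ 2 E≤2F) ⟩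
    4 * g + 5 * M.V + 2 * (2 * M.F)    ≡⟨ gather M.V M.F g ⟩
    4 * (M.V + M.F + g) + M.V          ≡⟨ cong (λ x → 4 * x + M.V) eq ⟩
    4 * (2 + M.E) + M.V                ≡⟨ spread M.E M.V ⟩
    (M.E * 2 + M.V) + 8 + 2 * M.E      ≤⟨ +-monoˡ-≤ (2 * M.E) (+-monoˡ-≤ 8 2E+V≤V²) ⟩
    M.V * M.V + 8 + 2 * M.E ∎)
    where
    open ≤-Reasoning
    gather : ∀ v f g → 4 * g + 5 * v + 2 * (2 * f) ≡ 4 * (v + f + g) + v
    gather = solve-∀
    spread : ∀ e v → 4 * (2 + e) + v ≡ (e * 2 + v) + 8 + 2 * e
    spread = solve-∀

-- Five vertices do not suffice for the Klein bottle

module Klein where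

  -- Unlike T b, the type Holds b is never unfolded, which keeps the large
  -- closed tests below from being evaluated on symbolic arguments.
  data Holds : Bool → Set where
    tr : Holds true

  holds : ∀ {b} → T b → Holds b
  holds {true} _ = tr

  unholds : ∀ {b} → Holds b → T b
  unholds tr = tt

  and⁻ : ∀ {a b} → Holds (a ∧ b) → Holds a × Holds b
  and⁻ {true} {true} _ = tr , tr

  and⁺ : ∀ {a b} → Holds a × Holds b → Holds (a ∧ b)
  and⁺ (tr , tr) = tr

  or⁻ : ∀ {a b} → Holds (a ∨ b) → Holds a ⊎ Holds b
  or⁻ {true} _ = inj₁ tr
  or⁻ {false} h = inj₂ h

  or⁺ : ∀ {a b} → Holds a ⊎ Holds b → Holds (a ∨ b)
  or⁺ (inj₁ tr) = tr
  or⁺ {true} (inj₂ tr) = tr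
  or⁺ {false} (inj₂ tr) = tr

  equals : ∀ {m n} → Holds (m ≡ᵇ n) → m ≡ n
  equals h = ≡ᵇ⇒≡ _ _ (unholds h)

  self : ∀ m → Holds (m ≡ᵇ m)
  self m = holds (≡⇒≡ᵇ m m refl)

  refute : ∀ {b} → ¬ Holds b → Holds (not b)
  refute {true} h = contradiction tr h
  refute {false} _ = tr

  unequal : ∀ {m n} → m ≢ n → Holds (not (m ≡ᵇ n))
  unequal m≢n = refute (m≢n ∘ equals)

  below : ℕ → (ℕ → Bool) → Bool
  below n p = all p (upTo n)

  below-sound : ∀ n p → Holds (below n p) → ∀ {i} → i < n → Holds (p i)
  below-sound n p t i<n = holds (All.lookup (All.all⁺ p (upTo n) (unholds t)) (∈-upTo⁺ i<n))

  below-complete : ∀ n p → (∀ {i} → i < n → Holds (p i)) → Holds (below n p)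
  below-complete n p h = holds (All.all⁻ p (All.tabulate λ m → unholds (h (∈-upTo⁻ m))))

  below² : ∀ k l (P : ℕ → ℕ → Bool) → Holds (below k λ a → below l λ b → P a b) →
           ∀ {a b} → a < k → b < l → Holds (P a b)
  below² k l P h {a} {b} a< b< = below-sound l (λ b → P a b) (below-sound k (λ a → below l λ b → P a b) h {a} a<) {b} b<

  below⁴ : ∀ k l m n (P : ℕ → ℕ → ℕ → ℕ → Bool) →
           Holds (below k λ a → below l λ b → below m λ c → below n λ d → P a b c d) →
           ∀ {a b c d} → a < k → b < l → c < m → d < n → Holds (P a b c d)
  below⁴ k l m n P h {a} {b} {c} {d} a< b< c< d< = below² m n (λ c d → P a b c d)
    (below² k l (λ a b → below m λ c → below n λ d → P a b c d) h {a} {b} a< b<) {c} {d} c< d<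

  below⁵ : ∀ k l m n o (P : ℕ → ℕ → ℕ → ℕ → ℕ → Bool) →
           Holds (below k λ a → below l λ b → below m λ c → below n λ d → below o λ e → P a b c d e) →
           ∀ {a b c d e} → a < k → b < l → c < m → d < n → e < o → Holds (P a b c d e)
  below⁵ k l m n o P h {a} {b} {c} {d} {e} a< b< c< d< e< = below-sound o (λ e → P a b c d e)
    (below⁴ k l m n (λ a b c d → below o λ e → P a b c d e) h {a} {b} {c} {d} a< b< c< d<) {e} e<

  _⇒ᵇ_ : Bool → Bool → Bool
  true ⇒ᵇ b = b
  false ⇒ᵇ _ = true

  ⇒ᵇ-sound : ∀ {a b} → Holds (a ⇒ᵇ b) → Holds a → Holds b
  ⇒ᵇ-sound h tr = h

  ⇒ᵇ-complete : ∀ {a b} → (Holds a → Holds b) → Holds (a ⇒ᵇ b)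
  ⇒ᵇ-complete {true} h = h tr
  ⇒ᵇ-complete {false} _ = tr

  is : (u w x y : ℕ) → Bool
  is u w x y = (u ≡ᵇ x) ∧ (w ≡ᵇ y)

  isDart : Quad → ℕ → ℕ → Bool
  isDart (quad a b c d) u w = is u w a b ∨ is u w b c ∨ is u w c d ∨ is u w d a

  isSide : Quad → ℕ → ℕ → Bool
  isSide q u w = isDart q u w ∨ isDart q w u

  -- The three 4-cycles through the vertices 0, …, 4 other than m.
  cycle : (m s : ℕ) → Quad
  cycle m s = order s (skip 0) (skip 1) (skip 2) (skip 3)
    where
    skip : ℕ → ℕ
    skip i = if i <ᵇ m then i else suc i
    order : ℕ → (w x y z : ℕ) → Quad
    order 0 w x y z = quad w x y z
    order 1 w x y z = quad w x z y
    order _ w x y z = quad w y x z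

  distinctᵇ : (a b c d : ℕ) → Bool
  distinctᵇ a b c d = not (a ≡ᵇ b) ∧ not (a ≡ᵇ c) ∧ not (a ≡ᵇ d) ∧ not (b ≡ᵇ c) ∧ not (b ≡ᵇ d) ∧ not (c ≡ᵇ d)

  -- 0 + 1 + 2 + 3 + 4 = 10
  missing : Quad → ℕ
  missing (quad a b c d) = 10 ∸ (a + b + c + d)

  pattern-of : Quad → ℕ
  pattern-of q@(quad a b c d) = if fits 0 then 0 else if fits 1 then 1 else 2
    where
    fits : ℕ → Bool
    fits s = isSide (cycle (missing q) s) a b ∧ isSide (cycle (missing q) s) b c
           ∧ isSide (cycle (missing q) s) c d ∧ isSide (cycle (missing q) s) d a

  _≡ᴮ_ : Bool → Bool → Bool
  a ≡ᴮ b = not (a xor b)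

  ≡ᴮ-sound : ∀ {a b} → Holds (a ≡ᴮ b) → a ≡ b
  ≡ᴮ-sound {true} {true} _ = refl
  ≡ᴮ-sound {false} {false} _ = refl

  is-refl : ∀ u w → Holds (is u w u w)
  is-refl u w = and⁺ (self u , self w)

  is-sound : ∀ {u w x y} → Holds (is u w x y) → x ≡ u × y ≡ w
  is-sound {u} {w} {x} {y} h = let p , q = and⁻ {u ≡ᵇ x} {w ≡ᵇ y} h in sym (equals p) , sym (equals q)

  orˡ : ∀ a b → Holds a → Holds (a ∨ b)
  orˡ a b h = or⁺ {a} {b} (inj₁ h)

  orʳ : ∀ a b → Holds b → Holds (a ∨ b)
  orʳ a b h = or⁺ {a} {b} (inj₂ h)

  side-complete : ∀ q k → Holds (isSide q (at q k) (nb q k))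
  side-complete q@(quad a b c d) = ∀8
    (along a b ab) (against a d da) (along b c bc) (against b a ab)
    (along c d cd) (against c b bc) (along d a da) (against d c cd)
    where
    along : ∀ u w → Holds (isDart q u w) → Holds (isSide q u w)
    along u w = orˡ (isDart q u w) (isDart q w u)
    against : ∀ u w → Holds (isDart q w u) → Holds (isSide q u w)
    against u w = orʳ (isDart q u w) (isDart q w u)
    ab : Holds (isDart q a b)
    ab = orˡ (is a b a b) (is a b b c ∨ is a b c d ∨ is a b d a) (is-refl a b)
    bc : Holds (isDart q b c)
    bc = orʳ (is b c a b) (is b c b c ∨ is b c c d ∨ is b c d a) (orˡ (is b c b c) (is b c c d ∨ is b c d a) (is-refl b c))
    cd : Holds (isDart q c d)
    cd = orʳ (is c d a b) (is c d b c ∨ is c d c d ∨ is c d d a)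
      (orʳ (is c d b c) (is c d c d ∨ is c d d a) (orˡ (is c d c d) (is c d d a) (is-refl c d)))
    da : Holds (isDart q d a)
    da = orʳ (is d a a b) (is d a b c ∨ is d a c d ∨ is d a d a)
      (orʳ (is d a b c) (is d a c d ∨ is d a d a) (orʳ (is d a c d) (is d a d a) (is-refl d a)))

  dart-sound : ∀ q {u w} → Holds (isDart q u w) → ∃ λ k → at q k ≡ u × nb q k ≡ w
  dart-sound (quad a b c d) {u} {w} h with or⁻ {is u w a b} {is u w b c ∨ is u w c d ∨ is u w d a} h
  ... | inj₁ h₁ = 0F , is-sound h₁
  ... | inj₂ h′ with or⁻ {is u w b c} {is u w c d ∨ is u w d a} h′
  ...   | inj₁ h₁ = 2F , is-sound h₁
  ...   | inj₂ h″ with or⁻ {is u w c d} {is u w d a} h″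
  ...     | inj₁ h₁ = 4F , is-sound h₁
  ...     | inj₂ h₁ = 6F , is-sound h₁

  side-sound : ∀ q {u w} → Holds (isSide q u w) → ∃ λ k → at q k ≡ u × nb q k ≡ w
  side-sound q {u} {w} h with or⁻ {isDart q u w} {isDart q w u} h
  ... | inj₁ f = dart-sound q f
  ... | inj₂ b = let k , p , r = dart-sound q b in τ₀ k , trans (at-τ₀ q k) r , trans (nb-τ₀ q k) p

  hitsᵇ : Quad → ℕ → Bool
  hitsᵇ (quad a b c d) u = (u ≡ᵇ a) ∨ (u ≡ᵇ b) ∨ (u ≡ᵇ c) ∨ (u ≡ᵇ d)

  coversᵇ followsᵇ normalᵇ : Quad → Bool
  coversᵇ q = below 5 λ u → not (u ≡ᵇ missing q) ⇒ᵇ hitsᵇ q u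
  followsᵇ q = below 5 λ u → below 5 λ w → isSide (cycle (missing q) (pattern-of q)) u w ≡ᴮ isSide q u w
  normalᵇ q = (missing q <ᵇ 5) ∧ (pattern-of q <ᵇ 3) ∧ coversᵇ q ∧ followsᵇ q

  -- All 120 quadruples of distinct labels are tested: each is a rotation or reflection of one of
  -- the 15 cycles `cycle m s`. A face is thereby described by two small numbers, the vertex it
  -- misses and its pattern.
  normal : Holds (below 5 λ a → below 5 λ b → below 5 λ c → below 5 λ d → distinctᵇ a b c d ⇒ᵇ normalᵇ (quad a b c d))
  normal = tr

  normal-quad : ∀ {a b c d} → a < 5 → b < 5 → c < 5 → d < 5 → Holds (distinctᵇ a b c d) → Holds (normalᵇ (quad a b c d))
  normal-quad {a} {b} {c} {d} a< b< c< d< dis = ⇒ᵇ-sound {distinctᵇ a b c d}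
    (below⁴ 5 5 5 5 (λ a b c d → distinctᵇ a b c d ⇒ᵇ normalᵇ (quad a b c d)) normal {a} {b} {c} {d} a< b< c< d<) dis

  normal-parts : ∀ q → Holds (normalᵇ q) →
    Holds (missing q <ᵇ 5) × Holds (pattern-of q <ᵇ 3) × Holds (coversᵇ q) × Holds (followsᵇ q)
  normal-parts q h =
    let p , h₁ = and⁻ {missing q <ᵇ 5} {(pattern-of q <ᵇ 3) ∧ coversᵇ q ∧ followsᵇ q} h
        t , h₂ = and⁻ {pattern-of q <ᵇ 3} {coversᵇ q ∧ followsᵇ q} h₁
    in p , t , and⁻ {coversᵇ q} {followsᵇ q} h₂

  -- Together with `turning` this says that being directed along a fixed cycle is a property of its
  -- flags that changes under `t0` and under `t1`.
  reversal : Holds (below 5 λ m → below 3 λ s → below 5 λ u → below 5 λ w →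
    isSide (cycle m s) u w ⇒ᵇ (isDart (cycle m s) w u ≡ᴮ not (isDart (cycle m s) u w)))
  reversal = tr

  turning : Holds (below 5 λ m → below 3 λ s → below 5 λ u → below 5 λ w → below 5 λ w′ →
    (isSide (cycle m s) u w ∧ isSide (cycle m s) u w′ ∧ not (w ≡ᵇ w′)) ⇒ᵇ
    (isDart (cycle m s) u w′ ≡ᴮ not (isDart (cycle m s) u w)))
  turning = tr

  covers-at : ∀ q {u} → Holds (coversᵇ q) → u < 5 → u ≢ missing q → Holds (hitsᵇ q u)
  covers-at q {u} h u<5 u≢ = ⇒ᵇ-sound {not (u ≡ᵇ missing q)}
    (below-sound 5 (λ u → not (u ≡ᵇ missing q) ⇒ᵇ hitsᵇ q u) h {u} u<5) (unequal u≢)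

  follows-at : ∀ q {u w} → Holds (followsᵇ q) → u < 5 → w < 5 →
               isSide (cycle (missing q) (pattern-of q)) u w ≡ isSide q u w
  follows-at q {u} {w} h u<5 w<5 = ≡ᴮ-sound (below² 5 5
    (λ u w → isSide (cycle (missing q) (pattern-of q)) u w ≡ᴮ isSide q u w) h {u} {w} u<5 w<5)

  reversal-at : ∀ {m p u w} → m < 5 → p < 3 → u < 5 → w < 5 → Holds (isSide (cycle m p) u w) →
                isDart (cycle m p) w u ≡ not (isDart (cycle m p) u w)
  reversal-at {m} {p} {u} {w} m< p< u< w< on = ≡ᴮ-sound (⇒ᵇ-sound {isSide (cycle m p) u w}
    (below⁴ 5 3 5 5
      (λ m p u w → isSide (cycle m p) u w ⇒ᵇ (isDart (cycle m p) w u ≡ᴮ not (isDart (cycle m p) u w)))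
      reversal {m} {p} {u} {w} m< p< u< w<) on)

  turning-at : ∀ {m p u w w′} → m < 5 → p < 3 → u < 5 → w < 5 → w′ < 5 →
    Holds (isSide (cycle m p) u w) → Holds (isSide (cycle m p) u w′) → w ≢ w′ →
    isDart (cycle m p) u w′ ≡ not (isDart (cycle m p) u w)
  turning-at {m} {p} {u} {w} {w′} m< p< u< w< w′< on on′ w≢w′ = ≡ᴮ-sound
    (⇒ᵇ-sound {isSide (cycle m p) u w ∧ isSide (cycle m p) u w′ ∧ not (w ≡ᵇ w′)}
      (below⁵ 5 3 5 5 5
        (λ m p u w w′ → (isSide (cycle m p) u w ∧ isSide (cycle m p) u w′ ∧ not (w ≡ᵇ w′)) ⇒ᵇ
                        (isDart (cycle m p) u w′ ≡ᴮ not (isDart (cycle m p) u w)))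
        turning {m} {p} {u} {w} {w′} m< p< u< w< w′<)
      (and⁺ (on , and⁺ (on′ , unequal w≢w′))))

  sel : {A : Set} → (x₀ x₁ x₂ x₃ x₄ : A) → ℕ → A
  sel x₀ x₁ x₂ x₃ x₄ 0 = x₀
  sel x₀ x₁ x₂ x₃ x₄ 1 = x₁
  sel x₀ x₁ x₂ x₃ x₄ 2 = x₂
  sel x₀ x₁ x₂ x₃ x₄ 3 = x₃
  sel x₀ x₁ x₂ x₃ x₄ _ = x₄

  sel-at : ∀ {A : Set} (f : Fin 5 → A) i → sel (f 0F) (f 1F) (f 2F) (f 3F) (f 4F) (toℕ i) ≡ f i
  sel-at f 0F = refl
  sel-at f 1F = refl
  sel-at f 2F = refl
  sel-at f 3F = refl
  sel-at f 4F = refl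

  module _ (s : ℕ → ℕ) where
    on : (m u w : ℕ) → Bool
    on m u w = isSide (cycle m (s m)) u w

    -- Five 4-cycles have 20 sides and K₅ has 10 edges, so if no edge lies on three of the cycles,
    -- each lies on exactly two.
    sparseᵇ : Bool
    sparseᵇ = below 5 λ u → below 5 λ w → below 5 λ m₁ → on m₁ u w ⇒ᵇ
      (below m₁ λ m₂ → on m₂ u w ⇒ᵇ (below m₂ λ m₃ → not (on m₃ u w)))

    coherentᵇ : (ℕ → Bool) → Bool
    coherentᵇ o = below 5 λ m → below 5 λ m′ → (m ≡ᵇ m′) ∨ (below 5 λ u → below 5 λ w →
      (on m u w ∧ on m′ u w) ⇒ᵇ
      ((isDart (cycle m (s m)) u w xor o m) xor (isDart (cycle m′ (s m′)) u w xor o m′)))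

  anyBool : (Bool → Bool) → Bool
  anyBool p = p true ∨ p false

  anyBool-elim : ∀ {X : Set} p → Holds (anyBool p) → (∀ b → Holds (p b) → X) → X
  anyBool-elim p h f with or⁻ {p true} h
  ... | inj₁ h′ = f true h′
  ... | inj₂ h′ = f false h′

  -- One 4-cycle avoiding m is chosen for each m, with no edge on three of them.
  orientations : Holds (below 3 λ s₀ → below 3 λ s₁ → below 3 λ s₂ → below 3 λ s₃ → below 3 λ s₄ →
    sparseᵇ (sel s₀ s₁ s₂ s₃ s₄) ⇒ᵇ
    -- Reversing all faces at once keeps coherence, so the direction of the first cycle is fixed to
    -- `true`.
    (anyBool λ o₁ → anyBool λ o₂ → anyBool λ o₃ → anyBool λ o₄ →
      coherentᵇ (sel s₀ s₁ s₂ s₃ s₄) (sel true o₁ o₂ o₃ o₄)))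
  orientations = tr

  orientation-of : ∀ {s₀ s₁ s₂ s₃ s₄} → s₀ < 3 → s₁ < 3 → s₂ < 3 → s₃ < 3 → s₄ < 3 →
    Holds (sparseᵇ (sel s₀ s₁ s₂ s₃ s₄)) → ∃ λ o → Holds (coherentᵇ (sel s₀ s₁ s₂ s₃ s₄) o)
  orientation-of {s₀} {s₁} {s₂} {s₃} {s₄} l₀ l₁ l₂ l₃ l₄ sp =
    anyBool-elim (λ o₁ → anyBool λ o₂ → anyBool λ o₃ → anyBool λ o₄ → coherentᵇ (sel s₀ s₁ s₂ s₃ s₄) (sel true o₁ o₂ o₃ o₄)) h₀ λ o₁ h₁ →
    anyBool-elim (λ o₂ → anyBool λ o₃ → anyBool λ o₄ → coherentᵇ (sel s₀ s₁ s₂ s₃ s₄) (sel true o₁ o₂ o₃ o₄)) h₁ λ o₂ h₂ →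
    anyBool-elim (λ o₃ → anyBool λ o₄ → coherentᵇ (sel s₀ s₁ s₂ s₃ s₄) (sel true o₁ o₂ o₃ o₄)) h₂ λ o₃ h₃ →
    anyBool-elim (λ o₄ → coherentᵇ (sel s₀ s₁ s₂ s₃ s₄) (sel true o₁ o₂ o₃ o₄)) h₃ λ o₄ h₄ →
    sel true o₁ o₂ o₃ o₄ , h₄
    where
    h₀ : Holds (anyBool λ o₁ → anyBool λ o₂ → anyBool λ o₃ → anyBool λ o₄ → coherentᵇ (sel s₀ s₁ s₂ s₃ s₄) (sel true o₁ o₂ o₃ o₄))
    h₀ = ⇒ᵇ-sound {sparseᵇ (sel s₀ s₁ s₂ s₃ s₄)}
      {anyBool λ o₁ → anyBool λ o₂ → anyBool λ o₃ → anyBool λ o₄ → coherentᵇ (sel s₀ s₁ s₂ s₃ s₄) (sel true o₁ o₂ o₃ o₄)}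
      (below⁵ 3 3 3 3 3
        (λ s₀ s₁ s₂ s₃ s₄ → sparseᵇ (sel s₀ s₁ s₂ s₃ s₄) ⇒ᵇ
          (anyBool λ o₁ → anyBool λ o₂ → anyBool λ o₃ → anyBool λ o₄ → coherentᵇ (sel s₀ s₁ s₂ s₃ s₄) (sel true o₁ o₂ o₃ o₄)))
        orientations {s₀} {s₁} {s₂} {s₃} {s₄} l₀ l₁ l₂ l₃ l₄) sp

  coherent-at : ∀ s o {m m′ u w} → Holds (coherentᵇ s o) → m < 5 → m′ < 5 → u < 5 → w < 5 → m ≢ m′ →
    Holds (on s m u w) → Holds (on s m′ u w) →
    isDart (cycle m (s m)) u w xor o m ≢ isDart (cycle m′ (s m′)) u w xor o m′
  coherent-at s o {m} {m′} {u} {w} h m< m′< u< w< m≢m′ on-m on-m′ =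
    [ (λ same → contradiction (equals same) m≢m′)
    , (λ h → differ (⇒ᵇ-sound {on s m u w ∧ on s m′ u w}
        (below² 5 5 (λ u w → Q m m′ u w) h {u} {w} u< w<) (and⁺ (on-m , on-m′)))) ]′
    (or⁻ {m ≡ᵇ m′} {below 5 λ u → below 5 λ w → Q m m′ u w}
      (below² 5 5 (λ m m′ → (m ≡ᵇ m′) ∨ (below 5 λ u → below 5 λ w → Q m m′ u w)) h {m} {m′} m< m′<))
    where
    Q : (m m′ u w : ℕ) → Bool
    Q m m′ u w = (on s m u w ∧ on s m′ u w) ⇒ᵇ
      ((isDart (cycle m (s m)) u w xor o m) xor (isDart (cycle m′ (s m′)) u w xor o m′))
    differ : ∀ {a b} → Holds (a xor b) → a ≢ b
    differ {true} () refl
    differ {false} () refl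

  module K₅ (M : Map) (simple : SimpleGraph M) (quadr : Quadrangular M)
            (V≡5 : V M ≡ 5) (F≡5 : F M ≡ 5) where
    open Counting M simple quadr
    private
      module M = Map M
      Flag : Set
      Flag = Fin M.nF

    v : Flag → ℕ
    v x = toℕ (M.vert x)

    v<5 : ∀ x → v x < 5
    v<5 x = subst (v x <_) V≡5 (toℕ<n (M.vert x))

    v-vert : ∀ {x y} → v x ≡ v y → M.vert x ≡ M.vert y
    v-vert = toℕ-injective

    v-t1 : ∀ x → v (M.t1 x) ≡ v x
    v-t1 x = cong toℕ (sym (proj₂ (M.vert-orb _ _) (return (inj₁ refl))))

    v-t2 : ∀ x → v (M.t2 x) ≡ v x
    v-t2 x = cong toℕ (sym (proj₂ (M.vert-orb _ _) (return (inj₂ refl))))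

    tip : Flag → ℕ
    tip x = v (M.t0 x)

    tip-r : ∀ x → v (r x) ≡ tip x
    tip-r x = v-t1 (M.t0 x)

    tip-t2 : ∀ x → tip (M.t2 x) ≡ tip x
    tip-t2 x = trans (cong v (M.comm02 x)) (v-t2 (M.t0 x))

    v≢tip : ∀ x → v x ≢ tip x
    v≢tip x eq = proj₁ simple x (v-vert (sym eq))

    square : Flag → Quad
    square x = quad (v x) (v (r x)) (v (r (r x))) (v (r (r (r x))))

    miss : Flag → ℕ
    miss x = missing (square x)

    distinct : ∀ x → Holds (distinctᵇ (v x) (v (r x)) (v (r (r x))) (v (r (r (r x)))))
    distinct x =
      let _ , p , q , s , t , u , w = quadr x in
      both (differ p) (both (differ q) (both (differ s) (both (differ t) (both (differ u) (differ w)))))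
      where
      both : ∀ {a b} → Holds a → Holds b → Holds (a ∧ b)
      both h k = and⁺ (h , k)
      differ : ∀ {y z} → M.vert y ≢ M.vert z → Holds (not (v y ≡ᵇ v z))
      differ ne = unequal (ne ∘ v-vert)

    abstract
      normal-at : ∀ x → Holds (missing (square x) <ᵇ 5) × Holds (pattern-of (square x) <ᵇ 3) ×
                        Holds (coversᵇ (square x)) × Holds (followsᵇ (square x))
      normal-at x = normal-parts (square x) (renamed (quad (v x) (v (r x)) (v (r (r x))) (v (r (r (r x))))) (square x) refl
        (normal-quad (v<5 x) (v<5 (r x)) (v<5 (r (r x))) (v<5 (r (r (r x)))) (distinct x)))
        where
        renamed : ∀ q q′ → q ≡ q′ → Holds (normalᵇ q) → Holds (normalᵇ q′)
        renamed _ _ refl h = h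

    edge-reach : ∀ {x y} → Star (Step02 M.t0 M.t2) x y → ∀ {z} k → x ≡ edgeMate k z → ∃ λ j → y ≡ edgeMate j z
    edge-reach ε k eq = k , eq
    edge-reach (inj₁ refl ◅ st) {z} 0F refl = edge-reach st 1F refl
    edge-reach (inj₁ refl ◅ st) {z} 1F refl = edge-reach st 0F (M.inv0 z)
    edge-reach (inj₁ refl ◅ st) {z} 2F refl = edge-reach st 3F refl
    edge-reach (inj₁ refl ◅ st) {z} 3F refl = edge-reach st 2F (M.inv0 _)
    edge-reach (inj₂ refl ◅ st) {z} 0F refl = edge-reach st 2F refl
    edge-reach (inj₂ refl ◅ st) {z} 1F refl = edge-reach st 3F (sym (M.comm02 z))
    edge-reach (inj₂ refl ◅ st) {z} 2F refl = edge-reach st 0F (M.inv2 z)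
    edge-reach (inj₂ refl ◅ st) {z} 3F refl = edge-reach st 1F (trans (sym (M.comm02 _)) (cong M.t0 (M.inv2 z)))

    same-dart : ∀ {x y} → v x ≡ v y → tip x ≡ tip y → y ≡ x ⊎ y ≡ M.t2 x
    same-dart {x} {y} p q
      with edge-reach (proj₁ (M.edge-orb x y) (proj₂ simple x y (v-vert p) (v-vert q))) {x} 0F refl
    ... | 0F , eq = inj₁ eq
    ... | 1F , refl = contradiction p (v≢tip x)
    ... | 2F , eq = inj₂ eq
    ... | 3F , refl = contradiction (trans p (tip-t2 x)) (v≢tip x)

    r³ : ∀ x → r (r (r x)) ≡ M.t0 (M.t1 x)
    r³ x = trans (sym (M.inv0 _)) (cong M.t0 (trans (sym (M.inv1 _)) (cong M.t1 (r⁴ x))))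

    tip-t1 : ∀ x → tip (M.t1 x) ≡ v (r (r (r x)))
    tip-t1 x = cong v (sym (r³ x))

    tip-t1≢tip : ∀ x → tip (M.t1 x) ≢ tip x
    tip-t1≢tip x eq = proj₁ (proj₂ (proj₂ (proj₂ (proj₂ (proj₂ (quadr x))))))
      (v-vert (trans (tip-r x) (trans (sym eq) (tip-t1 x))))

    mate-dart : ∀ k x → ∃ λ j → v (faceMate k x) ≡ at (square x) j × tip (faceMate k x) ≡ nb (square x) j
    mate-dart k x = ∀8 {λ k → ∃ λ j → v (faceMate k x) ≡ at (square x) j × tip (faceMate k x) ≡ nb (square x) j}
      (0F , refl , s x) (3F , s x , cong v (M.inv0 _))
      (2F , refl , s _) (5F , s _ , cong v (M.inv0 _))
      (4F , refl , s _) (7F , s _ , cong v (M.inv0 _))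
      (6F , refl , trans (s _) (cong v (r⁴ x))) (1F , trans (s _) (cong v (r⁴ x)) , cong v (M.inv0 _)) k
      where
      s : ∀ y → tip y ≡ v (r y)
      s y = sym (tip-r y)

    dart-mate : ∀ j x → ∃ λ k → v (faceMate k x) ≡ at (square x) j × tip (faceMate k x) ≡ nb (square x) j
    dart-mate j x = ∀8 {λ j → ∃ λ k → v (faceMate k x) ≡ at (square x) j × tip (faceMate k x) ≡ nb (square x) j}
      (0F , proj₂ (mate-dart 0F x)) (7F , proj₂ (mate-dart 7F x))
      (2F , proj₂ (mate-dart 2F x)) (1F , proj₂ (mate-dart 1F x))
      (4F , proj₂ (mate-dart 4F x)) (3F , proj₂ (mate-dart 3F x))
      (6F , proj₂ (mate-dart 6F x)) (5F , proj₂ (mate-dart 5F x)) j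

    miss-r : ∀ x → miss (r x) ≡ miss x
    miss-r x = cong (10 ∸_) (trans (cong (v (r x) + v (r (r x)) + v (r (r (r x))) +_) (cong v (r⁴ x)))
      (trans (+-comm (v (r x) + v (r (r x)) + v (r (r (r x)))) (v x))
        (trans (sym (+-assoc (v x) (v (r x) + v (r (r x))) _)) (cong (_+ v (r (r (r x)))) (sym (+-assoc (v x) (v (r x)) _))))))

    r-t0 : ∀ x → r (M.t0 x) ≡ M.t1 x
    r-t0 x = cong M.t1 (M.inv0 x)

    r-t1 : ∀ x → r (M.t1 x) ≡ M.t1 (r (r (r x)))
    r-t1 x = cong M.t1 (sym (r³ x))

    miss-t0 : ∀ x → miss (M.t0 x) ≡ miss x
    miss-t0 x = cong (10 ∸_) (trans
      (cong₂ _+_ (cong₂ _+_ (cong₂ _+_ (sym (tip-r x)) b) c) d) (swap-sides (v x) (v (r x)) (v (r (r x))) (v (r (r (r x))))))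
      where
      b : v (r (M.t0 x)) ≡ v x
      b = trans (cong v (r-t0 x)) (v-t1 x)
      c′ : r (r (M.t0 x)) ≡ M.t1 (r (r (r x)))
      c′ = trans (cong r (r-t0 x)) (r-t1 x)
      c : v (r (r (M.t0 x))) ≡ v (r (r (r x)))
      c = trans (cong v c′) (v-t1 _)
      d : v (r (r (r (M.t0 x)))) ≡ v (r (r x))
      d = trans (cong v (trans (cong r c′) (r-t1 (r (r (r x))))))
            (trans (v-t1 _) (cong (v ∘ r ∘ r) (r⁴ x)))
      swap-sides : ∀ a b c d → b + a + d + c ≡ a + b + c + d
      swap-sides = solve-∀

    miss-t1 : ∀ x → miss (M.t1 x) ≡ miss x
    miss-t1 x = trans (sym (miss-t0 (M.t1 x))) (trans (cong miss (sym (r³ x)))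
      (trans (miss-r _) (trans (miss-r _) (miss-r x))))

    miss-face : ∀ x y → M.face x ≡ M.face y → miss x ≡ miss y
    miss-face x y eq = star-invariant miss
      (λ { x _ (inj₁ refl) → sym (miss-t0 x) ; x _ (inj₂ refl) → sym (miss-t1 x) }) (proj₁ (M.face-orb x y) eq)

    face-t0 : ∀ x → M.face (M.t0 x) ≡ M.face x
    face-t0 x = sym (proj₂ (M.face-orb _ _) (return (inj₁ refl)))

    face-t1 : ∀ x → M.face (M.t1 x) ≡ M.face x
    face-t1 x = sym (proj₂ (M.face-orb _ _) (return (inj₂ refl)))

    face-r : ∀ x → M.face (r x) ≡ M.face x
    face-r x = trans (face-t1 _) (face-t0 x)

    abstract
      miss<5 : ∀ x → miss x < 5
      miss<5 x = <ᵇ⇒< _ 5 (unholds (proj₁ (normal-at x)))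

    meets : ∀ {m} x → m < 5 → m ≢ miss x → ∃ λ y → M.face y ≡ M.face x × v y ≡ m
    meets {m} x m<5 m≢ = locate (or⁻ {m ≡ᵇ v x} (covers-at (square x) (proj₁ (proj₂ (proj₂ (normal-at x)))) m<5 m≢))
      where
      found : ∀ y → M.face y ≡ M.face x → Holds (m ≡ᵇ v y) → ∃ λ y → M.face y ≡ M.face x × v y ≡ m
      found y f t = y , f , sym (equals t)
      locate : Holds (m ≡ᵇ v x) ⊎ Holds ((m ≡ᵇ v (r x)) ∨ (m ≡ᵇ v (r (r x))) ∨ (m ≡ᵇ v (r (r (r x))))) →
               ∃ λ y → M.face y ≡ M.face x × v y ≡ m
      locate (inj₁ t) = found x refl t
      locate (inj₂ t) with or⁻ {m ≡ᵇ v (r x)} t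
      ... | inj₁ t′ = found (r x) (face-r x) t′
      ... | inj₂ t′ with or⁻ {m ≡ᵇ v (r (r x))} t′
      ...   | inj₁ t″ = found (r (r x)) (trans (face-r _) (face-r x)) t″
      ...   | inj₂ t″ = found (r (r (r x))) (trans (face-r _) (trans (face-r _) (face-r x))) t″

    -- The vertex m has degree at most 4, hence at most 8 flags, whereas five
    -- faces through m contribute two flags each.
    not-everywhere : ∀ m → ¬ (∀ f → ∃ λ y → M.face y ≡ f × v y ≡ m)
    not-everywhere m visit =
      <⇒≱ {10} {12} (m≤m+n 11 1)
        (subst (λ F → F * 2 + 2 ≤ 10) F≡5 (injective⇒≤ {f = uncurry combine ∘ cell ∘ splitAt (M.F * 2)}
          (λ eq → splitAt-inj (M.F * 2) (cell-inj (combine-inj eq)))))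
      where
      flag : Fin M.F × Fin 2 → Flag
      flag (f , 0F) = proj₁ (visit f)
      flag (f , 1F) = M.t1 (proj₁ (visit f))
      flag-m : ∀ p → v (flag p) ≡ m
      flag-m (f , 0F) = proj₂ (proj₂ (visit f))
      flag-m (f , 1F) = trans (v-t1 _) (proj₂ (proj₂ (visit f)))
      flag-face : ∀ p → M.face (flag p) ≡ proj₁ p
      flag-face (f , 0F) = proj₁ (proj₂ (visit f))
      flag-face (f , 1F) = trans (face-t1 _) (proj₁ (proj₂ (visit f)))
      flag-inj : ∀ p q → flag p ≡ flag q → p ≡ q
      flag-inj p q eq with trans (sym (flag-face p)) (trans (cong M.face eq) (flag-face q))
      flag-inj (f , 0F) (_ , 0F) eq | refl = refl
      flag-inj (f , 1F) (_ , 1F) eq | refl = refl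
      flag-inj (f , 0F) (_ , 1F) eq | refl = contradiction (sym eq) (M.fpf1 _)
      flag-inj (f , 1F) (_ , 0F) eq | refl = contradiction eq (M.fpf1 _)
      At : ℕ → Flag → Set
      At w x = v x ≡ m × tip x ≡ w
      -- At most two flags lie along a directed edge; comparison with one fixed flag along it tells
      -- them apart.
      half : ∀ {w} → Dec (∃ (At w)) → Flag → Fin 2
      half (yes (x , _)) z = if does (z Fin.≟ x) then 0F else 1F
      half (no _) z = 0F
      half-inj : ∀ {w} (d : Dec (∃ (At w))) {y z} → At w y → At w z → half d y ≡ half d z → y ≡ z
      half-inj (no none) ay _ _ = contradiction (_ , ay) none
      half-inj (yes (x , xm , xw)) {y} {z} (ym , yw) (zm , zw) eq with y Fin.≟ x | z Fin.≟ x
      ... | yes refl | yes refl = refl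
      ... | no y≢x | no z≢x with same-dart {x} {y} (trans xm (sym ym)) (trans xw (sym yw))
                               | same-dart {x} {z} (trans xm (sym zm)) (trans xw (sym zw))
      ...   | inj₁ y≡x | _ = contradiction y≡x y≢x
      ...   | inj₂ _ | inj₁ z≡x = contradiction z≡x z≢x
      ...   | inj₂ p | inj₂ q = trans p (sym q)
      at? : ∀ w → Dec (∃ (At w))
      at? w = Fin.any? (λ x → (v x ≟ m) ×-dec (tip x ≟ w))
      m<5 : m < 5
      m<5 = subst (_< 5) (flag-m (M.face aFlag , 0F)) (v<5 _)
      -- The second summand occupies the two cells with tip `m`, where no flag at `m` points. In
      -- all, 12 items would be placed injectively into 10 cells.
      cell : Fin (M.F * 2) ⊎ Fin 2 → Fin 5 × Fin 2
      cell (inj₁ i) = let z = flag (remQuot 2 i) in fromℕ< (v<5 (M.t0 z)) , half (at? (tip z)) z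
      cell (inj₂ k) = fromℕ< m<5 , k
      tips : ∀ {x w} {w<5 : w < 5} → fromℕ< (v<5 (M.t0 x)) ≡ fromℕ< w<5 → tip x ≡ w
      tips {x} {w} {w<5} eq = fromℕ<-injective (tip x) w (v<5 (M.t0 x)) w<5 eq
      cell-inj : Inj cell
      cell-inj {inj₁ i} {inj₁ j} eq = cong inj₁ (remQuot-inj {M.F} 2 (flag-inj _ _
        (same (flag-m (remQuot 2 i)) (flag-m (remQuot 2 j)) (tips {flag (remQuot 2 i)} {tip (flag (remQuot 2 j))} {v<5 (M.t0 (flag (remQuot 2 j)))} (cong proj₁ eq)) (cong proj₂ eq))))
        where
        same : ∀ {y z} → v y ≡ m → v z ≡ m → tip y ≡ tip z → half (at? (tip y)) y ≡ half (at? (tip z)) z → y ≡ z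
        same {y} {z} ym zm t h = half-inj (at? (tip y)) (ym , refl) (zm , sym t)
          (trans h (cong (λ w → half (at? w) z) (sym t)))
      cell-inj {inj₁ i} {inj₂ k} eq = contradiction
        (trans (flag-m (remQuot 2 i)) (sym (tips {flag (remQuot 2 i)} {m} {m<5} (cong proj₁ eq)))) (v≢tip _)
      cell-inj {inj₂ k} {inj₁ i} eq = contradiction
        (trans (flag-m (remQuot 2 i)) (sym (tips {flag (remQuot 2 i)} {m} {m<5} (sym (cong proj₁ eq))))) (v≢tip _)
      cell-inj {inj₂ k} {inj₂ l} eq = cong inj₂ (cong proj₂ eq)

    abstract
      avoiding : ∀ {m} → m < 5 → ∃ λ x → miss x ≡ m
      avoiding {m} m<5 with Fin.any? (λ x → miss x ≟ m)
      ... | yes found = found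
      ... | no none = ⊥-elim (not-everywhere m λ f →
              let x , fx = M.face-surj f
                  y , fy , ym = meets x m<5 (λ eq → none (x , sym eq))
              in y , trans fy fx , ym)

    abstract
      root : Fin 5 → Flag
      root i = proj₁ (avoiding (toℕ<n i))

      miss-root : ∀ i → miss (root i) ≡ toℕ i
      miss-root i = proj₂ (avoiding (toℕ<n i))

      σ : Fin 5 → ℕ
      σ i = pattern-of (square (root i))

      σ-pattern : ∀ i → σ i ≡ pattern-of (square (root i))
      σ-pattern i = refl

    -- The five root faces miss different vertices, hence are different; a face that is none of them
    -- would be a sixth.
    face-root : ∀ x → ∃ λ i → toℕ i ≡ miss x × M.face (root i) ≡ M.face x
    face-root x with M.face (root (fromℕ< (miss<5 x))) Fin.≟ M.face x
    ... | yes eq = fromℕ< (miss<5 x) , toℕ-fromℕ< (miss<5 x) , eq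
    ... | no ne = ⊥-elim (<⇒≱ {5} {6} ≤-refl (subst (6 ≤_) F≡5 (injective⇒≤ {f = faces} faces-inj)))
      where
      faces : Fin 6 → Fin M.F
      faces Fin.zero = M.face x
      faces (Fin.suc i) = M.face (root i)
      other : ∀ i → M.face (root i) ≢ M.face x
      other i eq = ne (trans (cong (M.face ∘ root) (toℕ-injective
        (trans (toℕ-fromℕ< (miss<5 x)) (trans (sym (miss-face _ _ eq)) (miss-root i))))) eq)
      faces-inj : Inj faces
      faces-inj {Fin.zero} {Fin.zero} _ = refl
      faces-inj {Fin.zero} {Fin.suc j} eq = contradiction (sym eq) (other j)
      faces-inj {Fin.suc i} {Fin.zero} eq = contradiction eq (other i)
      faces-inj {Fin.suc i} {Fin.suc j} eq = cong Fin.suc (toℕ-injective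
        (trans (sym (miss-root i)) (trans (miss-face _ _ eq) (miss-root j))))

    s : ℕ → ℕ
    s = sel (σ 0F) (σ 1F) (σ 2F) (σ 3F) (σ 4F)

    s-root : ∀ i → s (toℕ i) ≡ σ i
    s-root = sel-at σ

    σ<3 : ∀ i → σ i < 3
    σ<3 i = subst (_< 3) (sym (σ-pattern i)) (<ᵇ⇒< _ 3 (unholds (proj₁ (proj₂ (normal-at (root i))))))

    s<3 : ∀ {m} → m < 5 → s m < 3
    s<3 {m} m<5 = subst (λ m → s m < 3) (toℕ-fromℕ< m<5)
      (subst (_< 3) (sym (s-root (fromℕ< m<5))) (σ<3 (fromℕ< m<5)))

    on-root : ∀ i {u w} → u < 5 → w < 5 → on s (toℕ i) u w ≡ isSide (square (root i)) u w
    on-root i {u} {w} u<5 w<5 = trans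
      (cong₂ (λ m p → isSide (cycle m p) u w) (sym (miss-root i)) (trans (s-root i) (σ-pattern i)))
      (follows-at (square (root i)) (proj₂ (proj₂ (proj₂ (normal-at (root i))))) u<5 w<5)

    on-flag : ∀ x → Holds (on s (miss x) (v x) (tip x))
    on-flag x =
      let i , im , fi = face-root x
          k , xk = face-reach (proj₁ (M.face-orb (root i) x) fi) {root i} {0F} refl
          j , vj , tj = mate-dart k (root i)
      in subst (λ m → Holds (on s m (v x) (tip x))) im
           (subst Holds (sym (on-root i (v<5 x) (v<5 (M.t0 x))))
             (subst₂ (λ u w → Holds (isSide (square (root i)) u w))
               (sym (trans (cong v xk) vj)) (sym (trans (cong tip xk) tj))
               (side-complete (square (root i)) j)))

    on-face : ∀ {m u w} → m < 5 → u < 5 → w < 5 → Holds (on s m u w) → ∃ λ x → miss x ≡ m × v x ≡ u × tip x ≡ w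
    on-face {m} {u} {w} m<5 u<5 w<5 t =
      let i = fromℕ< m<5
          im = toℕ-fromℕ< m<5
          j , aj , nj = side-sound (square (root i))
            (subst Holds (on-root i u<5 w<5) (subst (λ m → Holds (on s m u w)) (sym im) t))
          k , vk , tk = dart-mate j (root i)
          reached = proj₂ (M.face-orb (root i) (faceMate k (root i))) (mate-path k (root i))
      in faceMate k (root i) , trans (sym (miss-face _ _ reached)) (trans (miss-root i) im)
         , trans vk aj , trans tk nj
      where
      mate-path : ∀ k x → Star (Step01 M.t0 M.t1) x (faceMate k x)
      mate-path k x = ∀8 {λ k → Star (Step01 M.t0 M.t1) x (faceMate k x)}
        p₀ (p₀ ◅◅ t₀) p₂ (p₂ ◅◅ t₀) p₄ (p₄ ◅◅ t₀) p₆ (p₆ ◅◅ t₀) k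
        where
        t₀ : ∀ {y} → Star (Step01 M.t0 M.t1) y (M.t0 y)
        t₀ = return (inj₁ refl)
        t₀₁ : ∀ {y} → Star (Step01 M.t0 M.t1) y (r y)
        t₀₁ = inj₁ refl ◅ return (inj₂ refl)
        p₀ : Star (Step01 M.t0 M.t1) x x
        p₀ = ε
        p₂ : Star (Step01 M.t0 M.t1) x (r x)
        p₂ = t₀₁
        p₄ : Star (Step01 M.t0 M.t1) x (r (r x))
        p₄ = p₂ ◅◅ t₀₁
        p₆ : Star (Step01 M.t0 M.t1) x (r (r (r x)))
        p₆ = p₄ ◅◅ t₀₁

    -- An edge on three of the cycles would have three flags along it, in faces missing three
    -- different vertices, whereas only some `x` and `M.t2 x` lie along a directed edge.
    sparse : Holds (sparseᵇ s)
    sparse =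
      below-complete 5 _ λ u<5 → below-complete 5 _ λ w<5 → below-complete 5 _ λ {m₁} m₁<5 → ⇒ᵇ-complete λ on₁ →
      below-complete m₁ _ λ {m₂} m₂<m₁ → ⇒ᵇ-complete λ on₂ → below-complete m₂ _ λ m₃<m₂ →
      refute λ on₃ →
        let m₂<5 = <-trans m₂<m₁ m₁<5
            x₁ , e₁ , p₁ , q₁ = on-face m₁<5 u<5 w<5 on₁
            x₂ , e₂ , p₂ , q₂ = on-face m₂<5 u<5 w<5 on₂
            x₃ , e₃ , p₃ , q₃ = on-face (<-trans m₃<m₂ m₂<5) u<5 w<5 on₃
        in crowded {x₁} {x₂} {x₃}
             (same-dart (trans p₁ (sym p₂)) (trans q₁ (sym q₂)))
             (same-dart (trans p₁ (sym p₃)) (trans q₁ (sym q₃)))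
             (λ eq → <-irrefl (trans (sym e₂) (trans (cong miss eq) e₁)) m₂<m₁)
             (λ eq → <-irrefl (trans (sym e₃) (trans (cong miss eq) e₁)) (<-trans m₃<m₂ m₂<m₁))
             (λ eq → <-irrefl (trans (sym e₃) (trans (cong miss eq) e₂)) m₃<m₂)
      where
      crowded : ∀ {x y z} → y ≡ x ⊎ y ≡ M.t2 x → z ≡ x ⊎ z ≡ M.t2 x → y ≢ x → z ≢ x → z ≢ y → ⊥
      crowded (inj₁ p) _ n _ _ = n p
      crowded (inj₂ _) (inj₁ q) _ n _ = n q
      crowded (inj₂ p) (inj₂ q) _ _ n = n (trans q (sym p))

    -- The corners of a face are distinct, so its eight flags lie along eight different directed
    -- edges, while `x` and `M.t2 x` lie along the same one.
    other-face : ∀ x → M.face (M.t2 x) ≢ M.face x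
    other-face x eq with face-reach (proj₁ (M.face-orb x (M.t2 x)) (sym eq)) {x} {0F} refl
    ... | 0F , e = M.fpf2 x e
    ... | 1F , e = v≢tip x (trans (sym (v-t2 x)) (cong v e))
    ... | 2F , e = proj₁ (proj₂ (quadr x)) (v-vert (trans (sym (v-t2 x)) (cong v e)))
    ... | 3F , e = proj₁ (proj₂ (proj₂ (quadr x))) (v-vert (trans (sym (v-t2 x)) (trans (cong v e) (sym (tip-r (r x))))))
    ... | 4F , e = proj₁ (proj₂ (proj₂ (quadr x))) (v-vert (trans (sym (v-t2 x)) (cong v e)))
    ... | 5F , e = proj₁ (proj₂ (proj₂ (proj₂ (quadr x)))) (v-vert (trans (sym (v-t2 x)) (trans (cong v e) (sym (tip-r (r (r x)))))))
    ... | 6F , e = proj₁ (proj₂ (proj₂ (proj₂ (quadr x)))) (v-vert (trans (sym (v-t2 x)) (cong v e)))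
    ... | 7F , e = tip-t1≢tip x (trans (cong tip (sym (trans e (trans (cong M.t0 (r³ x)) (M.inv0 _))))) (tip-t2 x))

    other-miss : ∀ x → miss x ≢ miss (M.t2 x)
    other-miss x eq =
      let i , im , fi = face-root x
          j , jm , fj = face-root (M.t2 x)
      in other-face x (trans (sym fj) (trans (cong (M.face ∘ root) (toℕ-injective
           (trans jm (trans (sym eq) (sym im))))) fi))

    module Colouring (o : ℕ → Bool) (coherent : Holds (coherentᵇ s o)) where
      ahead : Flag → Bool
      ahead x = isDart (cycle (miss x) (s (miss x))) (v x) (tip x)

      -- The direction of the flag relative to the cycle of its face, corrected by the direction
      -- chosen for that cycle. The first term changes under `t0` and `t1` and the second does not;
      -- for `t2`, which changes the face, coherence applies.
      colour : Flag → Bool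
      colour x = ahead x xor o (miss x)

      flips : ∀ {a b a′ b′} → a′ ≡ not a → b′ ≡ b → a′ xor b′ ≢ a xor b
      flips {true} {true} refl refl ()
      flips {true} {false} refl refl ()
      flips {false} {true} refl refl ()
      flips {false} {false} refl refl ()

      colour-t0 : ∀ x → colour (M.t0 x) ≢ colour x
      colour-t0 x = flips {ahead x}
        (trans (cong₂ (λ m u → isDart (cycle m (s m)) (tip x) u) (miss-t0 x) (cong v (M.inv0 x)))
               (reversal-at {miss x} {s (miss x)} (miss<5 x) (s<3 (miss<5 x)) (v<5 x) (v<5 (M.t0 x)) (on-flag x)))
        (cong o (miss-t0 x))

      colour-t1 : ∀ x → colour (M.t1 x) ≢ colour x
      colour-t1 x = flips {ahead x}
        (trans (cong₂ (λ m u → isDart (cycle m (s m)) u (tip (M.t1 x))) (miss-t1 x) (v-t1 x))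
               (turning-at {miss x} {s (miss x)} (miss<5 x) (s<3 (miss<5 x)) (v<5 x) (v<5 (M.t0 x)) (v<5 (M.t0 (M.t1 x)))
                 (on-flag x)
                 (subst₂ (λ m u → Holds (on s m u (tip (M.t1 x)))) (miss-t1 x) (v-t1 x) (on-flag (M.t1 x)))
                 (tip-t1≢tip x ∘ sym)))
        (cong o (miss-t1 x))

      colour-t2 : ∀ x → colour (M.t2 x) ≢ colour x
      colour-t2 x eq = coherent-at s o {miss x} {miss (M.t2 x)} {v x} {tip x} coherent (miss<5 x) (miss<5 (M.t2 x)) (v<5 x) (v<5 (M.t0 x)) (other-miss x)
        (on-flag x)
        (subst₂ (λ u w → Holds (on s (miss (M.t2 x)) u w)) (v-t2 x) (tip-t2 x) (on-flag (M.t2 x)))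
        (trans (sym eq) (cong₂ (λ u w → isDart (cycle m′ (s m′)) u w xor o m′) (v-t2 x) (tip-t2 x)))
        where m′ = miss (M.t2 x)

      colouring : Orientable M
      colouring = colour , λ x → colour-t0 x , colour-t1 x , colour-t2 x

    orientable : Orientable M
    orientable =
      let o , coherent = orientation-of (σ<3 0F) (σ<3 1F) (σ<3 2F) (σ<3 3F) (σ<3 4F) sparse
      in Colouring.colouring o coherent

open Klein using (module K₅)

-- Vertex counts

-- Both walks run from `p` to `q`, but they pass between `r` and `s` in opposite directions, so the
-- two faces contain a Möbius band.
twisted : ∀ {p q r s R} → r ≢ s → NonOrientable (quad p q r s ∷ quad p q s r ∷ R)
twisted {p} {q} {r} {s} r≢s o coh = clash (o f) (o g)
  (coh (here refl) (there (here refl)) f≢g 0F 0F refl refl)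
  (coh (here refl) (there (here refl)) f≢g 4F 7F refl refl)
  where
  f g : Quad
  f = quad p q r s
  g = quad p q s r
  f≢g : f ≢ g
  f≢g refl = r≢s refl
  clash : ∀ b c → (if b then true else false) ≢ (if c then true else false) →
          (if b then true else false) ≢ (if c then false else true) → ⊥
  clash true true n _ = n refl
  clash true false _ n = n refl
  clash false true _ n = n refl
  clash false false n _ = n refl

-- The constant function 1 in `TwoSided` counts 8 for each face and 4 for each edge.
edges-faces : ∀ {L E} → TwoSided L E → length E ≡ 2 * length L
edges-faces {L} {E} two = *-cancelˡ-≡ _ _ 4 (begin
  4 * length E                            ≡⟨ quadruple (length E) ⟩
  2 * length E + 2 * length E             ≡⟨ cong₂ _+_ (edges E) (edges E) ⟨
  edgeTotal one E + edgeTotal one E       ≡⟨ two one ⟨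
  faceTotal one L + faceTotal one L       ≡⟨ cong₂ _+_ (faces L) (faces L) ⟩
  4 * length L + 4 * length L             ≡⟨ octuple (length L) ⟩
  4 * (2 * length L) ∎)
  where
  open ≡-Reasoning
  one : ℕ → ℕ → ℕ
  one _ _ = 1
  edges : ∀ E → edgeTotal one E ≡ 2 * length E
  edges [] = refl
  edges (_ ∷ E) = trans (cong (2 +_) (edges E)) (sym (*-suc 2 (length E)))
  faces : ∀ L → faceTotal one L ≡ 4 * length L
  faces [] = refl
  faces (quad _ _ _ _ ∷ L) = trans (cong (4 +_) (faces L)) (sym (*-suc 4 (length L)))
  quadruple : ∀ x → 4 * x ≡ 2 * x + 2 * x
  quadruple = solve-∀
  octuple : ∀ x → 4 * x + 4 * x ≡ 4 * (2 * x)
  octuple = solve-∀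

euler-faces : ∀ {n L E g} → TwoSided L E → length E + 4 ≡ 2 * n + 2 * g → n + length L + g ≡ 2 + length E
euler-faces {n} {L} {E} {g} two eq = *-cancelˡ-≡ _ _ 2 (begin
  2 * (n + length L + g)           ≡⟨ left n (length L) g ⟩
  2 * length L + (2 * n + 2 * g)   ≡⟨ cong (2 * length L +_) eq ⟨
  2 * length L + (length E + 4)      ≡⟨ cong (_+ (length E + 4)) (edges-faces {L} {E} two) ⟨
  length E + (length E + 4)   ≡⟨ right (length E) ⟩
  2 * (2 + length E) ∎)
  where
  open ≡-Reasoning
  left : ∀ n f g → 2 * (n + f + g) ≡ 2 * f + (2 * n + 2 * g)
  left = solve-∀
  right : ∀ e → e + (e + 4) ≡ 2 * (2 + e)
  right = solve-∀

euler-ℤ : ∀ v e f g → v + f + g ≡ 2 + e → (ℤ.+ v ℤ.- ℤ.+ e) ℤ.+ ℤ.+ f ≡ ℤ.+ 2 ℤ.- ℤ.+ g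
euler-ℤ v e f g eq = begin
  (ℤ.+ v ℤ.- ℤ.+ e) ℤ.+ ℤ.+ f                        ≡⟨ left (ℤ.+ v) (ℤ.+ e) (ℤ.+ f) (ℤ.+ g) ⟩
  (ℤ.+ v ℤ.+ ℤ.+ f ℤ.+ ℤ.+ g) ℤ.- (ℤ.+ e ℤ.+ ℤ.+ g)  ≡⟨ cong (ℤ._- (ℤ.+ e ℤ.+ ℤ.+ g)) (cong ℤ.+_ eq) ⟩
  (ℤ.+ 2 ℤ.+ ℤ.+ e) ℤ.- (ℤ.+ e ℤ.+ ℤ.+ g)            ≡⟨ right (ℤ.+ e) (ℤ.+ g) ⟩
  ℤ.+ 2 ℤ.- ℤ.+ g ∎
  where
  open ≡-Reasoning
  left : ∀ v e f g → (v ℤ.- e) ℤ.+ f ≡ (v ℤ.+ f ℤ.+ g) ℤ.- (e ℤ.+ g)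
  left = ℤSolver.solve-∀
  right : ∀ e g → (ℤ.+ 2 ℤ.+ e) ℤ.- (e ℤ.+ g) ≡ ℤ.+ 2 ℤ.- g
  right = ℤSolver.solve-∀

euler-ℕ : ∀ v e f g → (ℤ.+ v ℤ.- ℤ.+ e) ℤ.+ ℤ.+ f ≡ ℤ.+ 2 ℤ.- ℤ.+ g → v + f + g ≡ 2 + e
euler-ℕ v e f g eq = ℤ.+-injective (begin
  ℤ.+ v ℤ.+ ℤ.+ f ℤ.+ ℤ.+ g                                  ≡⟨ left (ℤ.+ v) (ℤ.+ e) (ℤ.+ f) (ℤ.+ g) ⟩
  ((ℤ.+ v ℤ.- ℤ.+ e) ℤ.+ ℤ.+ f) ℤ.+ (ℤ.+ e ℤ.+ ℤ.+ g)        ≡⟨ cong (ℤ._+ (ℤ.+ e ℤ.+ ℤ.+ g)) eq ⟩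
  (ℤ.+ 2 ℤ.- ℤ.+ g) ℤ.+ (ℤ.+ e ℤ.+ ℤ.+ g)                    ≡⟨ right (ℤ.+ e) (ℤ.+ g) ⟩
  ℤ.+ 2 ℤ.+ ℤ.+ e ∎)
  where
  open ≡-Reasoning
  left : ∀ v e f g → v ℤ.+ f ℤ.+ g ≡ ((v ℤ.- e) ℤ.+ f) ℤ.+ (e ℤ.+ g)
  left = ℤSolver.solve-∀
  right : ∀ e g → (ℤ.+ 2 ℤ.- g) ℤ.+ (e ℤ.+ g) ≡ ℤ.+ 2 ℤ.+ e
  right = ℤSolver.solve-∀

orientation : Surface → Bool
orientation (S _) = true
orientation (N _) = false

eulerChar-genus : ∀ Σ′ → eulerChar Σ′ ≡ ℤ.+ 2 ℤ.- ℤ.+ eulerGenus Σ′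
eulerChar-genus (S g) = cong (λ x → ℤ.+ 2 ℤ.- x) (sym (ℤ.pos-* 2 g))
eulerChar-genus (N q) = refl

HasQuadrangulation : Surface → ℕ → Set
HasQuadrangulation Σ′ n = ∃ λ (Q : Quadrangulation Σ′) → numVertices {Σ′} Q ≡ n

realise : ∀ Σ′ {n L R E} → 2 ≤ n → Inv n L E → (∀ {q} → q ∈ R → q ∈ L) → Kind (orientation Σ′) L R E →
          length E + 4 ≡ 2 * n + 2 * eulerGenus Σ′ → HasQuadrangulation Σ′ n
realise Σ′ {n} {L} {R} {E} (s≤s (s≤s z≤n)) I R⊆L kind eq =
  (surface , surface-simple , surface-quadrangular , embedded Σ′ kind χ) , refl
  where
  open FromFaces I using (surface; surface-simple; surface-quadrangular; surface-orientable; surface-nonorientable)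
  χ : mapEulerChar surface ≡ eulerChar Σ′
  χ = trans (euler-ℤ n (length E) (length L) (eulerGenus Σ′) (euler-faces {n} {L} {E} {eulerGenus Σ′} (Inv.sides I) eq))
            (sym (eulerChar-genus Σ′))
  embedded : ∀ Σ′ → Kind (orientation Σ′) L R E → mapEulerChar surface ≡ eulerChar Σ′ → EmbeddedIn surface Σ′
  embedded (S g) or χ = surface-orientable or , χ
  embedded (N q) non χ = surface-nonorientable (nonorientable-⊆ R⊆L non) , χ

-- The inequality 4 e + 5 n ≤ n² + 8 says that the complete graph on n
-- vertices has enough edges for Euler genus e.
Fits : ℕ → ℕ → Set
Fits e n = 4 * e + 5 * n ≤ n * n + 8

fits? : ∀ e n → Dec (Fits e n)
fits? e n = 4 * e + 5 * n ≤? n * n + 8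

-- `t` is the number of edges missing from the complete graph, by `slack` and the Euler formula in
-- `state`. As 4e moves in steps of 8 for fixed parity `p`, the bound `slack≤3` says that
-- `p + 2 * h` is the largest Euler genus of its parity that fits `n`.
record Level (or : Bool) (p n : ℕ) : Set where
  field
    odd     : Bool
    d h t   : ℕ
    state   : Tight or odd n d (p + 2 * h)
    pairs   : n ≡ 2 * d + (if odd then 3 else 2)
    slack   : 4 * (p + 2 * h) + 2 * t + 5 * n ≡ n * n + 8
    slack≤3 : t ≤ 3

halfStep : Bool → ℕ
halfStep odd = if odd then 9 else 7

genusStep-half : ∀ odd → genusStep odd ≡ 2 * halfStep odd
genusStep-half true = refl
genusStep-half false = refl

module _ {or p n} (7≤n : 7 ≤ n) (L : Level or p n) where
  open Level L

  private
    2≤n : 2 ≤ n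
    2≤n = ≤-trans (s≤s (s≤s z≤n)) 7≤n

    -- The patch and all `4 * d` tubes together supply every edge at the new vertices, so the number
    -- of missing edges stays `t`.
    full : 4 * (p + 2 * (h + halfStep odd + 4 * d)) + 2 * t + 5 * (8 + n) ≡ (8 + n) * (8 + n) + 8
    full = begin
      4 * (p + 2 * (h + c + 4 * d)) + 2 * t + 5 * (8 + n)
        ≡⟨ regroup p h c d t n ⟩
      (4 * (p + 2 * h) + 2 * t + 5 * n) + (8 * c + 16 * (2 * d) + 40)
        ≡⟨ cong₂ _+_ slack (count {n} {d} odd pairs) ⟩
      (n * n + 8) + (16 * n + 64)
        ≡⟨ square n ⟩
      (8 + n) * (8 + n) + 8 ∎
      where
      open ≡-Reasoning
      c = halfStep odd
      regroup : ∀ p h c d t n → 4 * (p + 2 * (h + c + 4 * d)) + 2 * t + 5 * (8 + n) ≡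
                                (4 * (p + 2 * h) + 2 * t + 5 * n) + (8 * c + 16 * (2 * d) + 40)
      regroup = solve-∀
      square : ∀ n → (n * n + 8) + (16 * n + 64) ≡ (8 + n) * (8 + n) + 8
      square = solve-∀
      count : ∀ {n d} odd → n ≡ 2 * d + (if odd then 3 else 2) → 8 * halfStep odd + 16 * (2 * d) + 40 ≡ 16 * n + 64
      count {d = d} true refl = odd-case d
        where
        odd-case : ∀ d → 8 * 9 + 16 * (2 * d) + 40 ≡ 16 * (2 * d + 3) + 64
        odd-case = solve-∀
      count {d = d} false refl = even-case d
        where
        even-case : ∀ d → 8 * 7 + 16 * (2 * d) + 40 ≡ 16 * (2 * d + 2) + 64
        even-case = solve-∀

  next-level : Patch odd → Level or p (8 + n)
  next-level P = record
    { odd = odd ; d = 4 + d ; h = h + halfStep odd + 4 * d ; t = t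
    ; state = subst (Tight or odd (8 + n) (4 + d))
        (trans (cong (λ x → p + 2 * h + x + 2 * (4 * d)) (genusStep-half odd)) (collect p h (halfStep odd) d))
        (Stage.complete P 2≤n state)
    ; pairs = trans (cong (8 +_) pairs) (shift-pairs d (if odd then 3 else 2))
    ; slack = full
    ; slack≤3 = slack≤3 }
    where
    collect : ∀ p h c d → p + 2 * h + 2 * c + 2 * (4 * d) ≡ p + 2 * (h + c + 4 * d)
    collect = solve-∀
    shift-pairs : ∀ d c → 8 + (2 * d + c) ≡ 2 * (4 + d) + c
    shift-pairs = solve-∀

  reach-level : Patch odd → ∀ {h′} → let e = p + 2 * h′ in
    ¬ Fits e (7 + n) → Fits e (8 + n) →
    ∃₂ λ ts E → length E + 4 ≡ 2 * (8 + n) + 2 * e × Cfg or (8 + n) ts E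
  reach-level P {h′} unfit fit =
    let ts , E , eq , C = Stage.partial P 2≤n state j j≤ in ts , E , trans eq (cong (λ x → 2 * (8 + n) + 2 * x) genus) , C
    where
    c = halfStep odd
    e = p + 2 * h′
    lower : h + c ≤ h′
    -- A smaller `h′` would make e fit `7 + n` vertices: the right side of `Fits` gains 14n + 49 on
    -- the way from n to 7 + n. With n ≥ 7 this and the 8 won by strictness cover 8c for the patch
    -- and 35 for the seven vertices.
    lower = ≮⇒≥ λ h′< → unfit (+-cancelʳ-≤ 8 _ _ (begin
      4 * (p + 2 * h′) + 5 * (7 + n) + 8       ≡⟨ expose p h′ n ⟩
      4 * p + 8 * suc h′ + (5 * n + 35)        ≤⟨ +-monoˡ-≤ (5 * n + 35) (+-monoʳ-≤ (4 * p) (*-monoʳ-≤ 8 h′<)) ⟩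
      4 * p + 8 * (h + c) + (5 * n + 35)       ≤⟨ m≤m+n _ (2 * t) ⟩
      4 * p + 8 * (h + c) + (5 * n + 35) + 2 * t ≡⟨ regroup p h c t n ⟩
      (4 * (p + 2 * h) + 2 * t + 5 * n) + (8 * c + 35) ≡⟨ cong (_+ (8 * c + 35)) slack ⟩
      (n * n + 8) + (8 * c + 35)               ≤⟨ +-monoʳ-≤ (n * n + 8) (+-mono-≤ (≤-trans (half≤ odd) (*-monoʳ-≤ 14 7≤n)) (35≤57)) ⟩
      (n * n + 8) + (14 * n + 57)              ≡⟨ square n ⟩
      (7 + n) * (7 + n) + 8 + 8 ∎))
      where
      open ≤-Reasoning
      expose : ∀ p h n → 4 * (p + 2 * h) + 5 * (7 + n) + 8 ≡ 4 * p + 8 * suc h + (5 * n + 35)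
      expose = solve-∀
      regroup : ∀ p h c t n → 4 * p + 8 * (h + c) + (5 * n + 35) + 2 * t ≡ (4 * (p + 2 * h) + 2 * t + 5 * n) + (8 * c + 35)
      regroup = solve-∀
      square : ∀ n → (n * n + 8) + (14 * n + 57) ≡ (7 + n) * (7 + n) + 8 + 8
      square = solve-∀
      half≤ : ∀ odd → 8 * halfStep odd ≤ 98
      half≤ true = m≤m+n 72 26
      half≤ false = m≤m+n 56 42
      35≤57 : 35 ≤ 57
      35≤57 = m≤m+n 35 22
    upper : h′ ≤ (h + c) + 4 * d
    -- A tube beyond the last one would need four more edges, that is 8 ≤ 2t, but t ≤ 3.
    upper = ≮⇒≥ λ above → <⇒≱ (s≤s (≤-trans (*-monoʳ-≤ 2 slack≤3) (m≤m+n 6 1))) (+-cancelˡ-≤ (4 * p + 8 * (h + c + 4 * d) + 5 * (8 + n)) _ _ (begin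
      4 * p + 8 * (h + c + 4 * d) + 5 * (8 + n) + 8     ≡⟨ expose p (h + c + 4 * d) n ⟩
      4 * p + 8 * suc (h + c + 4 * d) + 5 * (8 + n)     ≤⟨ +-monoˡ-≤ (5 * (8 + n)) (+-monoʳ-≤ (4 * p) (*-monoʳ-≤ 8 above)) ⟩
      4 * p + 8 * h′ + 5 * (8 + n)                      ≡⟨ cong (_+ 5 * (8 + n)) (double p h′) ⟩
      4 * (p + 2 * h′) + 5 * (8 + n)                    ≤⟨ fit ⟩
      (8 + n) * (8 + n) + 8                             ≡⟨ full ⟨
      4 * (p + 2 * (h + c + 4 * d)) + 2 * t + 5 * (8 + n) ≡⟨ regroup p (h + c + 4 * d) t n ⟩
      4 * p + 8 * (h + c + 4 * d) + 5 * (8 + n) + 2 * t ∎))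
      where
      open ≤-Reasoning
      expose : ∀ p x n → 4 * p + 8 * x + 5 * (8 + n) + 8 ≡ 4 * p + 8 * suc x + 5 * (8 + n)
      expose = solve-∀
      double : ∀ p h → 4 * p + 8 * h ≡ 4 * (p + 2 * h)
      double = solve-∀
      regroup : ∀ p x t n → 4 * (p + 2 * x) + 2 * t + 5 * (8 + n) ≡ 4 * p + 8 * x + 5 * (8 + n) + 2 * t
      regroup = solve-∀
    j : ℕ
    j = h′ ∸ (h + c)
    j≤ : j ≤ 4 * d
    j≤ = m≤n+o⇒m∸n≤o h′ (h + c) upper
    genus : p + 2 * h + genusStep odd + 2 * j ≡ e
    genus = trans (cong (λ x → p + 2 * h + x + 2 * j) (genusStep-half odd))
      (trans (collect p h c j) (cong (λ x → p + 2 * x) (m+[n∸m]≡n lower)))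
      where
      collect : ∀ p h c j → p + 2 * h + 2 * c + 2 * j ≡ p + 2 * (h + c + j)
      collect = solve-∀

-- From x to x + 1 the right side grows by 2x + 1, which is at least the 5 on the left once x ≥ 2.
fits-up : ∀ e x → 2 ≤ x → Fits e x → Fits e (suc x)
fits-up e x 2≤x fit = begin
  4 * e + 5 * suc x         ≡⟨ peel e x ⟩
  (4 * e + 5 * x) + 5       ≤⟨ +-mono-≤ fit (+-monoˡ-≤ 1 (*-monoʳ-≤ 2 2≤x)) ⟩
  (x * x + 8) + (2 * x + 1) ≡⟨ square x ⟩
  suc x * suc x + 8 ∎
  where
  open ≤-Reasoning
  peel : ∀ e x → 4 * e + 5 * suc x ≡ (4 * e + 5 * x) + 5
  peel = solve-∀
  square : ∀ x → (x * x + 8) + (2 * x + 1) ≡ suc x * suc x + 8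
  square = solve-∀

fits-up⁺ : ∀ e k x → 2 ≤ x → Fits e x → Fits e (k + x)
fits-up⁺ e zero x _ fit = fit
fits-up⁺ e (suc k) x 2≤x fit = fits-up e (k + x) (≤-trans 2≤x (m≤n+m x k)) (fits-up⁺ e k x 2≤x fit)

-- A quadrangulation with at most `m` vertices makes its own vertex count fit, and by monotonicity
-- `m` would fit as well.
vertex-bound : ∀ Σ′ m → ¬ Fits (eulerGenus Σ′) m → (Q : Quadrangulation Σ′) → suc m ≤ numVertices {Σ′} Q
vertex-bound Σ′ m unfit (M , simple , quadr , embedded) = ≰⇒> λ V≤m → unfit
  (subst (Fits g) (m∸n+n≡m V≤m) (fits-up⁺ g (m ∸ V M) (V M) (≤-trans (s≤s (s≤s z≤n)) 4≤V)
    (genus-bound {g} (euler-ℕ (V M) (E M) (F M) g (trans (char Σ′ embedded) (eulerChar-genus Σ′))))))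
  where
  open Counting M simple quadr
  g = eulerGenus Σ′
  char : ∀ Σ′ → EmbeddedIn M Σ′ → mapEulerChar M ≡ eulerChar Σ′
  char (S _) = proj₂
  char (N _) = proj₂

minimal : ∀ Σ′ m → ¬ Fits (eulerGenus Σ′) m → HasQuadrangulation Σ′ (suc m) → MinQuadVertices Σ′ (suc m)
minimal Σ′ m unfit Q = Q , vertex-bound Σ′ m unfit

sphere-bound : (Q : Quadrangulation (S 0)) → 4 ≤ numVertices {S 0} Q
sphere-bound (M , simple , quadr , _) = Counting.4≤V M simple quadr

klein-bound : (Q : Quadrangulation (N 2)) → 6 ≤ numVertices {N 2} Q
klein-bound Q@(M , simple , quadr , nonor , χ) = ≤∧≢⇒< (vertex-bound (N 2) 4 (toWitnessFalse {a? = fits? 2 4} _) Q) λ 5≡V →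
  nonor (K₅.orientable M simple quadr (sym 5≡V) (F≡5 (sym 5≡V)))
  where
  open Counting M simple quadr
  balance : V M + F M + 2 ≡ 2 + E M
  balance = euler-ℕ (V M) (E M) (F M) 2 χ
  -- Euler's formula gives E = F + 5. Then E ≤ 2F forces F ≥ 5, and E ≤ 10 forces F ≤ 5.
  F≡5 : V M ≡ 5 → F M ≡ 5
  F≡5 V≡5 = ≤-antisym F≤5 5≤F
    where
    E≡F+5 : E M ≡ F M + 5
    E≡F+5 = +-cancelˡ-≡ 2 _ _ (trans (sym balance) (trans (cong (λ v → v + F M + 2) V≡5) (swap-5 (F M))))
      where
      swap-5 : ∀ f → 5 + f + 2 ≡ 2 + (f + 5)
      swap-5 = solve-∀
    5≤F : 5 ≤ F M
    5≤F = +-cancelˡ-≤ (F M) 5 (F M) (subst₂ _≤_ E≡F+5 (cong (F M +_) (+-identityʳ (F M))) E≤2F)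
    F≤5 : F M ≤ 5
    F≤5 = *-cancelʳ-≤ (F M) 5 2 (+-cancelʳ-≤ 15 _ _ (subst (_≤ 25) (double (F M))
      (subst₂ (λ e v → e * 2 + v ≤ v * v) E≡F+5 V≡5 2E+V≤V²)))
      where
      double : ∀ f → (f + 5) * 2 + 5 ≡ f * 2 + 15
      double = solve-∀

-- The ceiling formula

module _ (e m : ℕ) (1≤e : 1 ≤ e) (3≤m : 3 ≤ m) (fit : Fits e (suc m)) (unfit : ¬ Fits e m) where
  private
    e′ i : ℕ
    e′ = e ∸ 1
    i = m ∸ 3
    e≡ : suc e′ ≡ e
    e≡ = m+[n∸m]≡n 1≤e
    m≡ : 3 + i ≡ m
    m≡ = m+[n∸m]≡n 3≤m

    linear : ∀ c k → ℤ.+ (c + k) ℤ.- ℤ.+ c ≡ ℤ.+ k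
    linear c k = trans (ℤ.m-n≡m⊖n (c + k) c) (trans (ℤ.⊖-≥ (m≤m+n c k)) (cong ℤ.+_ (m+n∸m≡n c k)))

    a≡ : ℤ.+ (2 * suc m) ℤ.- ℤ.+ 5 ≡ ℤ.+ (3 + 2 * i)
    a≡ = trans (cong (λ x → ℤ.+ x ℤ.- ℤ.+ 5) (trans (cong (λ m → 2 * suc m) (sym m≡)) (unfold i))) (linear 5 (3 + 2 * i))
      where
      unfold : ∀ i → 2 * suc (3 + i) ≡ 5 + (3 + 2 * i)
      unfold = solve-∀

    b≡ : ℤ.+ (2 * suc m) ℤ.- ℤ.+ 7 ≡ ℤ.+ (1 + 2 * i)
    b≡ = trans (cong (λ x → ℤ.+ x ℤ.- ℤ.+ 7) (trans (cong (λ m → 2 * suc m) (sym m≡)) (unfold i))) (linear 7 (1 + 2 * i))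
      where
      unfold : ∀ i → 2 * suc (3 + i) ≡ 7 + (1 + 2 * i)
      unfold = solve-∀

    upper : 9 + 16 * e′ ≤ (3 + 2 * i) * (3 + 2 * i)
    upper = +-cancelʳ-≤ (20 * i + 87) _ _ (begin
      9 + 16 * e′ + (20 * i + 87)                  ≡⟨ left e′ i ⟩
      4 * (4 * suc e′ + 5 * suc (3 + i))           ≤⟨ *-monoʳ-≤ 4 (subst₂ (λ e m → 4 * e + 5 * suc m ≤ suc m * suc m + 8) (sym e≡) (sym m≡) fit) ⟩
      4 * (suc (3 + i) * suc (3 + i) + 8)          ≡⟨ right i ⟩
      (3 + 2 * i) * (3 + 2 * i) + (20 * i + 87) ∎)
      where
      open ≤-Reasoning
      left : ∀ e i → 9 + 16 * e + (20 * i + 87) ≡ 4 * (4 * suc e + 5 * suc (3 + i))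
      left = solve-∀
      right : ∀ i → 4 * (suc (3 + i) * suc (3 + i) + 8) ≡ (3 + 2 * i) * (3 + 2 * i) + (20 * i + 87)
      right = solve-∀

    lower : (1 + 2 * i) * (1 + 2 * i) < 9 + 16 * e′
    lower = +-cancelʳ-< (20 * i + 67) _ _ (begin-strict
      (1 + 2 * i) * (1 + 2 * i) + (20 * i + 67)    ≡⟨ left i ⟩
      4 * ((3 + i) * (3 + i) + 8)                  <⟨ *-monoʳ-< 4 (subst₂ (λ e m → m * m + 8 < 4 * e + 5 * m) (sym e≡) (sym m≡) (≰⇒> unfit)) ⟩
      4 * (4 * suc e′ + 5 * (3 + i))               ≡⟨ right e′ i ⟩
      9 + 16 * e′ + (20 * i + 67) ∎)
      where
      open ≤-Reasoning
      left : ∀ i → (1 + 2 * i) * (1 + 2 * i) + (20 * i + 67) ≡ 4 * ((3 + i) * (3 + i) + 8)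
      left = solve-∀
      right : ∀ e i → 4 * (4 * suc e + 5 * (3 + i)) ≡ 9 + 16 * e + (20 * i + 67)
      right = solve-∀

  -- Multiplying `Fits e k` by four completes the square to 16e - 7 ≤ (2k - 5)². At k = m + 1 this
  -- is the upper half of the ceiling condition, and its failure at k = m, where 2k - 5 = 2(m + 1) -
  -- 7, is the lower half. Writing e as `suc e′` and m as `3 + i` makes all numbers involved
  -- natural.
  is-ceiling : ∀ {D} → D ≡ ℤ.+ 16 ℤ.* ℤ.+ e ℤ.- ℤ.+ 7 → IsCeilHalf5PlusSqrt D (suc m)
  is-ceiling {D} eq rewrite a≡ | b≡ =
    (ℤ.+≤+ z≤n , subst₂ ℤ._≤_ (sym D≡) (ℤ.pos-* (3 + 2 * i) (3 + 2 * i)) (ℤ.+≤+ upper)) ,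
    inj₂ (subst₂ ℤ._<_ (ℤ.pos-* (1 + 2 * i) (1 + 2 * i)) (sym D≡) (ℤ.+<+ lower))
    where
    D≡ : D ≡ ℤ.+ (9 + 16 * e′)
    D≡ = trans eq (trans (cong (λ e → ℤ.+ 16 ℤ.* ℤ.+ e ℤ.- ℤ.+ 7) (sym e≡))
      (trans (cong (ℤ._- ℤ.+ 7) (trans (sym (ℤ.pos-* 16 (suc e′))) (cong ℤ.+_ (unfold e′)))) (linear 7 (9 + 16 * e′))))
      where
      unfold : ∀ e → 16 * suc e ≡ 7 + (9 + 16 * e)
      unfold = solve-∀

Claim : Surface → Set
Claim Σ′ = ∃ λ n → MinQuadVertices Σ′ n
  × IsCeilHalf5PlusSqrt (ℤ.+ 25 ℤ.- ℤ.+ 16 ℤ.* eulerChar Σ′) n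
  × IsCeilHalf5PlusSqrt (ℤ.+ 16 ℤ.* ℤ.+ eulerGenus Σ′ ℤ.- ℤ.+ 7) n

claim : ∀ Σ′ m → 1 ≤ eulerGenus Σ′ → 3 ≤ m → Fits (eulerGenus Σ′) (suc m) → ¬ Fits (eulerGenus Σ′) m →
        HasQuadrangulation Σ′ (suc m) → Claim Σ′
claim Σ′ m 1≤e 3≤m fit unfit Q = suc m , minimal Σ′ m unfit Q
  , is-ceiling e m 1≤e 3≤m fit unfit
      (trans (cong (λ x → ℤ.+ 25 ℤ.- ℤ.+ 16 ℤ.* x) (eulerChar-genus Σ′)) (discriminant (ℤ.+ e)))
  , is-ceiling e m 1≤e 3≤m fit unfit refl
  where
  e = eulerGenus Σ′
  discriminant : ∀ x → ℤ.+ 25 ℤ.- ℤ.+ 16 ℤ.* (ℤ.+ 2 ℤ.- x) ≡ ℤ.+ 16 ℤ.* x ℤ.- ℤ.+ 7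
  discriminant = ℤSolver.solve-∀

threshold : ∀ e m fuel → ¬ Fits e m → Fits e (fuel + m) → ∃ λ k → ¬ Fits e (k + m) × Fits e (suc (k + m))
threshold e m zero unfit fit = contradiction fit unfit
threshold e m (suc fuel) unfit fit with fits? e (fuel + m)
... | no unfit′ = fuel , unfit′ , fit
... | yes fit′ = threshold e m fuel unfit fit′

fits-eventually : ∀ e m → Fits e ((4 * e + 5) + m)
fits-eventually e m = begin
  4 * e + 5 * (x + m)     ≤⟨ +-monoˡ-≤ (5 * (x + m)) (m≤m*n (4 * e) (x + m)) ⟩
  4 * e * (x + m) + 5 * (x + m) ≡⟨ *-distribʳ-+ (x + m) (4 * e) 5 ⟨
  x * (x + m)             ≤⟨ *-monoˡ-≤ (x + m) (m≤m+n x m) ⟩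
  (x + m) * (x + m)       ≤⟨ m≤m+n _ 8 ⟩
  (x + m) * (x + m) + 8 ∎
  where
  open ≤-Reasoning
  x = 4 * e + 5
  instance
    nonZero : NonZero (x + m)
    nonZero = subst NonZero (shape e m) _
      where
      shape : ∀ e m → suc (4 + 4 * e + m) ≡ 4 * e + 5 + m
      shape = solve-∀

apart? : ∀ s t → Dec (Apart s t)
apart? (p , _ , p′) (r , _ , r′) = ¬? (p ≟ r) ×-dec ¬? (p ≟ r′) ×-dec ¬? (p′ ≟ r) ×-dec ¬? (p′ ≟ r′)

clear? : ∀ odd a z a′ t → Dec (Clear odd a z a′ t)
clear? odd a z a′ (p , _ , p′) = avoids? p ×-dec avoids? p′
  where
  avoids? : ∀ u → Dec (u ≢ a × u ≢ a′ × (T odd → u ≢ z))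
  avoids? u = ¬? (u ≟ a) ×-dec ¬? (u ≟ a′) ×-dec (T? odd →-dec ¬? (u ≟ z))

KindCheck : Bool → (L R : List Quad) → List Edge → Set
KindCheck true  L R E = sort (darts L) ≡ sort (bothWays E)
KindCheck false L R E = NonOrientable R

kindCheck : ∀ or {L R E} → KindCheck or L R E → Kind or L R E
kindCheck true {L} {R} {E} eq = orientedCheck {L} {E} eq
kindCheck false non = non

-- Explicit surfaces

-- Sixteen bits per face: the four hexadecimal digits are its corners. Since
-- these are distinct, no face is 0x0000, where unpacking stops.
unpack : (fuel code : ℕ) → List (Triple × ℕ) → List (Triple × ℕ)
unpack _ zero fs = fs
unpack zero _ fs = fs
unpack (suc fuel) c fs =
  unpack fuel (c / 65536) (((c / 4096 % 16 , c / 256 % 16 , c / 16 % 16) , c % 16) ∷ fs)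

digits : List ℕ → List (Triple × ℕ)
digits = concatMap λ c → unpack 16 c []

decode : List ℕ → List Quad
decode codes = map marked (digits codes)

-- The face 0 1 2 `y` is always the place for the next patch. The reserved faces are listed
-- separately from the others, because in the nonorientable case the witness has to lie among faces
-- that no tube removes.
base : ∀ {or p n} odd d h t y (reserved others : List ℕ) →
  let ms = digits reserved
      rest = decode others
      ts = map proj₁ ms
      L = map marked (((0 , 1 , 2) , y) ∷ ms) ++ rest
  in Closed n L (edgesOf L) → KindCheck or L rest (edgesOf L) →
     length (edgesOf L) + 4 ≡ 2 * n + 2 * (p + 2 * h) →
     n ≡ 2 * d + (if odd then 3 else 2) →
     4 * (p + 2 * h) + 2 * t + 5 * n ≡ n * n + 8 →
     {_ : True (length ts ≟ d)} {_ : True (allPairs? apart? ts)} {_ : True (all? (clear? odd 0 1 2) ts)}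
     {_ : True (t ≤? 3)} → Level or p n
base {or} odd d h t y reserved others C K eu pairs slack {len} {apart} {clear} {t≤3} = record
  { odd = odd ; d = d ; h = h ; t = t
  ; state = tight 0 1 2 _ _ (cfg (((0 , 1 , 2) , y) ∷ digits reserved) refl (decode others) (closed-inv C) (kindCheck or K))
              (toWitness len) (toWitness apart) (toWitness clear) eu
  ; pairs = pairs ; slack = slack ; slack≤3 = toWitness t≤3 }

small-orientable : ∀ g {n} codes → let L = decode codes in Closed n L (edgesOf L) → sort (darts L) ≡ sort (bothWays (edgesOf L)) →
  length (edgesOf L) + 4 ≡ 2 * n + 2 * (2 * g) → {_ : True (2 ≤? n)} → HasQuadrangulation (S g) n
small-orientable g codes C or eq {2≤n} =
  realise (S g) {R = decode codes} (toWitness 2≤n) (closed-inv C) id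
    (orientedCheck {decode codes} {edgesOf (decode codes)} or) eq

small-nonorientable : ∀ q .{{_ : NonZero q}} {n} codes → let L = decode codes in Closed n L (edgesOf L) → NonOrientable L →
  length (edgesOf L) + 4 ≡ 2 * n + 2 * q → {_ : True (2 ≤? n)} → HasQuadrangulation (N q) n
small-nonorientable q codes C non eq {2≤n} =
  realise (N q) {R = decode codes} (toWitness 2≤n) (closed-inv C) id non eq

-- Each two of the faces share an edge: 05 and 14 are run through in opposite directions, 02 twice
-- in the same one. An odd number of reversals around the three faces rules out coherence.
three-face-band : ∀ {R} → NonOrientable (quad 3 5 0 2 ∷ quad 0 5 1 4 ∷ quad 0 2 4 1 ∷ R)
three-face-band o coh = clash (o (quad 3 5 0 2)) (o (quad 0 5 1 4)) (o (quad 0 2 4 1))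
  (coh (here refl) (there (here refl)) (λ ()) 2F 3F refl refl)
  (coh (here refl) (there (there (here refl))) (λ ()) 4F 0F refl refl)
  (coh (there (here refl)) (there (there (here refl))) (λ ()) 4F 7F refl refl)
  where
  clash : ∀ b c d → (if b then true else false) ≢ (if c then false else true) →
    (if b then true else false) ≢ (if d then true else false) →
    (if c then true else false) ≢ (if d then false else true) → ⊥
  clash true true true _ n _ = n refl
  clash true true false _ _ n = n refl
  clash true false _ n _ _ = n refl
  clash false true _ n _ _ = n refl
  clash false false true _ _ n = n refl
  clash false false false _ n _ = n refl

orientable-base-7 : Level true 0 7
orientable-base-7 = base true 2 2 3 3
  (0x3540_5361 ∷ [])
  (0x3251_0526_6204_4502_0631_4216 ∷ [])
  (closed _ refl _ _ _) refl refl refl refl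

orientable-base-8 : Level true 0 8
orientable-base-8 = base false 3 4 0 4
  (0x1435_4256_6370 ∷ [])
  (0x7410_0472_0265_0316_0573_6217_4615_3452_3675_7132 ∷ [])
  (closed _ refl _ _ _) refl refl refl refl

orientable-base-9 : Level true 0 9
orientable-base-9 = base true 3 5 2 7
  (0x3742_5368_7584 ∷ [])
  (0x8731_7861_8162_4821_7106_1564_6304_2057_0765_2435_4025_3451_2603 ∷ [])
  (closed _ refl _ _ _) refl refl refl refl

orientable-base-10 : Level true 0 10
orientable-base-10 = base false 4 7 1 9
  (0x1932_4250_6972_8594 ∷ [])
  (0x9208_4982_5273_2376_0286_3968_9517_9180_6384_5870_3610_7564_7416_4531_6540_3071
    ∷ 0x5781 ∷ [])
  (closed _ refl _ _ _) refl refl refl refl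

orientable-base-11 : Level true 0 11
orientable-base-11 = base true 4 9 1 5
  (0x3742_536a_758a_92a8 ∷ [])
  (0x5243_5a38_5479_5784_5941_0519_4916_4a20_480a_1403_3468_3a09_a107_a629_2187_2760
    ∷ 0x3086_3281_7396_6982_6170_971a ∷ [])
  (closed _ refl _ _ _) refl refl refl refl

orientable-base-12 : Level true 0 12
orientable-base-12 = base false 5 11 2 10
  (0x143a_4057_637b_8495_a9b4 ∷ [])
  (0xa428_4739_5417_4536_4b13_4610_4802_816a_18b3_51a2_1562_719a_a690_7ab9_ba35_592b
    ∷ 0x91b8_6508_b076_3852_9682_b260_2067_8309_3b70_7932 ∷ [])
  (closed _ refl _ _ _) refl refl refl refl

orientable-base-13 : Level true 0 13
orientable-base-13 = base true 5 14 0 4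
  (0x3045_5160_7984_92ac_b4c6 ∷ [])
  (0x4936_9435_4625_3482_42ba_14b8_4157_4a5c_9586_65b2_5617_527b_85a2_509c_29b0_21c3
    ∷ 0x208c_72c0_6cb7_bc13_b68a_c837_c7a3_0ca9_91b3_8b97_9a71_3a67_a870_a106_b1a0_3896
    ∷ 0x0318 ∷ [])
  (closed _ refl _ _ _) refl refl refl refl

orientable-base-14 : Level true 0 14
orientable-base-14 = base false 6 16 3 11
  (0x1739_4251_657c_8294_a6b4_c1d2 ∷ [])
  (0x24ca_c40b_4b2d_4138_6437_a463_49c3_4dc5_45d0_6c8b_3cd5_b36a_cb78_3b10_c720_c2a5
    ∷ 0xc90a_1c08_1b8a_a359_7b5a_dba0_5bd7_ad31_3d92_9326_9d87_da97_9528_1856_d198_5071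
    ∷ 0x2160_5830_7a86_2706_6809 ∷ [])
  (closed _ refl _ _ _) refl refl refl refl

even-base-7 : Level false 0 7
even-base-7 = base true 2 2 3 4
  (0x3146_5362 ∷ [])
  (0x1560_1506_0532_1326_0214_2465 ∷ [])
  (closed _ refl _ _ _) (twisted (λ ())) refl refl refl

even-base-8 : Level false 0 8
even-base-8 = base false 3 4 0 7
  (0x1630_4752_6573 ∷ [])
  (0x0534_0543_3521_4517_1564_1324_4620_0716_3762_6720 ∷ [])
  (closed _ refl _ _ _) (twisted (λ ())) refl refl refl

even-base-9 : Level false 0 9
even-base-9 = base true 3 5 2 7
  (0x3540_5863_7680 ∷ [])
  (0x3178_3187_6754_3628_2650_3742_0341_1725_1802_3482_1405_4852_5647 ∷ [])
  (closed _ refl _ _ _) (twisted (λ ())) refl refl refl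

even-base-10 : Level false 0 10
even-base-10 = base false 4 7 1 9
  (0x1438_4856_6172_8295 ∷ [])
  (0x8673_8637_7895_8930_2807_1847_3962_6915_1974_7906_0754_1603_3645_0425_2350_1243
    ∷ 0x1520 ∷ [])
  (closed _ refl _ _ _) (twisted (λ ())) refl refl refl

even-base-11 : Level false 0 11
even-base-11 = base true 4 9 1 5
  (0x364a_506a_7081_90a3 ∷ [])
  (0x7842_7824_5a86_254a_4518_5638_58a7_5719_159a_3891_2893_6809_2a67_9a74_6921_2976
    ∷ 0x4973_2640_0237_3410_061a_0413 ∷ [])
  (closed _ refl _ _ _) (twisted (λ ())) refl refl refl

even-base-12 : Level false 0 12
even-base-12 = base false 5 11 2 7
  (0x1432_415b_6a70_8396_a1b7 ∷ [])
  (0x08ba_08ab_0a13_8a94_6a37_3a20_2a49_4a90_0465_0179_05b2_0b46_3456_4527_4762_2489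
    ∷ 0x2596_23b8_2b78_1b98_3b61_9b63_7915_1687_5918_3857 ∷ [])
  (closed _ refl _ _ _) (twisted (λ ())) refl refl refl

even-base-13 : Level false 0 13
even-base-13 = base true 5 14 0 3
  (0x3b42_5c69_7685_93a4_b4c7 ∷ [])
  (0x6179_6197_17ab_1943_39a8_9a62_29c8_9ca8_89b2_9b10_5906_12bc_1354_1478_180a_1a65
    ∷ 0x15ac_6843_6c04_26bc_6b83_064c_5c87_7c30_2c37_3a0b_5802_37b5_5ba2_7a50_2450_0b84
    ∷ 0x2a47 ∷ [])
  (closed _ refl _ _ _) (twisted (λ ())) refl refl refl

even-base-14 : Level false 0 14
even-base-14 = base false 6 16 3 9
  (0x1437_485d_6a72_8692_a2b6_c4d2 ∷ [])
  (0x05a8_058a_5ad3_5d72_25b8_5bc7_576c_5c79_5906_56b4_3548_689d_269a_6d03_6730_3619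
    ∷ 0x6c21_2d80_024c_2493_2ba3_3891_8da1_187b_78ca_8c1b_79c0_07b4_7d14_174a_1dc3_1cb0
    ∷ 0x4ab9_9c3b_3b04_acd0_3d9a ∷ [])
  (closed _ refl _ _ _) (twisted (λ ())) refl refl refl

odd-base-7 : Level false 1 7
odd-base-7 = base true 2 2 1 5
  (0x3245_5460 ∷ [])
  (0x2063_2036_0143_3561_3421_1465_2516 ∷ [])
  (closed _ refl _ _ _) (twisted (λ ())) refl refl refl

odd-base-8 : Level false 1 8
odd-base-8 = base false 3 3 2 4
  (0x1236_4251_6372 ∷ [])
  (0x7035_7053_2346_0316_1345_1450_5746_2765_0476 ∷ [])
  (closed _ refl _ _ _) (twisted (λ ())) refl refl refl

odd-base-9 : Level false 1 9
odd-base-9 = base true 3 5 0 6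
  (0x3248_5462_7581 ∷ [])
  (0x1534_1543_2417_4860_4657_4780_1370_1876_3720_0285_3805_2861_5632_0763 ∷ [])
  (closed _ refl _ _ _) (twisted (λ ())) refl refl refl

odd-base-10 : Level false 1 10
odd-base-10 = base false 4 6 3 8
  (0x1632_4358_6273_8096 ∷ [])
  (0x5074_5047_0729_5798_7916_3718_1765_8946_4830_1820_1524_0246_1439_0356_2945_2693 ∷ [])
  (closed _ refl _ _ _) (twisted (λ ())) refl refl refl

odd-base-11 : Level false 1 11
odd-base-11 = base true 4 8 3 9
  (0x3642_5164_7082_97a4 ∷ [])
  (0x03a8_038a_0a71_0742_0276_0635_0975_6718_4781_7893_3758_2869_8954_485a_1439_4953
    ∷ 0x69a2_26a1_5a91_16a3_231a ∷ [])
  (closed _ refl _ _ _) (twisted (λ ())) refl refl refl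

odd-base-12 : Level false 1 12
odd-base-12 = base false 5 11 0 3
  (0x1435_4756_6a73_8a94_a4b7 ∷ [])
  (0x395b_39b5_3b78_374a_3a91_34b1_2389_3640_4950_4865_45a2_241b_5a18_5762_2507_58a1
    ∷ 0x2a08_0ab2_6ab0_9b60_0b81_6b82_0978_8916_7961_6927_1702 ∷ [])
  (closed _ refl _ _ _) (twisted (λ ())) refl refl refl

odd-base-13 : Level false 1 13
odd-base-13 = base true 5 13 2 10
  (0x3249_5964_7982_96a3_b9c1 ∷ [])
  (0x4803_4830_042b_08a7_016b_0716_0629_09b2_027a_295a_4981_79ab_9a31_19c5_1283_237c
    ∷ 0x2635_25ac_18cb_14b5_176a_1c4a_8a47_ac6b_463c_3c8b_45b3_4bc7_7b85_5786_6735_586c ∷ [])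
  (closed _ refl _ _ _) (twisted (λ ())) refl refl refl

odd-base-14 : Level false 1 14
odd-base-14 = base false 6 16 1 13
  (0x1936_4951_6279_8497_a1b4_c6d9 ∷ [])
  (0xa254_a245_2430_1469_467b_34c7_4cad_4db7_4720_48b0_1268_2d78_25c9_290c_2c6b_2b13
    ∷ 0x28a3_7c16_6b0a_1c3d_175d_17d8_1380_1a05_5703_07a6_37ad_0cd8_0689_6d05_cdba_9d5b
    ∷ 0x3c8b_8c59_35a9_9a3b_3658_ab58 ∷ [])
  (closed _ refl _ _ _) (twisted (λ ())) refl refl refl

even-patch : Patch false
even-patch = record
  { m₄ = 8 ; y₄ = 9 ; m₆ = 0 ; y₆ = 9 ; m₈ = 6 ; y₈ = 10 ; m₁₀ = 6 ; y₁₀ = 0 ; m₀ = 9 ; y₀ = 4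
  ; rest = decode (0x12a0_3062_90b8_8052_708b_04b5_9ba2_b975_9874_8a45_a956_a547_ab25_6827
        ∷ 0x6572_6784_2b64_b4a7 ∷ [])
  ; new = (0 , 4) ∷ (0 , 5) ∷ (0 , 6) ∷ (0 , 7) ∷ (0 , 8) ∷ (0 , 9) ∷ (0 , 10) ∷ (0 , 11) ∷ (2 , 4) ∷ (2 , 5)
        ∷ (2 , 6) ∷ (2 , 7) ∷ (2 , 8) ∷ (2 , 9) ∷ (2 , 10) ∷ (2 , 11) ∷ (4 , 5) ∷ (4 , 6) ∷ (4 , 7) ∷ (4 , 8)
        ∷ (4 , 9) ∷ (4 , 10) ∷ (4 , 11) ∷ (5 , 6) ∷ (5 , 7) ∷ (5 , 8) ∷ (5 , 9) ∷ (5 , 10) ∷ (5 , 11) ∷ (6 , 7)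
        ∷ (6 , 8) ∷ (6 , 9) ∷ (6 , 10) ∷ (6 , 11) ∷ (7 , 8) ∷ (7 , 9) ∷ (7 , 10) ∷ (7 , 11) ∷ (8 , 9) ∷ (8 , 10)
        ∷ (8 , 11) ∷ (9 , 10) ∷ (9 , 11) ∷ (10 , 11) ∷ []
  ; replaces = replacement _ _ refl _ ; new-simple = _ ; hub = _ ; attached = _
  ; hinge = λ () ; size = refl }

odd-patch : Patch true
odd-patch = record
  { m₄ = 1 ; y₄ = 6 ; m₆ = 8 ; y₆ = 11 ; m₈ = 0 ; y₈ = 7 ; m₁₀ = 4 ; y₁₀ = 7 ; m₀ = 6 ; y₀ = 10
  ; rest = decode (0x230b_705a_071b_01a6_5047_0ab9_0854_7612_7281_6749_5792_246a_42b8_b459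
        ∷ 0x4a91_869a_4829_1895_b526_198a_ba58_165b ∷ [])
  ; new = (0 , 4) ∷ (0 , 5) ∷ (0 , 6) ∷ (0 , 7) ∷ (0 , 8) ∷ (0 , 9) ∷ (0 , 10) ∷ (0 , 11) ∷ (1 , 4) ∷ (1 , 5)
        ∷ (1 , 6) ∷ (1 , 7) ∷ (1 , 8) ∷ (1 , 9) ∷ (1 , 10) ∷ (1 , 11) ∷ (2 , 4) ∷ (2 , 5) ∷ (2 , 6) ∷ (2 , 7)
        ∷ (2 , 8) ∷ (2 , 9) ∷ (2 , 10) ∷ (2 , 11) ∷ (4 , 5) ∷ (4 , 6) ∷ (4 , 7) ∷ (4 , 8) ∷ (4 , 9) ∷ (4 , 10)
        ∷ (4 , 11) ∷ (5 , 6) ∷ (5 , 7) ∷ (5 , 8) ∷ (5 , 9) ∷ (5 , 10) ∷ (5 , 11) ∷ (6 , 7) ∷ (6 , 8) ∷ (6 , 9)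
        ∷ (6 , 10) ∷ (6 , 11) ∷ (7 , 8) ∷ (7 , 9) ∷ (7 , 10) ∷ (7 , 11) ∷ (8 , 9) ∷ (8 , 10) ∷ (8 , 11) ∷ (9 , 10)
        ∷ (9 , 11) ∷ (10 , 11) ∷ []
  ; replaces = replacement _ _ refl _ ; new-simple = _ ; hub = _ ; attached = _
  ; hinge = λ _ → refl ; size = refl }

S-0 : HasQuadrangulation (S 0) 4
S-0 = small-orientable 0
  (0x0123_3210 ∷ [])
  (closed _ refl _ _ _) refl refl

S-1 : HasQuadrangulation (S 1) 5
S-1 = small-orientable 1
  (0x1230_3420_1402_1324_3104 ∷ [])
  (closed _ refl _ _ _) refl refl

S-3 : HasQuadrangulation (S 3) 8
S-3 = small-orientable 3
  (0x0642_6072_4021_0457_2536_3547_6751_1237_2415_1763_3461_4327 ∷ [])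
  (closed _ refl _ _ _) refl refl

S-6 : HasQuadrangulation (S 6) 10
S-6 = small-orientable 6
  (0x4130_1425_2468_4097_4576_4785_7081_5079_8753_7192_7263_7356_5936_3128_0529_6018
    ∷ 0x0698_3962_9158_2103 ∷ [])
  (closed _ refl _ _ _) refl refl

S-8 : HasQuadrangulation (S 8) 11
S-8 = small-orientable 8
  (0x4086_04a7_0a63_a012_0791_2034_0265_0548_4628_4521_2417_a439_a231_9275_2983_2518
    ∷ 0x387a_5761_7169_a193_958a_3567_5368_a896_7813 ∷ [])
  (closed _ refl _ _ _) refl refl

S-10 : HasQuadrangulation (S 10) 12
S-10 = small-orientable 10
  (0x9506_59ba_05b3_b54a_5a61_51a8_3582_5364_a918_9a34_9672_9320_9213_90b1_b948_6378
    ∷ 0x03a4_31b4_7381_1284_83b6_260a_6271_76b0_802b_087a_6a74_247b_142a_4b70 ∷ [])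
  (closed _ refl _ _ _) refl refl

S-12 : HasQuadrangulation (S 12) 13
S-12 = small-orientable 12
  (0x6a97_a650_7a13_a754_a519_5a32_a473_1a0b_71c5_5634_6741_6178_6089_69b3_064b_4681
    ∷ 0x53c9_b7c1_7b92_794c_8724_49c0_b402_c428_4398_9120_9052_1830_5803_1593_38b2_b5c3
    ∷ 0x82cb_c85b_c210 ∷ [])
  (closed _ refl _ _ _) refl refl

S-13 : HasQuadrangulation (S 13) 13
S-13 = small-orientable 13
  (0x81c9_1876_9124_19bc_01b4_b165_10b3_713c_1752_cb7a_7b63_3ba2_2b8c_ab59_b9c4_b286
    ∷ 0xb058_85a7_a890_8a43_c820_684a_8304_3a5c_a07c_6a94_4c67_c036_4506_9627_0297_5472
    ∷ 0xc532_3569_2a34_0926_3957 ∷ [])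
  (closed _ refl _ _ _) refl refl

S-15 : HasQuadrangulation (S 15) 14
S-15 = small-orientable 15
  (0xa741_7ad1_7139_73a8_37d6_d7b4_4780_b759_79c5_a1d4_da60_a45c_6a35_9ac8_8ab6_a962
    ∷ 0xba28_4692_8615_26d3_36cb_6bdc_65b1_064c_b503_1b0c_4b81_bc9d_b910_1c23_0183_3c49
    ∷ 0xc348_4385_4029_842d_253d_52cd_08d9_0512_d095_1982 ∷ [])
  (closed _ refl _ _ _) refl refl

N-1 : HasQuadrangulation (N 1) 4
N-1 = small-nonorientable 1
  (0x1023_1032_1203 ∷ [])
  (closed _ refl _ _ _) (twisted (λ ())) refl

N-2 : HasQuadrangulation (N 2) 6
N-2 = small-nonorientable 2
  (0x4015_4051_0123_2314_2431_3450 ∷ [])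
  (closed _ refl _ _ _) (twisted (λ ())) refl

N-3 : HasQuadrangulation (N 3) 6
N-3 = small-nonorientable 3
  (0x3502_0514_0241_0134_3452_1352_4512 ∷ [])
  (closed _ refl _ _ _) three-face-band refl

N-6 : HasQuadrangulation (N 6) 8
N-6 = small-nonorientable 6
  (0x2467_2476_4631_2603_3617_0614_1752_1302_2350_0457_0527_3745 ∷ [])
  (closed _ refl _ _ _) (twisted (λ ())) refl

N-9 : HasQuadrangulation (N 9) 9
N-9 = small-nonorientable 9
  (0x7613_7631_1705_3728_2740_4756_5704_4508_0261_3860_5608_2641_2843_6853_0143_1235 ∷ [])
  (closed _ refl _ _ _) (twisted (λ ())) refl

N-12 : HasQuadrangulation (N 12) 10
N-12 = small-nonorientable 12
  (0x9381_9318_8954_1947_5963_6901_0923_4928_4736_3708_0865_0721_2786_7851_5824_0526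
    ∷ 0x2341_1603_2435_1564 ∷ [])
  (closed _ refl _ _ _) (twisted (λ ())) refl

N-15 : HasQuadrangulation (N 15) 11
N-15 = small-nonorientable 15
  (0x2705_2750_2583_2308_02a1_2a81_2846_2651_4897_4610_0419_4719_149a_1576_1873_1307
    ∷ 0x589a_8a60_5639_5a09_387a_7a06_3697_3a69 ∷ [])
  (closed _ refl _ _ _) (twisted (λ ())) refl

N-16 : HasQuadrangulation (N 16) 11
N-16 = small-nonorientable 16
  (0xa954_a945_5937_4981_8906_3921_2978_796a_6901_2837_2705_256a_2a10_0234_2361_5a76
    ∷ 0x6704_5713_1748_1435_150a_368a_78a4_4806_083a ∷ [])
  (closed _ refl _ _ _) (twisted (λ ())) refl

N-19 : HasQuadrangulation (N 19) 12
N-19 = small-nonorientable 19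
  (0x6a18_6a81_1a32_167b_1b43_1209_1374_1480_1970_7ba2_ab64_6b20_2b59_4b50_0673_07a4
    ∷ 0x0365_0839_7a52_4752_7945_5a96_4536_59a8_5823_6892_8934_283a_4962 ∷ [])
  (closed _ refl _ _ _) (twisted (λ ())) refl

N-20 : HasQuadrangulation (N 20) 12
N-20 = small-nonorientable 20
  (0x1398_1389_3957_387b_37a0_3b5a_0328_3a45_3564_2340_7862_68b5_4521_284a_4812_8b2a
    ∷ 0x08ab_2409_1490_4976_0257_29a6_276b_7b9a_7950_9ba1_6a51_6b10_160b_051a ∷ [])
  (closed _ refl _ _ _) (twisted (λ ())) refl

N-21 : HasQuadrangulation (N 21) 12
N-21 = small-nonorientable 21
  (0x5417_5471_146a_4709_469b_4b23_3426_2403_0495_3679_03b7_3b68_3815_39a1_1379_37b5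
    ∷ 0x1920_0125_1206_1856_098a_06a8_082b_0b5a_9b85_257a_6728_2789_8ba7_9a26_ab65 ∷ [])
  (closed _ refl _ _ _) (twisted (λ ())) refl

N-24 : HasQuadrangulation (N 24) 13
N-24 = small-nonorientable 24
  (0x02a6_026a_0641_018c_142b_1b83_1846_1695_152a_1a37_1357_24a5_4a75_45c0_04c7_4ca9
    ∷ 0x48b9_0ab9_0935_05a3_0328_08a7_8ac9_9ab5_5bc6_562c_2b63_bc87_6b38_7b36_8927_6928
    ∷ 0x7c39_372c_9c67 ∷ [])
  (closed _ refl _ _ _) (twisted (λ ())) refl

N-25 : HasQuadrangulation (N 25) 13
N-25 = small-nonorientable 25
  (0x8957_8975_7846_67c3_79a2_7c90_0742_47ab_7a43_371c_1729_09b3_038b_02a1_0138_08c5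
    ∷ 0x05b6_0bc6_8cb2_8b3a_8a14_2816_1853_ab69_3a54_5ac6_4ac2_3692_2391_39c5_5941_9b54
    ∷ 0x2c46_1256_2b15_1b4c ∷ [])
  (closed _ refl _ _ _) (twisted (λ ())) refl

N-26 : HasQuadrangulation (N 26) 13
N-26 = small-nonorientable 26
  (0x2365_2356_26c7_2504_270b_2b79_29c8_28b1_120a_245a_02a4_1a73_1bc4_1495_158c_1ca0
    ∷ 0x0193_1978_1398_5a9b_9a70_ac08_8a37_3a6c_4a67_7cb4_7b35_6759_0c46_9c50_5c34_8964
    ∷ 0x9b34_086b_6b83_6830_584b ∷ [])
  (closed _ refl _ _ _) (twisted (λ ())) refl

N-29 : HasQuadrangulation (N 29) 14
N-29 = small-nonorientable 29
  (0x67d1_671d_6dca_1685_6819_69d5_6a73_362c_2640_4659_cd23_2c71_ac0b_0c5d_5c12_1c83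
    ∷ 0x8c79_2db9_254b_2b83_2978_2847_27b4_0247_7b58_370d_7d45_57a1_8bad_bda0_5b13_1b94
    ∷ 0x8d9a_4d3a_8a01_5930_4890_09a3_4a53_3914_1a50 ∷ [])
  (closed _ refl _ _ _) (twisted (λ ())) refl

N-30 : HasQuadrangulation (N 30) 14
N-30 = small-nonorientable 30
  (0x1b06_1b60_0b37_0194_0485_05a3_078c_03bd_0cd2_0248_0d28_5893_283c_38d6_8d51_1869
    ∷ 0x8c59_6871_1572_12bc_17ba_1a23_1364_14ad_1c4d_24a7_2ba6_2a96_23a9_29dc_6a7d_5acb
    ∷ 0xac5d_5b67_5976_56c3_46c7_4c93_bd49_9d37_7c9b_3d74 ∷ [])
  (closed _ refl _ _ _) (twisted (λ ())) refl

N-31 : HasQuadrangulation (N 31) 14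
N-31 = small-nonorientable 31
  (0xd435_d453_5da2_3d71_6d95_6dc1_5630_3621_167d_26ac_67c8_680c_6c54_6a24_cdba_ad01
    ∷ 0x1db9_0d23_2d87_9d83_2c93_3857_340c_3c8a_3a5b_3b17_1c7b_5c47_4c98_25a7_58a0_5b21
    ∷ 0x59a1_1948_1874_14b0_890b_7a49_4a92_7920_7b40_09b2_8ba0 ∷ [])
  (closed _ refl _ _ _) (twisted (λ ())) refl

-- Assembling all surfaces

patch : ∀ odd → Patch odd
patch true = odd-patch
patch false = even-patch

orientable-level : ∀ k → Level true 0 (7 + k)
orientable-level 0 = orientable-base-7
orientable-level 1 = orientable-base-8
orientable-level 2 = orientable-base-9
orientable-level 3 = orientable-base-10
orientable-level 4 = orientable-base-11
orientable-level 5 = orientable-base-12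
orientable-level 6 = orientable-base-13
orientable-level 7 = orientable-base-14
orientable-level (suc (suc (suc (suc (suc (suc (suc (suc k)))))))) =
  next-level (m≤m+n 7 k) (orientable-level k) (patch _)

even-level : ∀ k → Level false 0 (7 + k)
even-level 0 = even-base-7
even-level 1 = even-base-8
even-level 2 = even-base-9
even-level 3 = even-base-10
even-level 4 = even-base-11
even-level 5 = even-base-12
even-level 6 = even-base-13
even-level 7 = even-base-14
even-level (suc (suc (suc (suc (suc (suc (suc (suc k)))))))) =
  next-level (m≤m+n 7 k) (even-level k) (patch _)

odd-level : ∀ k → Level false 1 (7 + k)
odd-level 0 = odd-base-7
odd-level 1 = odd-base-8
odd-level 2 = odd-base-9
odd-level 3 = odd-base-10
odd-level 4 = odd-base-11
odd-level 5 = odd-base-12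
odd-level 6 = odd-base-13
odd-level 7 = odd-base-14
odd-level (suc (suc (suc (suc (suc (suc (suc (suc k)))))))) =
  next-level (m≤m+n 7 k) (odd-level k) (patch _)

cfg-realised : ∀ Σ′ {n ts E} → 2 ≤ n → Cfg (orientation Σ′) n ts E →
               length E + 4 ≡ 2 * n + 2 * eulerGenus Σ′ → HasQuadrangulation Σ′ n
cfg-realised Σ′ {E = E} 2≤n (cfg ms _ rest inv kind) eq =
  realise Σ′ {R = rest} {E = E} 2≤n inv (∈-++⁺ʳ (map marked ms)) kind eq

from-level : ∀ Σ′ {p n} (L : Level (orientation Σ′) p n) → eulerGenus Σ′ ≡ p + 2 * Level.h L →
             {_ : True (2 ≤? n)} → HasQuadrangulation Σ′ n
from-level Σ′ {n = n} L genus {2≤n} = cfg-realised Σ′ (toWitness 2≤n) (Tight.config (Level.state L))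
  (trans (Tight.euler (Level.state L)) (cong (λ e → 2 * n + 2 * e) (sym genus)))

large : ∀ Σ′ p h → eulerGenus Σ′ ≡ p + 2 * h → 34 ≤ eulerGenus Σ′ →
        (∀ k → Level (orientation Σ′) p (7 + k)) → Claim Σ′
large Σ′ p h genus 34≤e level =
  let k , unfit , fit = threshold e 14 (4 * e + 5) unfit₁₄ (fits-eventually e 14)
      m≡ : k + 14 ≡ 7 + (7 + k)
      m≡ = +-comm k 14
      unfit′ = subst (λ m → ¬ Fits e m) m≡ unfit
      fit′ = subst (λ m → Fits e (suc m)) m≡ fit
      ts , E , count , C = reach-level (m≤m+n 7 k) (level k) (patch _) {h}
        (subst (λ e → ¬ Fits e (7 + (7 + k))) genus unfit′) (subst (λ e → Fits e (8 + (7 + k))) genus fit′)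
  in claim Σ′ (14 + k) (≤-trans (m≤m+n 1 33) 34≤e) (m≤m+n 3 (11 + k)) fit′ unfit′
       (cfg-realised Σ′ (m≤m+n 2 (13 + k)) C (trans count (cong (λ e → 2 * (15 + k) + 2 * e) (sym genus))))
  where
  e = eulerGenus Σ′
  unfit₁₄ : ¬ Fits e 14
  -- 4 · 34 + 5 · 14 = 206 exceeds 14² + 8 = 204, whereas Euler genus 33 gives only 202.
  unfit₁₄ fit = <⇒≱ {204} {206} (m≤m+n 205 1) (≤-trans (+-monoˡ-≤ 70 (*-monoʳ-≤ 4 34≤e)) fit)

tabulated : ∀ Σ′ m → HasQuadrangulation Σ′ (suc m) →
  {_ : True (1 ≤? eulerGenus Σ′)} {_ : True (3 ≤? m)} {_ : True (fits? (eulerGenus Σ′) (suc m))}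
  {_ : False (fits? (eulerGenus Σ′) m)} → Claim Σ′
tabulated Σ′ m Q {p} {q} {r} {s} = claim Σ′ m (toWitness p) (toWitness q) (toWitness r) (toWitnessFalse s) Q

-- The base surfaces serve as entries too: each has the largest Euler genus of its series for its
-- number of vertices. The separate face lists fill the genera in between.
small-S : All (λ g → S g ≢ S 0 → Claim (S g)) (upTo 17)
small-S = (λ ≢S₀ → contradiction refl ≢S₀)
  ∷ (λ _ → tabulated (S 1) 4 S-1)
  ∷ (λ _ → tabulated (S 2) 6 (from-level (S 2) orientable-base-7 refl))
  ∷ (λ _ → tabulated (S 3) 7 S-3)
  ∷ (λ _ → tabulated (S 4) 7 (from-level (S 4) orientable-base-8 refl))
  ∷ (λ _ → tabulated (S 5) 8 (from-level (S 5) orientable-base-9 refl))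
  ∷ (λ _ → tabulated (S 6) 9 S-6)
  ∷ (λ _ → tabulated (S 7) 9 (from-level (S 7) orientable-base-10 refl))
  ∷ (λ _ → tabulated (S 8) 10 S-8)
  ∷ (λ _ → tabulated (S 9) 10 (from-level (S 9) orientable-base-11 refl))
  ∷ (λ _ → tabulated (S 10) 11 S-10)
  ∷ (λ _ → tabulated (S 11) 11 (from-level (S 11) orientable-base-12 refl))
  ∷ (λ _ → tabulated (S 12) 12 S-12)
  ∷ (λ _ → tabulated (S 13) 12 S-13)
  ∷ (λ _ → tabulated (S 14) 12 (from-level (S 14) orientable-base-13 refl))
  ∷ (λ _ → tabulated (S 15) 13 S-15)
  ∷ (λ _ → tabulated (S 16) 13 (from-level (S 16) orientable-base-14 refl))
  ∷ []

small-N : All (λ q → .{{_ : NonZero q}} → N q ≢ N 2 → Claim (N q)) (upTo 34)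
small-N = (λ {{nz}} _ → ⊥-elim-irr (NonZero.nonZero nz))
  ∷ (λ _ → tabulated (N 1) 3 N-1)
  ∷ (λ ≢N₂ → contradiction refl ≢N₂)
  ∷ (λ _ → tabulated (N 3) 5 N-3)
  ∷ (λ _ → tabulated (N 4) 6 (from-level (N 4) even-base-7 refl))
  ∷ (λ _ → tabulated (N 5) 6 (from-level (N 5) odd-base-7 refl))
  ∷ (λ _ → tabulated (N 6) 7 N-6)
  ∷ (λ _ → tabulated (N 7) 7 (from-level (N 7) odd-base-8 refl))
  ∷ (λ _ → tabulated (N 8) 7 (from-level (N 8) even-base-8 refl))
  ∷ (λ _ → tabulated (N 9) 8 N-9)
  ∷ (λ _ → tabulated (N 10) 8 (from-level (N 10) even-base-9 refl))
  ∷ (λ _ → tabulated (N 11) 8 (from-level (N 11) odd-base-9 refl))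
  ∷ (λ _ → tabulated (N 12) 9 N-12)
  ∷ (λ _ → tabulated (N 13) 9 (from-level (N 13) odd-base-10 refl))
  ∷ (λ _ → tabulated (N 14) 9 (from-level (N 14) even-base-10 refl))
  ∷ (λ _ → tabulated (N 15) 10 N-15)
  ∷ (λ _ → tabulated (N 16) 10 N-16)
  ∷ (λ _ → tabulated (N 17) 10 (from-level (N 17) odd-base-11 refl))
  ∷ (λ _ → tabulated (N 18) 10 (from-level (N 18) even-base-11 refl))
  ∷ (λ _ → tabulated (N 19) 11 N-19)
  ∷ (λ _ → tabulated (N 20) 11 N-20)
  ∷ (λ _ → tabulated (N 21) 11 N-21)
  ∷ (λ _ → tabulated (N 22) 11 (from-level (N 22) even-base-12 refl))
  ∷ (λ _ → tabulated (N 23) 11 (from-level (N 23) odd-base-12 refl))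
  ∷ (λ _ → tabulated (N 24) 12 N-24)
  ∷ (λ _ → tabulated (N 25) 12 N-25)
  ∷ (λ _ → tabulated (N 26) 12 N-26)
  ∷ (λ _ → tabulated (N 27) 12 (from-level (N 27) odd-base-13 refl))
  ∷ (λ _ → tabulated (N 28) 12 (from-level (N 28) even-base-13 refl))
  ∷ (λ _ → tabulated (N 29) 13 N-29)
  ∷ (λ _ → tabulated (N 30) 13 N-30)
  ∷ (λ _ → tabulated (N 31) 13 N-31)
  ∷ (λ _ → tabulated (N 32) 13 (from-level (N 32) even-base-14 refl))
  ∷ (λ _ → tabulated (N 33) 13 (from-level (N 33) odd-base-14 refl))
  ∷ []

parity : ∀ q → ∃ λ h → q ≡ 0 + 2 * h ⊎ q ≡ 1 + 2 * h
parity zero = 0 , inj₁ refl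
parity (suc q) with parity q
... | h , inj₁ refl = h , inj₂ refl
... | h , inj₂ refl = suc h , inj₁ (cong suc (sym (+-suc h (h + 0))))

all-surfaces : ∀ Σ′ → Σ′ ≢ S 0 → Σ′ ≢ N 2 → Claim Σ′
all-surfaces (S g) ≢S₀ _ with g <? 17
... | yes g<17 = All.lookup small-S (∈-upTo⁺ g<17) ≢S₀
... | no g≮17 = large (S g) 0 g refl (*-monoʳ-≤ 2 (≮⇒≥ g≮17)) orientable-level
all-surfaces (N q) _ ≢N₂ with q <? 34
... | yes q<34 = All.lookup small-N (∈-upTo⁺ q<34) ≢N₂
... | no q≮34 with parity q
...   | h , inj₁ eq = large (N q) 0 h eq (≮⇒≥ q≮34) even-level
...   | h , inj₂ eq = large (N q) 1 h eq (≮⇒≥ q≮34) odd-level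

theorem1p3 : (∀ (Σ' : Surface) → Σ' ≢ S 0 → Σ' ≢ N 2 →
    ∃ λ (n : ℕ) → MinQuadVertices Σ' n
    × IsCeilHalf5PlusSqrt (ℤ.+ 25 ℤ.- ℤ.+ 16 ℤ.* eulerChar Σ') n
    × IsCeilHalf5PlusSqrt (ℤ.+ 16 ℤ.* ℤ.+ eulerGenus Σ' ℤ.- ℤ.+ 7) n)
    × MinQuadVertices (S 0) 4 × MinQuadVertices (N 2) 6
theorem1p3 = all-surfaces , (S-0 , sphere-bound) , (N-2 , klein-bound)
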